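{- Every finite simple graph $G$ of order $n$ with no isolated vertices and with maximum degree at most $4$ has an odd induced subgraph of order at least $2n/7$. Furthermore, this bound is sharp: there exists a graph with no isolated vertices and maximum degree at most $4$ on $n$ vertices whose largest odd induced subgraph has exactly $2n/7$ vertices.
   Context: A graph is called odd if every vertex has odd degree. An odd induced subgraph of $G$ is an induced subgraph of $G$ (on a nonempty vertex set) which is odd. The order of a graph is its number of vertices. -}

module Defs where

open import Data.Nat using (ℕ; _≤_; _%_)
open import Data.Bool using (Bool; true; false)
open import Data.Fin using (Fin)
open import Data.Fin.Subset using (Subset; _∩_; ∣_∣; Nonempty; _∈_)
open import Data.Vec using (tabulate)
open import Data.Product using (_×_)
open import Relation.Binary.PropositionalEquality using (_≡_)

record Graph (n : ℕ) : Set where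
  field
    Adj    : Fin n → Fin n → Bool
    sym    : ∀ u v → Adj u v ≡ Adj v u
    irrefl : ∀ v → Adj v v ≡ false

open Graph public

nbhd : ∀ {n} → Graph n → Fin n → Subset n
nbhd G v = tabulate (Adj G v)

deg : ∀ {n} → Graph n → Fin n → ℕ
deg G v = ∣ nbhd G v ∣

degIn : ∀ {n} → Graph n → Subset n → Fin n → ℕ
degIn G S v = ∣ S ∩ nbhd G v ∣

NoIsolated : ∀ {n} → Graph n → Set
NoIsolated G = ∀ v → 1 ≤ deg G v

MaxDegAtMost : ∀ {n} → ℕ → Graph n → Set
MaxDegAtMost d G = ∀ v → deg G v ≤ d

IsOddInduced : ∀ {n} → Graph n → Subset n → Set
IsOddInduced G S = Nonempty S × (∀ v → v ∈ S → degIn G S v % 2 ≡ 1)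

{-# OPTIONS --safe #-}
module Submission where

-- Call a vertex low if its degree is 1, 2 or 3, and let n count the vertices that are not isolated.
-- By induction on n there is an odd set S with 7|S| ≥ 2n, and even 7|S| ≥ 2n + 2 if some vertex is low.
-- If no vertex is low, delete one vertex: its neighbours become low.  Otherwise look for a nonempty
-- odd set S such that deleting N[S] loses (by deletion or by becoming isolated) at most
-- (7|S| - 2)/2 vertices, or at most 7 vertices if |S| = 2 and a low vertex survives; then S is
-- added to an odd set of what remains.  Such an S with |S| ≤ 6 exists near a vertex of minimum
-- degree, except that a graph with leaves may look like a corona of a cubic graph; there, the
-- neighbours of the leaves form an odd set.  If 7 vertices are lost for |S| = 2 and no low vertex
-- survives, the lost vertices are a union of components of total order 7, handled on their own.
--
-- The existence of S near a vertex of minimum degree is a finite case analysis: vertices are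
-- revealed one at a time together with their neighbourhoods, and the resulting case tree is a list
-- of moves replayed by a verified checker.
--
-- Sharpness is witnessed by disjoint copies of the complement of the 7-cycle.

open import Defs
open import Data.Bool using (Bool; true; false; not; _∧_; _∨_; if_then_else_)
import Data.Bool as Bool
open import Data.Empty using (⊥; ⊥-elim)
open import Data.Fin using (Fin; zero; suc; _≟_; toℕ; combine; remQuot; _↑ˡ_; _↑ʳ_)
open import Data.Fin.Properties using (all?; remQuot-combine; combine-remQuot)
open import Data.Fin.Subset using (Subset; ∣_∣; _∩_)
open import Data.Fin.Subset.Properties using (anySubset?)
open import Data.List using (List; []; _∷_; _++_; concatMap; upTo)
import Data.List as List
open import Data.List.Membership.Propositional using (_∈_)
open import Data.List.Membership.Propositional.Properties using (∈-map⁺; ∈-concat⁺′; ∈-upTo⁺; ∈-++⁺ˡ; ∈-++⁺ʳ)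
open import Data.List.Relation.Unary.Any using (here; there)
open import Data.Maybe using (Maybe; just; nothing; _>>=_)
open import Data.Nat using (ℕ; zero; suc; _+_; _*_; _∸_; _≤_; _<_; _<ᵇ_; _≤ᵇ_; _≡ᵇ_; _≤?_; _⊓_; _/_; _%_; z≤n; s≤s; s≤s⁻¹)
import Data.Nat as ℕ
open import Data.Nat.DivMod using (m<n*o⇒m/o<n)
open import Data.Nat.Properties hiding (_≟_; _≤?_)
open import Data.Product using (Σ; ∃; _×_; _,_; proj₁; proj₂)
open import Data.Sum using (_⊎_; inj₁; inj₂)
open import Data.Unit using (⊤; tt)
open import Data.Vec using (Vec; []; _∷_; lookup)
import Data.Vec as Vec
open import Data.Vec.Properties using (lookup-map; lookup-zipWith; lookup∘tabulate; map-∘; []=⇒lookup; lookup⇒[]=)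
open import Function using (_∘_)
open import Relation.Nullary using (Dec; ¬_; yes; no; does)
open import Relation.Nullary.Decidable using (dec-true; dec-false; from-yes; from-no; map′; _×-dec_; _→-dec_)
open import Relation.Binary.PropositionalEquality using (_≡_; _≢_; refl; trans; cong; cong₂; subst; subst₂; module ≡-Reasoning) renaming (sym to ≡-sym)
open import Algebra.Properties.Semiring.Sum +-*-semiring using (sum; sum-cong-≗; ∑-distrib-+; ∑-comm; sum-replicate-zero; *-distribˡ-sum)

-- The complement of the 7-cycle meets the bound with equality, so 4-regular graphs leave no slack.
-- A low vertex is what yields slack: the extra 2 in its inequality is exactly the price of one
-- vertex, which is why a regular graph can afford to give one up. Odd sets have even order, so the
-- sets sought near a low vertex have order 2, 4 or 6 and may lose 6, 13 or 20 vertices. For an edge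
-- a seventh loss is affordable only if the remaining graph supplies an extra 2 of its own; this
-- explains the two families of case trees. The main obstacle is that deletion acts at a distance: a
-- vertex with all its neighbours in N(S) is lost too, although it may not have been revealed. The
-- checker bounds the number of such vertices by counting edges, and where this is too weak it
-- reveals one of them. In the corona of a cubic graph, a leaf and its neighbour v lose 8 vertices,
-- one too many: these two, the three other neighbours of v and their leaves. Hence the set of
-- unbounded size there.

private variable
  n k : ℕ

-- Truth values as numbers

⟦_⟧ : Bool → ℕ
⟦ true ⟧ = 1
⟦ false ⟧ = 0

⟦⟧-∧ : ∀ a b → ⟦ a ∧ b ⟧ ≡ ⟦ a ⟧ * ⟦ b ⟧
⟦⟧-∧ true  b = ≡-sym (+-identityʳ _)
⟦⟧-∧ false b = refl

⟦⟧-mono : ∀ {a b} → (a ≡ true → b ≡ true) → ⟦ a ⟧ ≤ ⟦ b ⟧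
⟦⟧-mono {false} h = z≤n
⟦⟧-mono {true}  h = ≤-reflexive (cong ⟦_⟧ (≡-sym (h refl)))

∧-true : ∀ {a b} → a ∧ b ≡ true → a ≡ true × b ≡ true
∧-true {true} h = refl , h

∨-true : ∀ {a b} → a ∨ b ≡ true → a ≡ true ⊎ b ≡ true
∨-true {true}  h = inj₁ refl
∨-true {false} h = inj₂ h

∨-trueʳ : ∀ {a b} → b ≡ true → a ∨ b ≡ true
∨-trueʳ {true}  h = refl
∨-trueʳ {false} h = h

not-true : ∀ {a} → not a ≡ true → a ≡ false
not-true {false} h = refl

¬true⇒false : ∀ {a} → ¬ (a ≡ true) → a ≡ false
¬true⇒false {true}  h = ⊥-elim (h refl)
¬true⇒false {false} h = refl

true≢false : ∀ {a} → a ≡ true → a ≡ false → ⊥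
true≢false refl ()

bool-cases : ∀ a → a ≡ true ⊎ a ≡ false
bool-cases true  = inj₁ refl
bool-cases false = inj₂ refl

positive⁺ : ∀ {m} → 0 < m → (0 <ᵇ m) ≡ true
positive⁺ (s≤s _) = refl

positive⁻ : ∀ {m} → (0 <ᵇ m) ≡ true → 0 < m
positive⁻ {suc m} h = s≤s z≤n

nonpositive⁻ : ∀ {m} → (0 <ᵇ m) ≡ false → m ≡ 0
nonpositive⁻ {zero} h = refl

<ᵇ⁻ : ∀ {m o} → (m <ᵇ o) ≡ true → m < o
<ᵇ⁻ {m} {o} h = <ᵇ⇒< m o (subst Data.Bool.T (≡-sym h) _)

<ᵇ⁺ : ∀ {m o} → m < o → (m <ᵇ o) ≡ true
<ᵇ⁺ {m} {o} h with m <ᵇ o | <⇒<ᵇ h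
... | true | _ = refl

≤ᵇ⁻ : ∀ {m o} → (m ≤ᵇ o) ≡ true → m ≤ o
≤ᵇ⁻ {m} {o} h = ≤ᵇ⇒≤ m o (subst Data.Bool.T (≡-sym h) _)

≤ᵇ⁺ : ∀ {m o} → m ≤ o → (m ≤ᵇ o) ≡ true
≤ᵇ⁺ {m} {o} h with m ≤ᵇ o | ≤⇒≤ᵇ h
... | true | _ = refl

≡ᵇ⁻ : ∀ {m o} → (m ≡ᵇ o) ≡ true → m ≡ o
≡ᵇ⁻ {m} {o} h = ≡ᵇ⇒≡ m o (subst Data.Bool.T (≡-sym h) _)

≡ᵇ⁺ : ∀ {m o} → m ≡ o → (m ≡ᵇ o) ≡ true
≡ᵇ⁺ {m} {o} h with m ≡ᵇ o | ≡⇒≡ᵇ m o h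
... | true | _ = refl

factors-positive : ∀ a b → 0 < ⟦ a ⟧ * ⟦ b ⟧ → a ≡ true × b ≡ true
factors-positive true true h = refl , refl

-- Sums over finite sets

sum-mono : {f g : Fin n → ℕ} → (∀ i → f i ≤ g i) → sum f ≤ sum g
sum-mono {zero}  h = z≤n
sum-mono {suc n} h = +-mono-≤ (h zero) (sum-mono {n} (h ∘ suc))

sum-zero : {f : Fin n → ℕ} → (∀ i → f i ≡ 0) → sum f ≡ 0
sum-zero {n} h = trans (sum-cong-≗ {n} h) (sum-replicate-zero n)

term≤sum : ∀ (f : Fin n → ℕ) i → f i ≤ sum f
term≤sum f zero    = m≤m+n _ _
term≤sum f (suc i) = ≤-trans (term≤sum (f ∘ suc) i) (m≤n+m _ _)

sum-positive : ∀ (f : Fin n → ℕ) → 0 < sum f → ∃ λ i → 0 < f i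
sum-positive {suc n} f h with f zero in eq
... | suc _ = zero , subst (0 <_) (≡-sym eq) (s≤s z≤n)
... | zero  = let i , p = sum-positive (f ∘ suc) h in suc i , p

-- Used to see that a vertex which keeps its full degree under a deletion keeps every single edge.
sum-squeeze : {f g : Fin n → ℕ} → (∀ i → f i ≤ g i) → sum g ≤ sum f → ∀ i → f i ≡ g i
sum-squeeze {suc n} {f} {g} h q = λ
  { zero    → ≤-antisym (h zero) (+-cancelʳ-≤ (sum (g ∘ suc)) _ _
      (≤-trans q (+-monoʳ-≤ (f zero) (sum-mono {n} (h ∘ suc)))))
  ; (suc i) → sum-squeeze {n} (h ∘ suc) (+-cancelˡ-≤ (f zero) _ _
      (≤-trans (+-monoˡ-≤ _ (h zero)) q)) i }

sum-+-≤ : {f g h : Fin n → ℕ} → (∀ i → f i ≤ g i + h i) → sum f ≤ sum g + sum h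
sum-+-≤ {n} {g = g} {h} q = ≤-trans (sum-mono {n} q) (≤-reflexive (∑-distrib-+ g h))

sum-+-≡ : {f g h : Fin n → ℕ} → (∀ i → f i ≡ g i + h i) → sum f ≡ sum g + sum h
sum-+-≡ {n} {g = g} {h} q = trans (sum-cong-≗ {n} q) (∑-distrib-+ g h)

infix 4 _==_
_==_ : Fin n → Fin n → Bool
i == j = does (i ≟ j)

==-refl : (i : Fin n) → (i == i) ≡ true
==-refl i = dec-true (i ≟ i) refl

==⇒≡ : {i j : Fin n} → (i == j) ≡ true → i ≡ j
==⇒≡ {i = i} {j} h with i ≟ j
... | yes p = p

≢⇒== : {i j : Fin n} → i ≢ j → (i == j) ≡ false
≢⇒== {i = i} {j} = dec-false (i ≟ j)

sum-point : ∀ (y : Fin n) (h : Fin n → ℕ) → sum (λ z → ⟦ z == y ⟧ * h z) ≡ h y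
sum-point {suc n} zero    h = trans (cong₂ _+_ (+-identityʳ (h zero)) (sum-zero {n} λ _ → refl)) (+-identityʳ _)
sum-point {suc n} (suc y) h = sum-point y (h ∘ suc)

count : (Fin n → Bool) → ℕ
count p = sum (λ i → ⟦ p i ⟧)

count-witness : ∀ (p : Fin n → Bool) → 0 < count p → ∃ λ i → p i ≡ true
count-witness p h with sum-positive (λ i → ⟦ p i ⟧) h
... | i , q with p i in eq
...   | true = i , eq

count-positive : ∀ (p : Fin n → Bool) i → p i ≡ true → 0 < count p
count-positive p i h = ≤-trans (≤-reflexive (cong ⟦_⟧ (≡-sym h))) (term≤sum (λ z → ⟦ p z ⟧) i)

count-zero : ∀ (p : Fin n → Bool) → count p ≡ 0 → ∀ i → p i ≡ false
count-zero p h i = ¬true⇒false λ q → <-irrefl (≡-sym h) (count-positive p i q)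

search : ∀ (p : Fin n → Bool) → (∃ λ i → p i ≡ true) ⊎ (∀ i → p i ≡ false)
search p with bool-cases (0 <ᵇ count p)
... | inj₁ h = inj₁ (count-witness p (positive⁻ h))
... | inj₂ h = inj₂ (count-zero p (nonpositive⁻ h))

count-unique : ∀ (p : Fin n → Bool) → count p ≤ 1 → ∀ {a b} → p a ≡ true → p b ≡ true → a ≡ b
count-unique {n} p h {a} {b} pa pb with a ≟ b
... | yes q = q
... | no  q = ⊥-elim (<-irrefl refl (≤-trans two h))
  where
  at : ∀ c → sum (λ z → ⟦ z == c ⟧) ≡ 1
  at c = trans (sum-cong-≗ {n} λ z → ≡-sym (*-identityʳ _)) (sum-point c (λ _ → 1))
  bound : ∀ z → ⟦ z == a ⟧ + ⟦ z == b ⟧ ≤ ⟦ p z ⟧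
  bound z with z ≟ a | z ≟ b
  ... | yes refl | yes refl = ⊥-elim (q refl)
  ... | yes refl | no _     = ≤-reflexive (cong ⟦_⟧ (≡-sym pa))
  ... | no _     | yes refl = ≤-reflexive (cong ⟦_⟧ (≡-sym pb))
  ... | no _     | no _     = z≤n
  two : 2 ≤ count p
  two = ≤-trans (≤-reflexive (≡-sym (trans (∑-distrib-+ {n} (λ z → ⟦ z == a ⟧) (λ z → ⟦ z == b ⟧)) (cong₂ _+_ (at a) (at b))))) (sum-mono {n} bound)

-- Sequences of distinct vertices

out : Vec (Fin n) k → Fin n → Bool
out []      z = true
out (e ∷ E) z = not (z == e) ∧ out E z

Distinct : Vec (Fin n) k → Set
Distinct []      = ⊤
Distinct (e ∷ E) = out E e ≡ true × Distinct E

out-≢ : ∀ (E : Vec (Fin n) k) {z} → out E z ≡ true → ∀ i → lookup E i ≢ z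
out-≢ (e ∷ E) {z} h zero    refl = true≢false (==-refl z) (not-true (proj₁ (∧-true h)))
out-≢ (e ∷ E) {z} h (suc i) q    = out-≢ E (proj₂ (∧-true {not (z == e)} h)) i q

out-step : ∀ {E : Vec (Fin n) k} {y} → out E y ≡ true → ∀ z → ⟦ out E z ⟧ ≡ ⟦ z == y ⟧ + ⟦ out (y ∷ E) z ⟧
out-step {y = y} h z with z ≟ y
... | yes refl rewrite h = refl
... | no _ = refl

-- Every count over the graph passes through this equation: the first summand is what the search
-- knows exactly, the second concerns the unrevealed vertices.
sum-split : ∀ (E : Vec (Fin n) k) → Distinct E → ∀ (h : Fin n → ℕ) →
            sum h ≡ sum (λ i → h (lookup E i)) + sum (λ z → ⟦ out E z ⟧ * h z)
sum-split {n} [] _ h = sum-cong-≗ {n} λ z → ≡-sym (*-identityˡ (h z))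
sum-split {n} (e ∷ E) (fresh , d) h = begin
  sum h                                                     ≡⟨ sum-split E d h ⟩
  old + sum (λ z → ⟦ out E z ⟧ * h z)                        ≡⟨ cong (old +_) (sum-+-≡ {n} point) ⟩
  old + (sum (λ z → ⟦ z == e ⟧ * h z) + new)                 ≡⟨ cong (λ x → old + (x + new)) (sum-point e h) ⟩
  old + (h e + new)                                         ≡⟨ +-assoc old (h e) new ⟨
  (old + h e) + new                                         ≡⟨ cong (_+ new) (+-comm old (h e)) ⟩
  (h e + old) + new                                         ∎
  where
  open ≡-Reasoning
  old = sum (λ i → h (lookup E i))
  new = sum (λ z → ⟦ out (e ∷ E) z ⟧ * h z)
  point : ∀ z → ⟦ out E z ⟧ * h z ≡ ⟦ z == e ⟧ * h z + ⟦ out (e ∷ E) z ⟧ * h z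
  point z = trans (cong (_* h z) (out-step {E = E} fresh z)) (*-distribʳ-+ (h z) ⟦ z == e ⟧ _)

mark : Vec (Fin n) k → Vec Bool k → Fin n → Bool
mark []      []      z = false
mark (e ∷ E) (b ∷ S) z = (b ∧ (z == e)) ∨ mark E S z

mark-out : ∀ (E : Vec (Fin n) k) S {z} → out E z ≡ true → mark E S z ≡ false
mark-out []      []      h = refl
mark-out (e ∷ E) (b ∷ S) {z} h with z ≟ e
mark-out (e ∷ E) (true ∷ S)  h | no _ = mark-out E S h
mark-out (e ∷ E) (false ∷ S) h | no _ = mark-out E S h

mark-witness : ∀ (E : Vec (Fin n) k) S {z} → mark E S z ≡ true → ∃ λ i → z ≡ lookup E i × lookup S i ≡ true
mark-witness []      []      ()
mark-witness (e ∷ E) (b ∷ S) {z} h with ∨-true h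
... | inj₁ q = zero , ==⇒≡ (proj₂ (∧-true {b} q)) , proj₁ (∧-true q)
... | inj₂ q = let i , r = mark-witness E S q in suc i , r

mark-lookup : ∀ (E : Vec (Fin n) k) → Distinct E → ∀ S i → mark E S (lookup E i) ≡ lookup S i
mark-lookup (e ∷ E) (fresh , d) (b ∷ S) zero rewrite ==-refl e | mark-out E S fresh = lemma b
  where
  lemma : ∀ b → (b ∧ true) ∨ false ≡ b
  lemma true  = refl
  lemma false = refl
mark-lookup (e ∷ E) (fresh , d) (b ∷ S) (suc i)
  rewrite ≢⇒== (out-≢ E fresh i) = trans (cong (_∨ mark E S (lookup E i)) (lemma b)) (mark-lookup E d S i)
  where
  lemma : ∀ b → b ∧ false ≡ false
  lemma true  = refl
  lemma false = refl

sum-mark : ∀ (E : Vec (Fin n) k) → Distinct E → ∀ S (h : Fin n → ℕ) →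
           sum (λ z → ⟦ mark E S z ⟧ * h z) ≡ sum (λ i → ⟦ lookup S i ⟧ * h (lookup E i))
sum-mark {n} {k} E d S h = begin
  sum (λ z → ⟦ mark E S z ⟧ * h z)  ≡⟨ sum-split E d _ ⟩
  sum (λ i → ⟦ mark E S (lookup E i) ⟧ * h (lookup E i)) + sum (λ z → ⟦ out E z ⟧ * (⟦ mark E S z ⟧ * h z))
    ≡⟨ cong₂ _+_ (sum-cong-≗ {k} λ i → cong (λ b → ⟦ b ⟧ * h (lookup E i)) (mark-lookup E d S i)) (sum-zero {n} none) ⟩
  sum (λ i → ⟦ lookup S i ⟧ * h (lookup E i)) + 0  ≡⟨ +-identityʳ _ ⟩
  sum (λ i → ⟦ lookup S i ⟧ * h (lookup E i))      ∎
  where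
  open ≡-Reasoning
  none : ∀ z → ⟦ out E z ⟧ * (⟦ mark E S z ⟧ * h z) ≡ 0
  none z with out E z in eq
  ... | false = refl
  ... | true rewrite mark-out E S eq = refl

-- Vertex sets and deletion

module Vertices {n : ℕ} (G : Graph n) where

  dg : Fin n → ℕ
  dg z = count (Adj G z)

  attached : Fin n → Bool
  attached z = 0 <ᵇ dg z

  into : (Fin n → Bool) → Fin n → ℕ
  into s z = sum (λ w → ⟦ s w ⟧ * ⟦ Adj G z w ⟧)

  reach : (Fin n → Bool) → Fin n → Bool
  reach s z = s z ∨ (0 <ᵇ into s z)

  Odd : (Fin n → Bool) → Set
  Odd s = ∀ z → s z ≡ true → into s z % 2 ≡ 1

  near-leaf : Fin n → Bool
  near-leaf z = 0 <ᵇ count (λ w → Adj G z w ∧ (dg w ≤ᵇ 1))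

  attached⁺ : ∀ {z w} → Adj G z w ≡ true → attached z ≡ true
  attached⁺ {z} {w} h = positive⁺ (count-positive (Adj G z) w h)

  into⁺ : ∀ s {z w} → s w ≡ true → Adj G z w ≡ true → 0 < into s z
  into⁺ s {z} {w} p q = ≤-trans (≤-reflexive (≡-sym (cong₂ (λ a b → ⟦ a ⟧ * ⟦ b ⟧) p q)))
                                (term≤sum (λ w → ⟦ s w ⟧ * ⟦ Adj G z w ⟧) w)

  into⁻ : ∀ s {z} → 0 < into s z → ∃ λ w → s w ≡ true × Adj G z w ≡ true
  into⁻ s {z} h = let w , q = sum-positive (λ w → ⟦ s w ⟧ * ⟦ Adj G z w ⟧) h in w , factors-positive _ _ q

-- The vertex set stays `Fin n`: deleted vertices merely become isolated. As only non-isolated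
-- vertices are counted, the induction never renumbers vertices.
delete : Graph n → (Fin n → Bool) → Graph n
delete G d .Adj u v = Adj G u v ∧ (not (d u) ∧ not (d v))
delete G d .sym u v with Adj G u v | Adj G v u | sym G u v | d u | d v
... | false | _ | refl | _     | _     = refl
... | true  | _ | refl | true  | true  = refl
... | true  | _ | refl | true  | false = refl
... | true  | _ | refl | false | true  = refl
... | true  | _ | refl | false | false = refl
delete G d .irrefl v rewrite irrefl G v = refl

-- Here `reach G s` is N[s]. Its vertices are isolated after the deletion, so this covers both kinds
-- of loss, the deleted vertices and those cut off.
lost : Graph n → (Fin n → Bool) → Fin n → Bool
lost G s z = attached G z ∧ not (attached (delete G (reach G s)) z)
  where open Vertices

-- A vertex outside N[s] loses an edge only if the other end lies in N[s], and that end is not in s,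
-- since its neighbours would then be in N[s]. So a vertex that is cut off has all its neighbours in
-- N(s).
lost⁻ : ∀ (G : Graph n) s {z} → lost G s z ≡ true → Vertices.reach G s z ≡ false →
        ∀ w → Adj G z w ≡ true → s w ≡ false × 0 < Vertices.into G s w
lost⁻ G s {z} h far w adj = unmarked , hit
  where
  open Vertices
  unmarked : s w ≡ false
  unmarked = ¬true⇒false λ q → true≢false (∨-trueʳ {s z} (positive⁺ (into⁺ G s q adj))) far
  hit : 0 < into G s w
  hit with bool-cases (reach G s w)
  ... | inj₂ q = ⊥-elim (true≢false
    (attached⁺ (delete G (reach G s)) {z} {w} (cong₂ _∧_ adj (cong₂ _∧_ (cong not far) (cong not q))))
    (not-true (proj₂ (∧-true {attached G z} h))))
  ... | inj₁ q with ∨-true q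
  ...   | inj₁ p = ⊥-elim (true≢false p unmarked)
  ...   | inj₂ p = positive⁻ p

-- The search
--
-- A state records k revealed vertices, newest first.  A mask is a set of revealed vertices; the trace
-- of a vertex is the mask of its revealed neighbours.  The rows are the traces of the revealed
-- vertices.  The table lists, for the nonempty traces P, the number of unrevealed vertices with trace P.

Mask : ℕ → Set
Mask = Vec Bool

Table : ℕ → Set
Table k = List (Mask k × ℕ)

Rows : ℕ → Set
Rows k = Vec (Mask k) k

State : ℕ → Set
State k = Rows k × Table k

size : ∀ {k} → Mask k → ℕ
size [] = 0
size (b ∷ P) = ⟦ b ⟧ + size P

common : ∀ {k} → Mask k → Mask k → ℕ
common [] [] = 0
common (a ∷ P) (b ∷ S) = ⟦ a ∧ b ⟧ + common P S

meets : ∀ {k} → Mask k → Mask k → Bool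
meets P S = 0 <ᵇ common P S

within : ∀ {k} → Mask k → Mask k → Bool
within [] [] = true
within (a ∷ P) (b ∷ F) = (not a ∨ b) ∧ within P F

empty : ∀ {k} → Mask k
empty {zero}  = []
empty {suc k} = false ∷ empty

-- Membership of the oldest revealed vertex.
anchor : ∀ {k} → Mask k → Bool
anchor [] = false
anchor (b ∷ []) = b
anchor (_ ∷ P@(_ ∷ _)) = anchor P

weigh : ∀ {k} → (Mask k → ℕ) → Table k → ℕ
weigh g [] = 0
weigh g ((P , c) ∷ T) = c * g P + weigh g T

module _ {k} (rows : Rows k) where

  evenAt : Mask k → Fin k → Bool
  evenAt S i = lookup S i ∧ not (common (lookup rows i) S % 2 ≡ᵇ 1)

  oddSet : Mask k → Bool
  oddSet S = (count (evenAt S) ≡ᵇ 0) ∧ (0 <ᵇ size S)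

  touched : Mask k → Mask k
  touched S = Vec.map (λ r → meets r S) rows

  -- Traces of vertices outside N[S] whose revealed neighbours all lie in N(S): only these can become
  -- isolated when N[S] is deleted.
  stray : Mask k → Mask k → Bool
  stray S P = not (meets P S) ∧ within P (touched S)

  module _ (T : Table k) where

    -- A necessary condition for a revealed vertex outside N[S] to become isolated. Its unrevealed
    -- neighbours have it in their traces, hence all occur in the table.
    stuck : Mask k → Fin k → Bool
    stuck S i = within (lookup rows i) (touched S)
              ∧ (weigh (λ P → ⟦ not (meets P S) ∧ lookup P i ⟧) T ≡ᵇ 0)

    -- The lost vertices, except for unrevealed vertices outside N[S] that become isolated.
    known : Mask k → ℕ
    known S = sum (λ i → ⟦ lookup S i ∨ (meets (lookup rows i) S ∨ stuck S i) ⟧)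
            + weigh (λ P → ⟦ meets P S ⟧) T

    -- A bound on the degree sum of those exceptions, whose unrevealed neighbours all lie in N(S).
    room : Mask k → ℕ
    room S = weigh (λ P → ⟦ stray S P ⟧ * size P) T + weigh (λ P → ⟦ meets P S ⟧ * (4 ∸ size P)) T

    -- All vertices in L have degree at most 1, and the oldest vertex has at least three neighbours
    -- adjacent to L.
    crowned : Mask k → Bool
    crowned L =
      (sum (λ i → ⟦ lookup L i ⟧ * (size (lookup rows i) + weigh (λ P → ⟦ lookup P i ⟧) T ∸ 1)) ≡ᵇ 0)
      ∧ (2 <ᵇ sum (λ i → ⟦ anchor (lookup rows i) ∧ meets (lookup rows i) L ⟧)
              + weigh (λ P → ⟦ anchor P ∧ meets P L ⟧) T)

-- win S: few vertices are lost with S.  crown L: the oldest vertex is as in a corona.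
-- new i: reveal a vertex of the i-th class.  cut S: reveal an unrevealed vertex that becomes
-- isolated when N[S] is deleted.  Masks are written in binary, the newest vertex being the lowest bit.
data Move : Set where
  win new cut crown : ℕ → Move

pick : ∀ {k} → ℕ → Table k → Maybe (Mask k × Table k)
pick _ [] = nothing
pick zero ((P , zero) ∷ T) = nothing
pick zero ((P , suc c) ∷ T) = just (P , (P , c) ∷ T)
pick (suc i) (x ∷ T) = pick i T >>= λ { (Q , T′) → just (Q , x ∷ T′) }

picks : ∀ {k} → Table k → List (Mask k × Table k)
picks [] = []
picks ((P , c) ∷ T) = (P , (P , c ∸ 1) ∷ T) ∷ List.map (λ { (Q , T′) → Q , (P , c) ∷ T′ }) (picks T)

-- Empty classes are never entered, so the indices in `new` refer to nonempty classes.
add : ∀ {k} → Mask k → ℕ → Table k → Table k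
add P zero T = T
add P (suc c) T = (P , suc c) ∷ T

decode : ∀ k → ℕ → Mask k
decode zero n = []
decode (suc k) n = (n % 2 ≡ᵇ 1) ∷ decode k (n / 2)

-- `lo` bounds the degrees of non-isolated vertices from below, `lim s` is the number of vertices
-- that an odd set of order s may lose, and `fits` tells which orders are still possible for the
-- graph.
module Check (lo : ℕ) (lim : ℕ → ℕ) (fits : ℕ → Bool) where

  module _ {k} (ok : Mask k → Bool) where
    -- All ways to split the classes into neighbours and non-neighbours of the vertex being revealed,
    -- which has at most b further neighbours; its degree is between lo and 4.
    splits : ℕ → Table k → List (Table (suc k))
    splits b [] = if b + lo ≤ᵇ 4 then [] ∷ [] else []
    splits b ((P , c) ∷ T) =
      concatMap (λ j → List.map (λ R → add (true ∷ P) j (add (false ∷ P) (c ∸ j) R)) (splits (b ∸ j) T))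
                (upTo (suc (if ok P then c ⊓ b else 0)))

    grow : Rows k → Mask k → Table k → List (State (suc k))
    grow rows Q T =
      concatMap (λ m → List.map (λ R → (false ∷ Q) ∷ Vec.zipWith _∷_ Q rows , add (true ∷ empty) m R)
                                (splits (4 ∸ size Q ∸ m) T))
                (upTo (suc (if ok empty then 4 ∸ size Q else 0)))

  -- A vertex with four revealed neighbours has no unrevealed ones.
  open4 : ∀ {k} → Mask k → Bool
  open4 P = size P <ᵇ 4

  module _ {k} (rows : Rows k) (T : Table k) (S : Mask k) where

    wins cuts : Bool
    wins = oddSet rows S ∧ (room rows T S <ᵇ lo * (suc (lim (size S)) ∸ known rows T S))
    cuts = oddSet rows S ∧ (known rows T S ≤ᵇ lim (size S))

    inner : Mask k → Bool
    inner P = open4 P ∧ meets P S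

    isolates : List (State (suc k))
    isolates = grow inner rows empty T ++
      concatMap (λ { (Q , T′) → if stray rows S Q then grow inner rows Q T′ else [] }) (picks T)

  checkAll : ∀ {k} → (State k → List Move → Maybe (List Move)) → List (State k) → List Move → Maybe (List Move)
  checkAll chk [] ms = just ms
  checkAll chk (s ∷ ss) ms = chk s ms >>= checkAll chk ss

  -- Returns the moves left over by a successful case; f bounds the depth of the case tree.
  check step : ℕ → ∀ {k} → State k → List Move → Maybe (List Move)

  check zero    _  _  = nothing
  check (suc f) {k} st ms = if fits (k + weigh (λ _ → 1) (proj₂ st)) then step f st ms else just ms

  step f st [] = nothing
  step f {k} (rows , T) (win m ∷ ms) = if wins rows T (decode k m) then just ms else nothing
  step f {k} (rows , T) (crown m ∷ ms) = if crowned rows T (decode k m) then just ms else nothing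
  step f (rows , T) (new m ∷ ms) =
    pick m T >>= λ { (Q , T′) → checkAll (check f) (grow open4 rows Q T′) ms }
  step f {k} (rows , T) (cut m ∷ ms) =
    if cuts rows T (decode k m) then checkAll (check f) (isolates rows T (decode k m)) ms else nothing

-- Arithmetic of masks

size-map : ∀ {A : Set} (f : A → Bool) (E : Vec A k) → size (Vec.map f E) ≡ sum (λ i → ⟦ f (lookup E i) ⟧)
size-map f []      = refl
size-map f (e ∷ E) = cong (⟦ f e ⟧ +_) (size-map f E)

size-lookup : (S : Mask k) → size S ≡ sum (λ i → ⟦ lookup S i ⟧ * 1)
size-lookup []      = refl
size-lookup (b ∷ S) = cong₂ _+_ (≡-sym (*-identityʳ ⟦ b ⟧)) (size-lookup S)

common-map : ∀ {A : Set} (f : A → Bool) (E : Vec A k) S →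
             common (Vec.map f E) S ≡ sum (λ i → ⟦ lookup S i ⟧ * ⟦ f (lookup E i) ⟧)
common-map f []      []      = refl
common-map f (e ∷ E) (b ∷ S) = cong₂ _+_ (trans (⟦⟧-∧ (f e) b) (*-comm ⟦ f e ⟧ ⟦ b ⟧)) (common-map f E S)

within-map : ∀ {A : Set} {f g : A → Bool} → (∀ e → f e ≡ true → g e ≡ true) →
             (E : Vec A k) → within (Vec.map f E) (Vec.map g E) ≡ true
within-map h [] = refl
within-map {f = f} {g} h (e ∷ E) with f e in eq
... | true rewrite h e eq = within-map h E
... | false = within-map h E

size-empty : ∀ k → size (empty {k}) ≡ 0
size-empty zero    = refl
size-empty (suc k) = size-empty k

size-zero : (P : Mask k) → size P ≡ 0 → P ≡ empty
size-zero []          h = refl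
size-zero (false ∷ P) h = cong (false ∷_) (size-zero P h)

meets-empty : (S : Mask k) → meets empty S ≡ false
meets-empty []      = refl
meets-empty (b ∷ S) = meets-empty S

lookup-empty : (i : Fin k) → lookup empty i ≡ false
lookup-empty zero    = refl
lookup-empty (suc i) = lookup-empty i

anchor-empty : ∀ k → anchor (empty {k}) ≡ false
anchor-empty zero          = refl
anchor-empty (suc zero)    = refl
anchor-empty (suc (suc k)) = anchor-empty (suc k)

anchor-∷ : ∀ b (P : Mask (suc k)) → anchor (b ∷ P) ≡ anchor P
anchor-∷ b (_ ∷ _) = refl

-- Tables as partitions of the seen vertices

module Traces {n : ℕ} (G : Graph n) where
  open Vertices G

  trace : Vec (Fin n) k → Fin n → Mask k
  trace E z = Vec.map (Adj G z) E

  -- Disjoint union in numerical form: one equation says both that the parts cover and that they do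
  -- not overlap, and it can be summed directly.
  record _≐_⊕_ (q p r : Fin n → Bool) : Set where
    constructor splitting
    field at : ∀ z → ⟦ q z ⟧ ≡ ⟦ p z ⟧ + ⟦ r z ⟧
  open _≐_⊕_

  -- The entries of the table are the blocks of a partition of the vertices satisfying q,
  -- each listed with its common trace and its size.
  Classes : Vec (Fin n) k → Table k → (Fin n → Bool) → Set
  Classes E []            q = ∀ z → q z ≡ false
  Classes E ((P , c) ∷ T) q = Σ (Fin n → Bool) λ p → Σ (Fin n → Bool) λ r →
    (∀ z → p z ≡ true → trace E z ≡ P) × (count p ≡ c) ×
    (q ≐ p ⊕ r) × Classes E T r

  ⟦⟧-injective : ∀ {a b} → ⟦ a ⟧ ≡ ⟦ b ⟧ → a ≡ b
  ⟦⟧-injective {false} {false} h = refl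
  ⟦⟧-injective {true}  {true}  h = refl

  Classes-cong : ∀ (E : Vec (Fin n) k) T {q q′} → (∀ z → q z ≡ q′ z) → Classes E T q → Classes E T q′
  Classes-cong E []      h cl = λ z → trans (≡-sym (h z)) (cl z)
  Classes-cong E (_ ∷ T) h (p , r , a , b , c , d) =
    p , r , a , b , splitting (λ z → trans (cong ⟦_⟧ (≡-sym (h z))) (at c z)) , d

  Classes-add : ∀ (E : Vec (Fin n) k) T {q} p r {P c} → (∀ z → p z ≡ true → trace E z ≡ P) → count p ≡ c →
    q ≐ p ⊕ r → Classes E T r → Classes E (add P c T) q
  Classes-add E T p r {c = suc c} h₁ h₂ h₃ cl = p , r , h₁ , h₂ , h₃ , cl
  Classes-add E T {q} p r {c = zero} h₁ h₂ h₃ cl =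
    Classes-cong E T (λ z → ≡-sym (⟦⟧-injective (trans (at h₃ z) (cong (λ b → ⟦ b ⟧ + ⟦ r z ⟧) (count-zero p h₂ z))))) cl

  -- Through this equation the numbers computed from a table become counts of actual vertices.
  Classes-weigh : ∀ (E : Vec (Fin n) k) T {q} → Classes E T q → ∀ g →
                  sum (λ z → ⟦ q z ⟧ * g (trace E z)) ≡ weigh g T
  Classes-weigh E [] cl g = sum-zero {n} λ z → cong (λ b → ⟦ b ⟧ * g (trace E z)) (cl z)
  Classes-weigh E ((P , c) ∷ T) {q} (p , r , h₁ , h₂ , h₃ , cl) g =
    trans (sum-+-≡ {n} point) (cong₂ _+_ block (Classes-weigh E T cl g))
    where
    point : ∀ z → ⟦ q z ⟧ * g (trace E z) ≡ g P * ⟦ p z ⟧ + ⟦ r z ⟧ * g (trace E z)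
    point z with p z | h₁ z | at h₃ z
    ... | true  | a | b rewrite b | a refl = cong₂ _+_ (≡-sym (*-identityʳ (g P))) refl
    ... | false | a | b rewrite b | *-zeroʳ (g P) = refl
    block : sum (λ z → g P * ⟦ p z ⟧) ≡ c * g P
    block = trans (≡-sym (*-distribˡ-sum {n} (g P) (λ z → ⟦ p z ⟧))) (trans (cong (g P *_) h₂) (*-comm (g P) c))

  drop : (Fin n → Bool) → Fin n → Fin n → Bool
  drop q y z = q z ∧ not (z == y)

  count-drop : ∀ p {y c} → p y ≡ true → count p ≡ suc c → count (drop p y) ≡ c
  count-drop p {y} {c} h q = suc-injective (trans (≡-sym total) q)
    where
    point : ∀ z → ⟦ p z ⟧ ≡ ⟦ z == y ⟧ * 1 + ⟦ drop p y z ⟧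
    point z with z ≟ y
    ... | yes refl rewrite h = refl
    ... | no _ with p z
    ...   | true  = refl
    ...   | false = refl
    total : count p ≡ suc (count (drop p y))
    total = trans (sum-+-≡ {n} point) (cong (_+ count (drop p y)) (sum-point y (λ _ → 1)))

  drop-other : ∀ q y → q y ≡ false → ∀ z → drop q y z ≡ q z
  drop-other q y h z with z ≟ y
  ... | yes refl rewrite h = refl
  ... | no _ with q z
  ...   | true  = refl
  ...   | false = refl

  drop-split : ∀ {q p r} → q ≐ p ⊕ r → ∀ y → drop q y ≐ drop p y ⊕ drop r y
  drop-split {q} {p} {r} h y .at z with q z | p z | r z | at h z | z == y
  ... | false | false | false | _ | _     = refl
  ... | true  | true  | false | _ | true  = refl
  ... | true  | true  | false | _ | false = refl
  ... | true  | false | true  | _ | true  = refl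
  ... | true  | false | true  | _ | false = refl

  split-cases : ∀ {q p r} → q ≐ p ⊕ r → ∀ {y} → q y ≡ true →
                (p y ≡ true × r y ≡ false) ⊎ (p y ≡ false × r y ≡ true)
  split-cases {q} {p} {r} h {y} e with q y | p y | r y | at h y
  ... | true | true  | false | _ = inj₁ (refl , refl)
  ... | true | false | true  | _ = inj₂ (refl , refl)

  left⇒ : ∀ {q p r} → q ≐ p ⊕ r → ∀ {y} → p y ≡ true → q y ≡ true × r y ≡ false
  left⇒ {q} {p} {r} h {y} e with q y | p y | r y | at h y
  ... | true  | true | false | _ = refl , refl
  ... | true  | true | true  | ()
  ... | false | true | _     | ()

  right⇒ : ∀ {q p r} → q ≐ p ⊕ r → ∀ {y} → r y ≡ true → q y ≡ true × p y ≡ false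
  right⇒ {q} {p} {r} h {y} e with q y | p y | r y | at h y
  ... | true  | false | true | _ = refl , refl
  ... | true  | true  | true | ()
  ... | false | true  | true | ()
  ... | false | false | true | ()

  drop-right : ∀ {q p r} → q ≐ p ⊕ r → ∀ {y} → p y ≡ false → drop q y ≐ p ⊕ drop r y
  drop-right {p = p} {r} h {y} e .at z =
    trans (at (drop-split h y) z) (cong (λ b → ⟦ b ⟧ + ⟦ drop r y z ⟧) (drop-other p y e z))

  -- Serves `cut`, where the vertex is given but its class is not, so that every class must be
  -- tried. For `new` the class is given and `pick-sound` chooses the vertex.
  picks-complete : ∀ (E : Vec (Fin n) k) T {q} → Classes E T q → ∀ {y} → q y ≡ true →
    ∃ λ T′ → (trace E y , T′) ∈ picks T × Classes E T′ (drop q y)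
  picks-complete E [] cl h = ⊥-elim (true≢false h (cl _))
  picks-complete E ((P , c) ∷ T) (p , r , h₁ , h₂ , h₃ , cl) {y} h with split-cases h₃ h
  ... | inj₁ (py , ry) rewrite h₁ y py =
    _ , here refl , drop p y , drop r y , (λ z e → h₁ z (proj₁ (∧-true e))) ,
    count-drop p py (trans h₂ (≡-sym (m+[n∸m]≡n (subst (0 <_) h₂ (count-positive p y py))))) , drop-split h₃ y , Classes-cong E T (λ z → ≡-sym (drop-other r y ry z)) cl
  ... | inj₂ (py , ry) =
    let T′ , mem , cl′ = picks-complete E T cl ry
    in _ , there (∈-map⁺ (λ { (Q , T′) → Q , (P , c) ∷ T′ }) mem) , p , drop r y , h₁ , h₂ , drop-right h₃ py , cl′

  pick-sound : ∀ (E : Vec (Fin n) k) m T {Q T′} → pick m T ≡ just (Q , T′) → ∀ {q} → Classes E T q →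
    ∃ λ y → q y ≡ true × trace E y ≡ Q × Classes E T′ (drop q y)
  pick-sound E zero ((P , suc c) ∷ T) refl (p , r , h₁ , h₂ , h₃ , cl) =
    let y , py = count-witness p (subst (0 <_) (≡-sym h₂) (s≤s z≤n))
        qy , ry = left⇒ h₃ py
    in y , qy , h₁ y py , drop p y , drop r y , (λ z e → h₁ z (proj₁ (∧-true e))) ,
       count-drop p py h₂ , drop-split h₃ y , Classes-cong E T (λ z → ≡-sym (drop-other r y ry z)) cl
  pick-sound E (suc m) ((P , c) ∷ T) e (p , r , h₁ , h₂ , h₃ , cl) with pick m T in eq
  pick-sound E (suc m) ((P , c) ∷ T) refl (p , r , h₁ , h₂ , h₃ , cl) | just (Q , T′) =
    let y , ry , ty , cl′ = pick-sound E m T eq cl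
        qy , py = right⇒ h₃ ry
    in y , qy , ty , p , drop r y , h₁ , h₂ , drop-right h₃ py , cl′

-- Soundness of the checker

zipWith-∷-map : ∀ {A : Set} (f : A → Bool) (g : A → Mask k) {j} (E : Vec A j) →
                Vec.zipWith Vec._∷_ (Vec.map f E) (Vec.map g E) ≡ Vec.map (λ e → f e Vec.∷ g e) E
zipWith-∷-map f g []      = refl
zipWith-∷-map f g (e ∷ E) = cong ((f e ∷ g e) ∷_) (zipWith-∷-map f g E)

map-cong : ∀ {A B : Set} {f g : A → B} → (∀ x → f x ≡ g x) → (E : Vec A k) → Vec.map f E ≡ Vec.map g E
map-cong h []      = refl
map-cong h (e ∷ E) = cong₂ _∷_ (h e) (map-cong h E)

positive-+ : ∀ b m → (0 <ᵇ ⟦ b ⟧ + m) ≡ b ∨ (0 <ᵇ m)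
positive-+ true  m = refl
positive-+ false m = refl

-- The assumptions describe a counterexample: every nonempty odd set loses more than `lim` allows,
-- and `root` is not as in a corona. An accepted list of moves shows that no such graph contains the
-- starting state.
module Soundness {n : ℕ} (G : Graph n) (lo : ℕ) (lim : ℕ → ℕ) (fits : ℕ → Bool) (root : Fin n)
  (min-degree : ∀ z → Vertices.attached G z ≡ true → lo ≤ Vertices.dg G z)
  (max-degree : ∀ z → Vertices.dg G z ≤ 4)
  (fits⁺ : ∀ m → m ≤ count (Vertices.attached G) → fits m ≡ true)
  (fails : ∀ s → Vertices.Odd G s → 0 < count s → lim (count s) < count (lost G s))
  (uncrowned : count (λ z → Adj G z root ∧ Vertices.near-leaf G z) ≤ 2)
  where

  open Vertices G
  open Traces G
  open Check lo lim fits

  dg-split : ∀ (E : Vec (Fin n) k) → Distinct E → ∀ y →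
             dg y ≡ size (trace E y) + sum (λ z → ⟦ out E z ⟧ * ⟦ Adj G y z ⟧)
  dg-split E d y = trans (sum-split E d _) (cong (_+ sum (λ z → ⟦ out E z ⟧ * ⟦ Adj G y z ⟧)) (≡-sym (size-map (Adj G y) E)))

  into-mark : ∀ (E : Vec (Fin n) k) → Distinct E → ∀ S z → into (mark E S) z ≡ common (trace E z) S
  into-mark E d S z = trans (sum-mark E d S _) (≡-sym (common-map (Adj G z) E S))

  count-mark : ∀ (E : Vec (Fin n) k) → Distinct E → ∀ S → count (mark E S) ≡ size S
  count-mark E d S = trans (sum-cong-≗ {n} λ z → ≡-sym (*-identityʳ ⟦ mark E S z ⟧))
                           (trans (sum-mark E d S (λ _ → 1)) (≡-sym (size-lookup S)))

  seen : Vec (Fin n) k → Fin n → Bool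
  seen E z = out E z ∧ (0 <ᵇ size (trace E z))

  -- `rooted` identifies the oldest revealed vertex with `root` through its adjacencies, which is
  -- all that `crown` asks for; `alive` serves the count behind `fits`.
  record Models (st : State (suc k)) : Set where
    field
      E        : Vec (Fin n) (suc k)
      distinct : Distinct E
      rows≡    : proj₁ st ≡ Vec.map (trace E) E
      alive    : ∀ i → attached (lookup E i) ≡ true
      rooted   : ∀ z → anchor (trace E z) ≡ Adj G z root
      classes  : Classes E (proj₂ st) (seen E)

  -- The budget `b` starts as 4 minus the neighbours already placed. What is left at the end,
  -- `rest`, is therefore 4 minus the degree of `y`, and `rest + lo ≤ 4` is the lower bound on this
  -- degree.
  splits-complete : ∀ (E : Vec (Fin n) k) y ok T {q} → Classes E T q →
    (∀ z → q z ≡ true → Adj G y z ≡ true → ok (trace E z) ≡ true) →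
    ∀ b rest → b ≡ sum (λ z → ⟦ q z ⟧ * ⟦ Adj G y z ⟧) + rest → rest + lo ≤ 4 →
    ∃ λ T′ → T′ ∈ splits ok b T × Classes (y ∷ E) T′ q
  splits-complete E y ok [] {q} cl hok b rest refl h
    rewrite sum-zero {n} (λ z → cong (λ x → ⟦ x ⟧ * ⟦ Adj G y z ⟧) (cl z)) | ≤ᵇ⁺ h = [] , here refl , cl
  splits-complete E y ok ((P , c) ∷ T) {q} (p , r , h₁ , h₂ , h₃ , cl) hok b rest eq h =
    let R , mem , cl′ = splits-complete E y ok T cl (λ z e → hok z (proj₁ (right⇒ h₃ e))) (b ∸ j) rest
                          (trans (cong (_∸ j) b≡) (m+n∸m≡n j _)) h
    in add (true ∷ P) j (add (false ∷ P) (c ∸ j) R)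
     , ∈-concat⁺′ (∈-map⁺ _ mem) (∈-map⁺ _ (∈-upTo⁺ (s≤s j≤)))
     , Classes-add (y ∷ E) _ pᵗ m (λ z e → cong₂ _∷_ (trans (sym G z y) (proj₂ (∧-true {p z} e))) (h₁ z (proj₁ (∧-true e))))
         refl (splitting split₁)
         (Classes-add (y ∷ E) R pᶠ r (λ z e → cong₂ _∷_ (trans (sym G z y) (not-true (proj₂ (∧-true {p z} e)))) (h₁ z (proj₁ (∧-true e))))
           (≡-sym (trans (cong (_∸ j) c≡) (m+n∸m≡n j _))) (splitting split₂) cl′)
    where
    pᵗ pᶠ m : Fin n → Bool
    pᵗ z = p z ∧ Adj G y z
    pᶠ z = p z ∧ not (Adj G y z)
    m z = q z ∧ not (pᵗ z)
    j = count pᵗ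
    split₁ : ∀ z → ⟦ q z ⟧ ≡ ⟦ pᵗ z ⟧ + ⟦ m z ⟧
    split₁ z with q z | p z | r z | _≐_⊕_.at h₃ z | Adj G y z
    ... | false | false | false | _ | _ = refl
    ... | true | true | false | _ | true = refl
    ... | true | true | false | _ | false = refl
    ... | true | false | true | _ | _ = refl
    split₂ : ∀ z → ⟦ m z ⟧ ≡ ⟦ pᶠ z ⟧ + ⟦ r z ⟧
    split₂ z with q z | p z | r z | _≐_⊕_.at h₃ z | Adj G y z
    ... | false | false | false | _ | _ = refl
    ... | true | true | false | _ | true = refl
    ... | true | true | false | _ | false = refl
    ... | true | false | true | _ | _ = refl
    split₃ : ∀ z → ⟦ p z ⟧ ≡ ⟦ pᵗ z ⟧ + ⟦ pᶠ z ⟧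
    split₃ z with p z | Adj G y z
    ... | false | _ = refl
    ... | true | true = refl
    ... | true | false = refl
    split₄ : ∀ z → ⟦ q z ⟧ * ⟦ Adj G y z ⟧ ≡ ⟦ pᵗ z ⟧ + ⟦ r z ⟧ * ⟦ Adj G y z ⟧
    split₄ z with q z | p z | r z | _≐_⊕_.at h₃ z | Adj G y z
    ... | false | false | false | _ | _ = refl
    ... | true | true | false | _ | true = refl
    ... | true | true | false | _ | false = refl
    ... | true | false | true | _ | _ = refl
    c≡ : c ≡ j + count pᶠ
    c≡ = trans (≡-sym h₂) (sum-+-≡ {n} split₃)
    b≡ : b ≡ j + (sum (λ z → ⟦ r z ⟧ * ⟦ Adj G y z ⟧) + rest)
    b≡ = trans eq (trans (cong (_+ rest) (sum-+-≡ {n} split₄)) (+-assoc j _ rest))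
    j≤ : j ≤ (if ok P then c ⊓ b else 0)
    j≤ with ok P in e
    ... | true  = ⊓-glb (subst (j ≤_) (≡-sym c≡) (m≤m+n j _)) (subst (j ≤_) (≡-sym b≡) (m≤m+n j _))
    ... | false = ≤-reflexive (sum-zero {n} λ z → cong ⟦_⟧ (¬true⇒false (no-edge z)))
      where
      no-edge : ∀ z → ¬ (pᵗ z ≡ true)
      no-edge z t = let pz , az = ∧-true {p z} t in
        true≢false (subst (λ X → ok X ≡ true) (h₁ z pz) (hok z (proj₁ (left⇒ h₃ pz)) az)) e

  -- The neighbours of `y` never seen before form one new class, whose trace is `y` alone; every old
  -- class splits according to adjacency to `y`. Since `grow` lists all sizes allowed by the
  -- degrees, the true ones are among them.
  grow-complete : ∀ {rows : Rows (suc k)} {T} (M : Models (rows , T)) ok T₁ {y} → let E = Models.E M in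
    out E y ≡ true → attached y ≡ true →
    (∀ z → out E z ≡ true → Adj G y z ≡ true → ok (trace E z) ≡ true) →
    Classes E T₁ (drop (seen E) y) →
    ∃ λ st → st ∈ grow ok rows (trace E y) T₁ × Models st
  grow-complete {k} {rows} M ok T₁ {y} fresh ay hok cl =
    let R , mem , cl′ = splits-complete E y ok T₁ cl
          (λ z e → hok z (proj₁ (∧-true (proj₁ (∧-true e))))) (4 ∸ size Q ∸ m) rest budget rest+lo≤4
    in _ , ∈-concat⁺′ (∈-map⁺ _ mem) (∈-map⁺ _ (∈-upTo⁺ (s≤s m≤)))
     , record
       { E        = y ∷ E
       ; distinct = fresh , distinct
       ; rows≡    = cong₂ _∷_ (cong (_∷ Q) (≡-sym (irrefl G y)))
                     (trans (cong (Vec.zipWith _∷_ Q) rows≡)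
                       (trans (zipWith-∷-map (Adj G y) (trace E) E) (map-cong (λ e → cong (_∷ trace E e) (sym G y e)) E)))
       ; alive    = λ { zero → ay ; (suc i) → alive i }
       ; rooted   = λ z → trans (anchor-∷ _ (trace E z)) (rooted z)
       ; classes  = Classes-add (y ∷ E) R ν (drop (seen E) y)
                     (λ z e → cong₂ _∷_ (trans (sym G z y) (proj₂ (∧-true {out E z} (proj₁ (∧-true e)))))
                                        (unseen (proj₂ (∧-true {out E z ∧ Adj G y z} e))))
                     refl (splitting split₁) cl′
       }
    where
    open Models M
    Q = trace E y
    ν : Fin n → Bool
    ν z = (out E z ∧ Adj G y z) ∧ not (0 <ᵇ size (trace E z))
    m = count ν
    -- The degree that `y` lacks to 4, carried along as the unspent part of the budget.
    rest = 4 ∸ dg y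
    inside = sum (λ z → ⟦ drop (seen E) y z ⟧ * ⟦ Adj G y z ⟧)
    unseen : ∀ {z} → not (0 <ᵇ size (trace E z)) ≡ true → trace E z ≡ empty
    unseen e = size-zero _ (nonpositive⁻ (not-true e))
    split₁ : ∀ z → ⟦ seen (y ∷ E) z ⟧ ≡ ⟦ ν z ⟧ + ⟦ drop (seen E) y z ⟧
    split₁ z rewrite positive-+ (Adj G z y) (size (trace E z)) | sym G z y with z ≟ y
    ... | yes refl rewrite irrefl G z with out E z | 0 <ᵇ size (trace E z)
    ...   | true  | true  = refl
    ...   | true  | false = refl
    ...   | false | _     = refl
    split₁ z | no _ with Adj G y z | out E z | 0 <ᵇ size (trace E z)
    ...   | true  | true  | true  = refl
    ...   | true  | true  | false = refl
    ...   | true  | false | _     = refl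
    ...   | false | true  | true  = refl
    ...   | false | true  | false = refl
    ...   | false | false | _     = refl
    split₂ : ∀ z → ⟦ out E z ⟧ * ⟦ Adj G y z ⟧ ≡ ⟦ ν z ⟧ + ⟦ drop (seen E) y z ⟧ * ⟦ Adj G y z ⟧
    split₂ z with z ≟ y
    ... | yes refl rewrite irrefl G z with out E z | 0 <ᵇ size (trace E z)
    ...   | true  | true  = refl
    ...   | true  | false = refl
    ...   | false | _     = refl
    split₂ z | no _ with Adj G y z | out E z | 0 <ᵇ size (trace E z)
    ...   | true  | true  | true  = refl
    ...   | true  | true  | false = refl
    ...   | true  | false | _     = refl
    ...   | false | true  | true  = refl
    ...   | false | true  | false = refl
    ...   | false | false | _     = refl
    four : 4 ≡ size Q + (m + (inside + rest))
    four = trans (≡-sym (m+[n∸m]≡n (max-degree y))) (trans (cong (_+ rest)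
      (trans (dg-split E distinct y) (cong (size Q +_) (sum-+-≡ {n} split₂))))
      (trans (+-assoc (size Q) _ rest) (cong (size Q +_) (+-assoc m inside rest))))
    left : 4 ∸ size Q ≡ m + (inside + rest)
    left = trans (cong (_∸ size Q) four) (m+n∸m≡n (size Q) _)
    budget : 4 ∸ size Q ∸ m ≡ inside + rest
    budget = trans (cong (_∸ m) left) (m+n∸m≡n m _)
    rest+lo≤4 : rest + lo ≤ 4
    rest+lo≤4 = ≤-trans (+-monoʳ-≤ rest (min-degree y ay)) (≤-reflexive (m∸n+n≡m (max-degree y)))
    m≤ : m ≤ (if ok empty then 4 ∸ size Q else 0)
    m≤ with ok empty in e
    ... | true  = subst (m ≤_) (≡-sym left) (m≤m+n m _)
    ... | false = ≤-reflexive (sum-zero {n} λ z → cong ⟦_⟧ (¬true⇒false (no-edge z)))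
      where
      no-edge : ∀ z → ¬ (ν z ≡ true)
      no-edge z t = let a , b = ∧-true {out E z ∧ Adj G y z} t ; c , d = ∧-true {out E z} a in
        true≢false (subst (λ X → ok X ≡ true) (unseen b) (hok z c d)) e

  module Reading {k} {rows : Rows (suc k)} {T : Table (suc k)} (M : Models (rows , T)) where
    open Models M

    row : ∀ i → lookup rows i ≡ trace E (lookup E i)
    row i = trans (cong (λ R → lookup R i) rows≡) (lookup-map i (trace E) E)

    column : ∀ i z → lookup (trace E z) i ≡ Adj G z (lookup E i)
    column i z = lookup-map i (Adj G z) E

    -- The table omits the unrevealed vertices with empty trace, so `g` has to vanish there.
    weigh-out : ∀ g → g empty ≡ 0 → sum (λ z → ⟦ out E z ⟧ * g (trace E z)) ≡ weigh g T
    weigh-out g h = trans (sum-cong-≗ {n} point) (Classes-weigh E T classes g)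
      where
      point : ∀ z → ⟦ out E z ⟧ * g (trace E z) ≡ ⟦ seen E z ⟧ * g (trace E z)
      point z with 0 <ᵇ size (trace E z) in eq
      ... | false rewrite size-zero (trace E z) (nonpositive⁻ eq) | h
                        | *-zeroʳ ⟦ out E z ⟧ | *-zeroʳ ⟦ out E z ∧ false ⟧ = refl
      ... | true with out E z
      ...   | true  = refl
      ...   | false = refl

    seen-attached : ∀ z → seen E z ≡ true → attached z ≡ true
    seen-attached z h = positive⁺ (≤-trans (positive⁻ {size (trace E z)} (proj₂ (∧-true {out E z} h)))
      (≤-trans (m≤m+n (size (trace E z)) _) (≤-reflexive (≡-sym (dg-split E distinct z)))))

    -- Justifies skipping a state that does not satisfy `fits`: its revealed and seen vertices are
    -- non-isolated and would already be too many.
    attached-bound : suc k + weigh (λ _ → 1) T ≤ count attached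
    attached-bound = ≤-trans (+-mono-≤ (ones (suc k) λ i → cong ⟦_⟧ (alive i))
      (≤-trans (≤-reflexive (≡-sym (Classes-weigh E T classes (λ _ → 1)))) (sum-mono {n} point)))
      (≤-reflexive (≡-sym (sum-split E distinct (λ z → ⟦ attached z ⟧))))
      where
      ones : ∀ m {f : Fin m → ℕ} → (∀ i → f i ≡ 1) → m ≤ sum f
      ones zero    h = z≤n
      ones (suc m) h = +-mono-≤ (≤-reflexive (≡-sym (h zero))) (ones m (h ∘ suc))
      point : ∀ z → ⟦ seen E z ⟧ * 1 ≤ ⟦ out E z ⟧ * ⟦ attached z ⟧
      point z with seen E z in eq
      ... | false = z≤n
      ... | true rewrite proj₁ (∧-true {out E z} eq) | seen-attached z eq = s≤s z≤n

    module Cutting (S : Mask (suc k)) (odd : oddSet rows S ≡ true) where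

      s : Fin n → Bool
      s = mark E S

      s-Odd : Odd s
      s-Odd z h with mark-witness E S h
      ... | i , refl , Sᵢ = trans (cong (_% 2) (trans (into-mark E distinct S _) (cong (λ R → common R S) (≡-sym (row i)))))
        (≡ᵇ⁻ (¬even (count-zero (evenAt rows S) (≡ᵇ⁻ (proj₁ (∧-true odd))) i) Sᵢ))
        where
        ¬even : ∀ {a b} → a ∧ not b ≡ false → a ≡ true → b ≡ true
        ¬even {true} {true} _ _ = refl

      count-s : count s ≡ size S
      count-s = count-mark E distinct S

      s-fails : lim (size S) < count (lost G s)
      s-fails = subst (λ m → lim m < count (lost G s)) count-s
        (fails s s-Odd (subst (0 <_) (≡-sym count-s) (positive⁻ (proj₂ (∧-true {count (evenAt rows S) ≡ᵇ 0} odd)))))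

      lost-meets : ∀ {z} → lost G s z ≡ true → s z ≡ false → meets (trace E z) S ≡ false →
                   ∀ w → Adj G z w ≡ true → meets (trace E w) S ≡ true
      lost-meets {z} l u f w a = positive⁺ (subst (0 <_) (into-mark E distinct S w)
        (proj₂ (lost⁻ G s l (cong₂ _∨_ u (trans (cong (0 <ᵇ_) (into-mark E distinct S z)) f)) w a)))

      touched≡ : touched rows S ≡ Vec.map (λ w → meets (trace E w) S) E
      touched≡ = trans (cong (Vec.map (λ r → meets r S)) rows≡) (≡-sym (map-∘ (λ r → meets r S) (trace E) E))

      within-touched : ∀ {z} → lost G s z ≡ true → s z ≡ false → meets (trace E z) S ≡ false →
                       within (trace E z) (touched rows S) ≡ true
      within-touched l u f rewrite touched≡ = within-map (lost-meets l u f) E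

      isolated : Fin n → Bool
      isolated z = lost G s z ∧ not (meets (trace E z) S)

      extra : ℕ
      extra = sum (λ z → ⟦ out E z ⟧ * ⟦ isolated z ⟧)

      isolated-meets : ∀ {z} → out E z ≡ true → isolated z ≡ true →
                       ∀ w → Adj G z w ≡ true → meets (trace E w) S ≡ true
      isolated-meets {z} o h = lost-meets (proj₁ (∧-true h)) (mark-out E S o) (not-true (proj₂ (∧-true {lost G s z} h)))

      isolated-stray : ∀ {z} → out E z ≡ true → isolated z ≡ true → stray rows S (trace E z) ≡ true
      isolated-stray {z} o h = let l , u = ∧-true {lost G s z} h in
        cong₂ _∧_ u (within-touched l (mark-out E S o) (not-true u))

      -- A lost revealed vertex lies in S, is adjacent to S or is stuck. A lost unrevealed one is
      -- adjacent to S or belongs to the exceptions counted by `extra`.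
      known-bound : count (lost G s) ≤ known rows T S + extra
      known-bound = begin
        count (lost G s)
          ≡⟨ sum-split E distinct _ ⟩
        sum (λ i → ⟦ lost G s (lookup E i) ⟧) + sum (λ z → ⟦ out E z ⟧ * ⟦ lost G s z ⟧)
          ≤⟨ +-mono-≤ (sum-mono {suc k} inner′) (sum-+-≤ {n} outer) ⟩
        A + (sum (λ z → ⟦ out E z ⟧ * ⟦ meets (trace E z) S ⟧) + extra)
          ≡⟨ cong (λ x → A + (x + extra)) (weigh-out (λ P → ⟦ meets P S ⟧) (cong ⟦_⟧ (meets-empty S))) ⟩
        A + (weigh (λ P → ⟦ meets P S ⟧) T + extra)
          ≡⟨ +-assoc A _ extra ⟨
        known rows T S + extra ∎
        where
        open ≤-Reasoning
        A = sum (λ i → ⟦ lookup S i ∨ (meets (lookup rows i) S ∨ stuck rows T S i) ⟧)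
        outer : ∀ z → ⟦ out E z ⟧ * ⟦ lost G s z ⟧ ≤ ⟦ out E z ⟧ * ⟦ meets (trace E z) S ⟧ + ⟦ out E z ⟧ * ⟦ isolated z ⟧
        outer z with out E z | lost G s z | meets (trace E z) S
        ... | false | _     | _     = z≤n
        ... | true  | false | _     = z≤n
        ... | true  | true  | true  = s≤s z≤n
        ... | true  | true  | false = s≤s z≤n
        inner′ : ∀ i → ⟦ lost G s (lookup E i) ⟧ ≤ ⟦ lookup S i ∨ (meets (lookup rows i) S ∨ stuck rows T S i) ⟧
        inner′ i = ⟦⟧-mono covered
          where
          covered : lost G s (lookup E i) ≡ true → lookup S i ∨ (meets (lookup rows i) S ∨ stuck rows T S i) ≡ true
          covered l with lookup S i in eS
          ... | true = refl
          ... | false rewrite row i with meets (trace E (lookup E i)) S in eM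
          ...   | true = refl
          ...   | false = cong₂ _∧_ (within-touched l u eM) (≡ᵇ⁺ nothing-outside)
            where
            u : s (lookup E i) ≡ false
            u = trans (mark-lookup E distinct S i) eS
            nothing-outside : weigh (λ P → ⟦ not (meets P S) ∧ lookup P i ⟧) T ≡ 0
            nothing-outside = trans (≡-sym (weigh-out _ (cong ⟦_⟧ (trans (cong (not (meets empty S) ∧_) (lookup-empty i)) (∧-false (not (meets empty S)))))))
              (sum-zero {n} λ z → trans (cong (⟦ out E z ⟧ *_) (cong ⟦_⟧ (¬true⇒false (absent z)))) (*-zeroʳ ⟦ out E z ⟧))
              where
              ∧-false : ∀ a → a ∧ false ≡ false
              ∧-false true  = refl
              ∧-false false = refl
              absent : ∀ z → ¬ (not (meets (trace E z) S) ∧ lookup (trace E z) i ≡ true)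
              absent z h = let a , b = ∧-true h in
                true≢false (lost-meets l u eM z (trans (sym G _ z) (trans (≡-sym (column i z)) b))) (not-true a)

      -- Double counting of the edges at the exceptional vertices, each of which has at least `lo`.
      -- Edges to revealed vertices are read off the traces. The others end in unrevealed vertices w
      -- of N(S), as recorded by `term`, and w has at most 4 minus its trace size of them.
      room-bound : lo * extra ≤ room rows T S
      room-bound = begin
        lo * extra
          ≡⟨ *-distribˡ-sum {n} lo _ ⟩
        sum (λ z → lo * (⟦ out E z ⟧ * ⟦ isolated z ⟧))
          ≤⟨ sum-+-≤ {n} point ⟩
        sum (λ z → ⟦ out E z ⟧ * (⟦ stray rows S (trace E z) ⟧ * size (trace E z))) + sum (λ z → sum (λ w → term z w))
          ≡⟨ cong₂ _+_ (weigh-out (λ P → ⟦ stray rows S P ⟧ * size P) (trans (cong (⟦ stray rows S empty ⟧ *_) (size-empty (suc k))) (*-zeroʳ ⟦ stray rows S empty ⟧)))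
                       (∑-comm {n} {n} term) ⟩
        W + sum (λ w → sum (λ z → term z w))
          ≤⟨ +-monoʳ-≤ W (sum-mono {n} swap) ⟩
        W + sum (λ w → ⟦ out E w ⟧ * (⟦ meets (trace E w) S ⟧ * (4 ∸ size (trace E w))))
          ≡⟨ cong (W +_) (weigh-out (λ P → ⟦ meets P S ⟧ * (4 ∸ size P)) (cong (λ b → ⟦ b ⟧ * (4 ∸ size (empty {suc k}))) (meets-empty S))) ⟩
        room rows T S ∎
        where
        open ≤-Reasoning
        W = weigh (λ P → ⟦ stray rows S P ⟧ * size P) T
        term : Fin n → Fin n → ℕ
        term z w = (⟦ out E w ⟧ * ⟦ meets (trace E w) S ⟧) * (⟦ out E z ⟧ * ⟦ Adj G w z ⟧)
        point : ∀ z → lo * (⟦ out E z ⟧ * ⟦ isolated z ⟧) ≤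
                      ⟦ out E z ⟧ * (⟦ stray rows S (trace E z) ⟧ * size (trace E z)) + sum (λ w → term z w)
        point z with out E z in eO | isolated z in eI
        ... | false | _     rewrite *-zeroʳ lo = z≤n
        ... | true  | false rewrite *-zeroʳ lo = z≤n
        ... | true  | true  rewrite isolated-stray eO eI = begin
          lo * 1 ≡⟨ *-identityʳ lo ⟩
          lo ≤⟨ min-degree z (proj₁ (∧-true (proj₁ (∧-true {lost G s z} eI)))) ⟩
          dg z ≡⟨ dg-split E distinct z ⟩
          size (trace E z) + sum (λ w → ⟦ out E w ⟧ * ⟦ Adj G z w ⟧)
            ≤⟨ +-mono-≤ (≤-reflexive (≡-sym (trans (+-identityʳ _) (+-identityʳ _)))) (sum-mono {n} hit) ⟩
          1 * (1 * size (trace E z)) + sum (λ w → (⟦ out E w ⟧ * ⟦ meets (trace E w) S ⟧) * (1 * ⟦ Adj G w z ⟧)) ∎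
          where
          hit : ∀ w → ⟦ out E w ⟧ * ⟦ Adj G z w ⟧ ≤ (⟦ out E w ⟧ * ⟦ meets (trace E w) S ⟧) * (1 * ⟦ Adj G w z ⟧)
          hit w rewrite sym G w z with Adj G z w in eA
          ... | false rewrite *-zeroʳ ⟦ out E w ⟧ = z≤n
          ... | true  rewrite isolated-meets eO eI w eA = ≤-reflexive (≡-sym (*-identityʳ _))
        swap : ∀ w → sum (λ z → term z w) ≤ ⟦ out E w ⟧ * (⟦ meets (trace E w) S ⟧ * (4 ∸ size (trace E w)))
        swap w = begin
          sum (λ z → term z w)
            ≡⟨ *-distribˡ-sum {n} (⟦ out E w ⟧ * ⟦ meets (trace E w) S ⟧) _ ⟨
          (⟦ out E w ⟧ * ⟦ meets (trace E w) S ⟧) * sum (λ z → ⟦ out E z ⟧ * ⟦ Adj G w z ⟧)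
            ≤⟨ *-monoʳ-≤ (⟦ out E w ⟧ * ⟦ meets (trace E w) S ⟧) spare ⟩
          (⟦ out E w ⟧ * ⟦ meets (trace E w) S ⟧) * (4 ∸ size (trace E w))
            ≡⟨ *-assoc ⟦ out E w ⟧ _ _ ⟩
          ⟦ out E w ⟧ * (⟦ meets (trace E w) S ⟧ * (4 ∸ size (trace E w))) ∎
          where
          spare : sum (λ z → ⟦ out E z ⟧ * ⟦ Adj G w z ⟧) ≤ 4 ∸ size (trace E w)
          spare = m+n≤o⇒m≤o∸n _ (≤-trans (≤-reflexive (trans (+-comm _ (size (trace E w))) (≡-sym (dg-split E distinct w)))) (max-degree w))

      lim<known+extra : lim (size S) < known rows T S + extra
      lim<known+extra = <-≤-trans s-fails known-bound

    -- By `room-bound` the exceptions are too few to lift the losses from `known` above the limit.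
    wins-sound : ∀ S → wins rows T S ≡ true → ⊥
    wins-sound S h = <⇒≱ lim<known+extra (s≤s⁻¹ (begin-strict
        known rows T S + extra ≡⟨ +-comm _ extra ⟩
        extra + known rows T S <⟨ +-monoˡ-< (known rows T S) (*-cancelˡ-< lo _ _ (≤-<-trans room-bound room<)) ⟩
        suc (lim (size S)) ∸ known rows T S + known rows T S ≡⟨ m∸n+n≡m (<⇒≤ known<) ⟩
        suc (lim (size S)) ∎))
      where
      open Cutting S (proj₁ (∧-true h))
      open ≤-Reasoning
      room< : room rows T S < lo * (suc (lim (size S)) ∸ known rows T S)
      room< = <ᵇ⁻ (proj₂ (∧-true {oddSet rows S} h))
      known< : known rows T S < suc (lim (size S))
      known< = m∸n≢0⇒n<m λ e → n≮0 (subst (room rows T S <_) (trans (cong (lo *_) e) (*-zeroʳ lo)) room<)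

    -- The known losses stay within the limit and the actual ones exceed it, so some unrevealed
    -- vertex outside N[S] is cut off.
    cuts-sound : ∀ S → (h : cuts rows T S ≡ true) →
                 ∃ λ z → out E z ≡ true × Cutting.isolated S (proj₁ (∧-true h)) z ≡ true
    cuts-sound S h = let z , q = sum-positive _ extra>0 in z , factors-positive _ _ q
      where
      open Cutting S (proj₁ (∧-true h))
      extra>0 : 0 < extra
      extra>0 = +-cancelˡ-< (known rows T S) 0 extra (≤-<-trans (≤-trans (≤-reflexive (+-identityʳ _))
        (≤ᵇ⁻ (proj₂ (∧-true {oddSet rows S} h)))) lim<known+extra)

    -- Rows and table together show all neighbours of a revealed vertex, so the vertices of L really
    -- are leaves, and `root` would have three neighbours next to leaves.
    crowned-sound : ∀ L → crowned rows T L ≡ true → ⊥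
    crowned-sound L h = <⇒≱ (<ᵇ⁻ (proj₂ (∧-true {sum (λ i → ⟦ lookup L i ⟧ * excess i) ≡ᵇ 0} h))) (begin
      sum (λ i → ⟦ near (lookup rows i) ⟧) + weigh (λ P → ⟦ near P ⟧) T
        ≡⟨ cong₂ _+_ (sum-cong-≗ {suc k} λ i → cong (λ P → ⟦ near P ⟧) (row i))
                     (≡-sym (weigh-out (λ P → ⟦ near P ⟧) (cong (λ b → ⟦ b ∧ meets empty L ⟧) (anchor-empty (suc k))))) ⟩
      sum (λ i → ⟦ near (trace E (lookup E i)) ⟧) + sum (λ z → ⟦ out E z ⟧ * ⟦ near (trace E z) ⟧)
        ≡⟨ sum-split E distinct (λ z → ⟦ near (trace E z) ⟧) ⟨
      count (λ z → near (trace E z))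
        ≤⟨ sum-mono {n} (λ z → ⟦⟧-mono (λ e → cong₂ _∧_ (trans (≡-sym (rooted z)) (proj₁ (∧-true e)))
                                                  (leaf-near z (proj₂ (∧-true {anchor (trace E z)} e))))) ⟩
      count (λ z → Adj G z root ∧ near-leaf z)
        ≤⟨ uncrowned ⟩
      2 ∎)
      where
      open ≤-Reasoning
      near : Mask (suc k) → Bool
      near P = anchor P ∧ meets P L
      excess : Fin (suc k) → ℕ
      excess i = size (lookup rows i) + weigh (λ P → ⟦ lookup P i ⟧) T ∸ 1
      no-excess : ∀ i → lookup L i ≡ true → excess i ≡ 0
      no-excess i e = trans (≡-sym (trans (cong (λ b → ⟦ b ⟧ * excess i) e) (+-identityʳ _)))
        (n≤0⇒n≡0 (≤-trans (term≤sum (λ i → ⟦ lookup L i ⟧ * excess i) i)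
          (≤-reflexive (≡ᵇ⁻ (proj₁ (∧-true {sum (λ i → ⟦ lookup L i ⟧ * excess i) ≡ᵇ 0} h))))))
      leaf : ∀ i → lookup L i ≡ true → dg (lookup E i) ≤ 1
      leaf i e = ≤-trans (≤-reflexive (trans (dg-split E distinct (lookup E i)) (cong₂ _+_ (cong size (≡-sym (row i)))
          (trans (sum-cong-≗ {n} λ z → cong (λ b → ⟦ out E z ⟧ * ⟦ b ⟧) (trans (sym G _ z) (≡-sym (column i z))))
                 (weigh-out (λ P → ⟦ lookup P i ⟧) (cong ⟦_⟧ (lookup-empty i)))))))
        (m∸n≡0⇒m≤n (no-excess i e))
      leaf-near : ∀ z → meets (trace E z) L ≡ true → near-leaf z ≡ true
      leaf-near z e with into⁻ (mark E L) (subst (0 <_) (≡-sym (into-mark E distinct L z)) (positive⁻ e))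
      ... | w , m , a with mark-witness E L m
      ...   | i , refl , Lᵢ = positive⁺ (count-positive (λ w → Adj G z w ∧ (dg w ≤ᵇ 1)) w (cong₂ _∧_ a (≤ᵇ⁺ (leaf i Lᵢ))))

  open-trace : ∀ (E : Vec (Fin n) k) → Distinct E → ∀ {y} → out E y ≡ true → ∀ z → Adj G y z ≡ true →
               open4 (trace E z) ≡ true
  open-trace E d {y} fresh z a = <ᵇ⁺ (begin-strict
    size (trace E z)     <⟨ m<m+n (size (trace E z)) (≤-trans (≤-reflexive (≡-sym (cong₂ (λ b c → ⟦ b ⟧ * ⟦ c ⟧) fresh (trans (sym G z y) a))))
                              (term≤sum (λ w → ⟦ out E w ⟧ * ⟦ Adj G z w ⟧) y)) ⟩
    size (trace E z) + _ ≡⟨ dg-split E d z ⟨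
    dg z                 ≤⟨ max-degree z ⟩
    4                    ∎)
    where open ≤-Reasoning

  checkAll-sound : ∀ (chk : State k → List Move → Maybe (List Move)) {st} sts {ms ms′} →
    checkAll chk sts ms ≡ just ms′ → st ∈ sts → ∃ λ a → ∃ λ b → chk st a ≡ just b
  checkAll-sound chk (s ∷ sts) {ms} h mem with chk s ms in eq
  checkAll-sound chk (s ∷ sts) h (here refl) | just _ = _ , _ , eq
  checkAll-sound chk (s ∷ sts) h (there mem) | just _ = checkAll-sound chk sts h mem

  -- Recursion along the case tree: a graph that fits a state fits one of the children listed by a
  -- revealing move, and the leaves of the tree are contradictory.
  check-sound : ∀ f {k} (st : State (suc k)) ms {ms′} → check f st ms ≡ just ms′ → Models st → ⊥
  step-sound : ∀ f {k} (st : State (suc k)) ms {ms′} → step f st ms ≡ just ms′ → Models st → ⊥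

  check-sound (suc f) (rows , T) ms h M
    rewrite fits⁺ _ (Reading.attached-bound M) = step-sound f (rows , T) ms h M

  step-sound f {k} (rows , T) (win m ∷ ms) h M with wins rows T (decode (suc k) m) in eq
  ... | true = Reading.wins-sound M _ eq
  step-sound f {k} (rows , T) (crown m ∷ ms) h M with crowned rows T (decode (suc k) m) in eq
  ... | true = Reading.crowned-sound M _ eq
  step-sound f (rows , T) (new m ∷ ms) h M with pick m T in eq
  ... | just (Q , T′) with pick-sound (Models.E M) m T eq (Models.classes M)
  ...   | y , sy , refl , cl =
    let st , mem , M′ = grow-complete M open4 T′ fresh (Reading.seen-attached M y sy)
                          (λ z _ → open-trace E distinct fresh z) cl
        _ , _ , h′ = checkAll-sound (check f) _ h mem
    in check-sound f st _ h′ M′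
    where
    open Models M
    fresh = proj₁ (∧-true {out E y} sy)
  step-sound f {k} (rows , T) (cut m ∷ ms) h M with cuts rows T (decode (suc k) m) in eq
  ... | true with Reading.cuts-sound M (decode (suc k) m) eq
  ...   | z , fresh , iso =
    let st , mem , M′ = child
        _ , _ , h′ = checkAll-sound (check f) _ h mem
    in check-sound f st _ h′ M′
    where
    open Models M
    S = decode (suc k) m
    open Reading.Cutting M S (proj₁ (∧-true eq))
    az : attached z ≡ true
    az = proj₁ (∧-true (proj₁ (∧-true {lost G s z} iso)))
    inner-ok : ∀ w → out E w ≡ true → Adj G z w ≡ true → inner rows T S (trace E w) ≡ true
    inner-ok w _ a = cong₂ _∧_ (open-trace E distinct fresh w a) (isolated-meets fresh iso w a)
    child : ∃ λ st → st ∈ isolates rows T S × Models st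
    child with bool-cases (0 <ᵇ size (trace E z))
    ... | inj₂ q =
      let st , mem , M′ = grow-complete M (inner rows T S) T fresh az inner-ok
                            (Classes-cong E T (λ w → ≡-sym (drop-other (seen E) z unseen w)) classes)
      in st , ∈-++⁺ˡ (subst (λ Q → st ∈ grow (inner rows T S) rows Q T) (size-zero _ (nonpositive⁻ q)) mem) , M′
      where
      unseen : seen E z ≡ false
      unseen = cong₂ _∧_ fresh q
    ... | inj₁ q =
      let T′ , mem , cl = picks-complete E T classes {z} (cong₂ _∧_ fresh q)
          st , mem′ , M′ = grow-complete M (inner rows T S) T′ fresh az inner-ok cl
      in st , ∈-++⁺ʳ (grow (inner rows T S) rows empty T)
                (∈-concat⁺′ (subst (λ b → st ∈ (if b then grow (inner rows T S) rows (trace E z) T′ else []))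
                                   (≡-sym (isolated-stray fresh iso)) mem′)
                            (∈-map⁺ _ mem)) , M′

-- The neighbourhood of a vertex of minimum degree

limit : ℕ → ℕ → ℕ
limit l s = if s ≡ᵇ 2 then l else (7 * s ∸ 2) / 2

-- The starting points: a vertex of degree d, and a leaf whose neighbour has d further neighbours.
hub : ℕ → State 1
hub d = (false ∷ []) ∷ [] , ((true ∷ []) , d) ∷ []

pendant : ℕ → State 2
pendant d = (false ∷ true ∷ []) ∷ (true ∷ false ∷ []) ∷ [] , add (false ∷ true ∷ []) d []

-- 20 is the fuel, a bound on the depth of the case trees; the result `just []` says that every case
-- is closed and every move consumed.
Refuted : ℕ → ℕ → (ℕ → Bool) → State k → Set
Refuted lo l fits st = ∃ λ ms → Check.check lo (limit l) fits 20 st ms ≡ just []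

record Refutations (l : ℕ) (fits : ℕ → Bool) : Set where
  field
    pendants : ∀ d → d ≤ 3 → Refuted 1 l fits (pendant d)
    hub₂     : Refuted 2 l fits (hub 2)
    hub₃     : Refuted 3 l fits (hub 3)

-- `H` and `H₂` say that no odd set is cheap enough, with an individual limit for edges. The module
-- concludes that no vertex is low.
module Local {n : ℕ} (G : Graph n) (max-degree : ∀ z → Vertices.dg G z ≤ 4)
  (l : ℕ) (fits : ℕ → Bool) (fits⁺ : ∀ m → m ≤ count (Vertices.attached G) → fits m ≡ true)
  (H : ∀ s → Vertices.Odd G s → 0 < count s → 7 * count s < 2 * count (lost G s) + 2)
  (H₂ : ∀ s → Vertices.Odd G s → count s ≡ 2 → l < count (lost G s))
  (refutations : Refutations l fits)
  where

  open Vertices G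
  open Traces G
  open Refutations refutations

  -- `H` gives 7c - 2 < 2 · lost for a set of order c, hence the floor of (7c - 2)/2 in `limit`. The
  -- truncated subtraction is exact because c is positive.
  fails : ∀ s → Odd s → 0 < count s → limit l (count s) < count (lost G s)
  fails s o p with count s ≡ᵇ 2 in eq
  ... | true  = H₂ s o (≡ᵇ⁻ eq)
  ... | false = m<n*o⇒m/o<n {7 * count s ∸ 2} {count (lost G s)} {2}
    (subst (7 * count s ∸ 2 <_) (*-comm 2 (count (lost G s)))
      (+-cancelʳ-< 2 _ _ (subst (_< 2 * count (lost G s) + 2) (≡-sym (m∸n+n≡m {7 * count s} {2}
        (≤-trans (s≤s (s≤s z≤n)) (*-monoʳ-≤ 7 p)))) (H s o p))))

  near-leaf⁻ : ∀ {v} → near-leaf v ≡ true → ∃ λ u → Adj G v u ≡ true × dg u ≤ 1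
  near-leaf⁻ {v} h = let u , q = count-witness (λ w → Adj G v w ∧ (dg w ≤ᵇ 1)) (positive⁻ h) ; a , b = ∧-true {Adj G v u} q in u , a , ≤ᵇ⁻ b

  near-leaf⁺ : ∀ {v u} → Adj G v u ≡ true → dg u ≤ 1 → near-leaf v ≡ true
  near-leaf⁺ {v} {u} a d = positive⁺ (count-positive (λ w → Adj G v w ∧ (dg w ≤ᵇ 1)) u (cong₂ _∧_ a (≤ᵇ⁺ d)))

  leaf-neighbour : ∀ {u v w} → dg u ≤ 1 → Adj G u v ≡ true → Adj G u w ≡ true → v ≡ w
  leaf-neighbour {u} d = count-unique (Adj G u) d

  supports : Fin n → ℕ
  supports v = count (λ z → Adj G z v ∧ near-leaf z)

  -- If every support vertex had three support neighbours, the supports would form an odd set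
  -- (with all degrees 3) whose closed neighbourhood is closed under adjacency and twice as large.
  not-all-crowned : ∀ {u} → dg u ≡ 1 → ¬ (∀ v → near-leaf v ≡ true → 2 < supports v)
  not-all-crowned {u₀} du₀ all = <⇒≱ (H D D-Odd D>0) (begin
      2 * count (lost G D) + 2                ≤⟨ +-monoˡ-≤ 2 (*-monoʳ-≤ 2 lost≤) ⟩
      2 * (count D + count D) + 2             ≤⟨ +-monoʳ-≤ (2 * (count D + count D)) (≤-trans (s≤s (s≤s z≤n)) (*-monoʳ-≤ 3 D>0)) ⟩
      2 * (count D + count D) + 3 * count D   ≡⟨ arith (count D) ⟩
      7 * count D                             ∎)
    where
    open ≤-Reasoning
    arith : ∀ d → 2 * (d + d) + 3 * d ≡ 7 * d
    arith d = trans (cong (_+ 3 * d) (trans (cong (2 *_) (cong (d +_) (≡-sym (+-identityʳ d)))) (≡-sym (*-assoc 2 2 d)))) (≡-sym (*-distribʳ-+ d 4 3))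
    D D̄ : Fin n → Bool
    D = near-leaf
    D̄ z = not (D z)
    crown≡ : ∀ v → supports v ≡ into D v
    crown≡ v = sum-cong-≗ {n} λ z → trans (⟦⟧-∧ (Adj G z v) (D z)) (trans (*-comm ⟦ Adj G z v ⟧ _) (cong (λ b → ⟦ D z ⟧ * ⟦ b ⟧) (sym G z v)))
    dg-parts : ∀ v → dg v ≡ into D v + into D̄ v
    dg-parts v = sum-+-≡ {n} λ w → part (D w) (Adj G v w)
      where
      part : ∀ a b → ⟦ b ⟧ ≡ ⟦ a ⟧ * ⟦ b ⟧ + ⟦ not a ⟧ * ⟦ b ⟧
      part true  b = ≡-sym (trans (+-identityʳ _) (+-identityʳ _))
      part false b = ≡-sym (+-identityʳ _)
    -- Three neighbours in `D` and a leaf exhaust the degree 4, so `v` has exactly three neighbours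
    -- in `D` and its leaf `u` is the only one outside. The leaf is not in `D`: its sole neighbour
    -- `v` would have to be a leaf itself.
    module At {v} (Dv : D v ≡ true) where
      leafy = near-leaf⁻ Dv
      u = proj₁ leafy
      au = proj₁ (proj₂ leafy)
      du = proj₂ (proj₂ leafy)
      three : 3 ≤ into D v
      three = subst (3 ≤_) (crown≡ v) (all v Dv)
      u∉D : D̄ u ≡ true
      u∉D with D u in eq
      ... | false = refl
      ... | true with near-leaf⁻ eq
      ...   | w , aw , dw with leaf-neighbour du (trans (sym G u v) au) aw
      ...     | refl = ⊥-elim (<⇒≱ (≤-trans (≤-trans (s≤s (s≤s z≤n)) three)
                         (≤-trans (m≤m+n _ _) (≤-reflexive (≡-sym (dg-parts v))))) dw)
      sum≤4 : into D v + into D̄ v ≤ 4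
      sum≤4 = subst (_≤ 4) (dg-parts v) (max-degree v)
      one : 1 ≤ into D̄ v
      one = into⁺ D̄ u∉D au
      into≡3 : into D v ≡ 3
      into≡3 = ≤-antisym (+-cancelʳ-≤ 1 _ _ (≤-trans (+-monoʳ-≤ _ one) sum≤4)) three
      others≤1 : into D̄ v ≤ 1
      others≤1 = +-cancelˡ-≤ 3 _ _ (≤-trans (+-monoˡ-≤ _ three) sum≤4)
    D-Odd : Odd D
    D-Odd v Dv = cong (_% 2) (At.into≡3 Dv)
    D>0 : 0 < count D
    D>0 = let v , a = count-witness (Adj G u₀) (subst (0 <_) (≡-sym du₀) (s≤s z≤n)) in
      count-positive D v (near-leaf⁺ (trans (sym G v u₀) a) (≤-reflexive du₀))
    -- Otherwise a neighbour w of z lies outside `D` next to some v in `D`. The only neighbour of v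
    -- outside `D` is its leaf, so w is this leaf and its only neighbour is v; thus z = v, which is
    -- in `D`.
    touches : ∀ {z} → lost G D z ≡ true → D z ≡ false → 0 < into D z
    touches {z} lz nz with bool-cases (0 <ᵇ into D z)
    ... | inj₁ p  = positive⁻ p
    ... | inj₂ eq with count-witness (Adj G z) (positive⁻ (proj₁ (∧-true {attached z} lz)))
    ...   | w , zw with lost⁻ G D lz (cong₂ _∨_ nz eq) w zw
    ...     | w∉D , hit with into⁻ D hit
    ...       | v , Dv , wv = ⊥-elim (true≢false (subst (λ x → D x ≡ true) v≡z Dv) nz)
      where
      open At Dv
      u≡w : u ≡ w
      u≡w = count-unique (λ x → D̄ x ∧ Adj G v x)
        (subst (_≤ 1) (sum-cong-≗ {n} λ x → ≡-sym (⟦⟧-∧ (D̄ x) (Adj G v x))) others≤1)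
        (cong₂ _∧_ u∉D au) (cong₂ _∧_ (cong not w∉D) (trans (sym G v w) wv))
      v≡z : v ≡ z
      v≡z = leaf-neighbour (subst (λ x → dg x ≤ 1) u≡w du) wv (trans (sym G w z) zw)
    -- Each lost vertex outside `D` receives an edge from `D`, and each vertex of `D` sends out at
    -- most one.
    lost≤ : count (lost G D) ≤ count D + count D
    lost≤ = begin
      count (lost G D)                                                ≤⟨ sum-+-≤ {n} point ⟩
      count D + sum (λ z → ⟦ D̄ z ⟧ * into D z)                         ≡⟨ cong (count D +_) (sum-cong-≗ {n} λ z → *-distribˡ-sum {n} ⟦ D̄ z ⟧ _) ⟩
      count D + sum (λ z → sum (λ w → ⟦ D̄ z ⟧ * (⟦ D w ⟧ * ⟦ Adj G z w ⟧))) ≡⟨ cong (count D +_) (∑-comm {n} {n} _) ⟩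
      count D + sum (λ w → sum (λ z → ⟦ D̄ z ⟧ * (⟦ D w ⟧ * ⟦ Adj G z w ⟧))) ≤⟨ +-monoʳ-≤ (count D) (sum-mono {n} swap) ⟩
      count D + count D                                               ∎
      where
      point : ∀ z → ⟦ lost G D z ⟧ ≤ ⟦ D z ⟧ + ⟦ D̄ z ⟧ * into D z
      point z = cover (lost G D z) (D z) touches
        where
        cover : ∀ a b {m} → (a ≡ true → b ≡ false → 0 < m) → ⟦ a ⟧ ≤ ⟦ b ⟧ + ⟦ not b ⟧ * m
        cover false _     h = z≤n
        cover true  true  h = s≤s z≤n
        cover true  false h = ≤-trans (h refl refl) (≤-reflexive (≡-sym (+-identityʳ _)))
      swap : ∀ w → sum (λ z → ⟦ D̄ z ⟧ * (⟦ D w ⟧ * ⟦ Adj G z w ⟧)) ≤ ⟦ D w ⟧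
      swap w with D w in eq
      ... | false = ≤-reflexive (sum-zero {n} λ z → *-zeroʳ ⟦ D̄ z ⟧)
      ... | true  = ≤-trans (≤-reflexive (sum-cong-≗ {n} λ z → cong (⟦ D̄ z ⟧ *_) (trans (+-identityʳ _) (cong ⟦_⟧ (sym G z w)))))
                            (At.others≤1 eq)

  support : ∀ {u} → dg u ≡ 1 → ∃ λ v → near-leaf v ≡ true × supports v ≤ 2
  support {u} du with search (λ v → near-leaf v ∧ (supports v ≤ᵇ 2))
  ... | inj₁ (v , q) = let a , b = ∧-true {near-leaf v} q in v , a , ≤ᵇ⁻ b
  ... | inj₂ none = ⊥-elim (not-all-crowned du λ v Dv → ≰⇒> λ c → true≢false (cong₂ _∧_ Dv (≤ᵇ⁺ c)) (none v))

  leaf-case : ∀ {u} → dg u ≡ 1 → ⊥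
  leaf-case du₀ with support du₀
  -- The start is not the given leaf but one whose neighbour `v` has at most two neighbours next to
  -- leaves; as the oldest vertex, `v` is the `root`.
  ... | v , Dv , cr with near-leaf⁻ Dv
  ...   | u , vu , du = check-sound 20 (pendant d) _ (proj₂ (pendants d d≤3)) record
      { E        = E
      ; distinct = (cong (_∧ true) (cong not (≢⇒== u≢v))) , refl , tt
      ; rows≡    = cong₂ _∷_ (cong₂ _∷_ (≡-sym (irrefl G u)) (cong (_∷ []) (≡-sym uv)))
                   (cong (_∷ []) (cong₂ _∷_ (≡-sym vu) (cong (_∷ []) (≡-sym (irrefl G v)))))
      ; alive    = λ { zero → attached⁺ uv ; (suc zero) → attached⁺ vu }
      ; rooted   = λ z → refl
      ; classes  = Classes-add E [] (seen E) (λ _ → false) traces refl (splitting λ z → ≡-sym (+-identityʳ _)) (λ _ → refl)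
      }
    where
    open Soundness G 1 (limit l) fits v (λ z → positive⁻) max-degree fits⁺ fails cr
    E = u ∷ v ∷ []
    d = count (seen E)
    uv : Adj G u v ≡ true
    uv = trans (sym G u v) vu
    u≢v : u ≢ v
    u≢v refl = true≢false uv (irrefl G u)
    traces : ∀ z → seen E z ≡ true → trace E z ≡ false ∷ true ∷ []
    traces z h with ∧-true {out E z} h
    ... | o , q with Adj G z u in eu | Adj G z v in ev
    ...   | true  | _     = ⊥-elim (out-≢ E o (suc zero) (leaf-neighbour du uv (trans (sym G u z) eu)))
    ...   | false | true  = refl
    ...   | false | false = ⊥-elim (true≢false q refl)
    d≤3 : d ≤ 3
    d≤3 = +-cancelˡ-≤ 1 _ _ (≤-trans (≤-trans (≤-reflexive (cong (_+ d) (≡-sym (trans (cong (λ b → ⟦ b ⟧ + 0) vu) refl))))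
      (≤-trans (+-monoʳ-≤ (⟦ Adj G v u ⟧ + 0) (sum-mono {n} point)) (≤-reflexive (≡-sym (sum-split (u ∷ []) (refl , tt) _))))) (max-degree v))
      where
      point : ∀ z → ⟦ seen E z ⟧ ≤ ⟦ out (u ∷ []) z ⟧ * ⟦ Adj G v z ⟧
      point z with seen E z in eq
      ... | false = z≤n
      ... | true  = ≤-reflexive (≡-sym (cong₂ (λ a b → ⟦ a ⟧ * ⟦ b ⟧)
        (cong (_∧ true) (proj₁ (∧-true {not (z == u)} (proj₁ (∧-true {out E z} eq)))))
        (trans (sym G v z) (cong (λ P → lookup P (suc zero)) (traces z eq)))))

  -- With minimum degree at least 2 there are no leaves, so the condition against coronas holds
  -- trivially.
  hub-case : ∀ lo d → Refuted lo l fits (hub d) → 2 ≤ lo → (∀ z → attached z ≡ true → lo ≤ dg z) →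
             ∀ {u} → attached u ≡ true → dg u ≡ d → ⊥
  hub-case lo d (ms , ref) lo≥2 min-degree {u} au refl = check-sound 20 (hub (dg u)) ms ref record
      { E        = E
      ; distinct = refl , tt
      ; rows≡    = cong (λ b → (b ∷ []) ∷ []) (≡-sym (irrefl G u))
      ; alive    = λ { zero → au }
      ; rooted   = λ z → refl
      ; classes  = seen E , (λ _ → false) , traces , sum-cong-≗ {n} same , splitting (λ z → ≡-sym (+-identityʳ _)) , (λ _ → refl)
      }
    where
    crown≤2 : supports u ≤ 2
    crown≤2 = ≤-trans (≤-reflexive (sum-zero {n} λ z → cong ⟦_⟧ (¬true⇒false λ h →
      let w , a , dw = near-leaf⁻ (proj₂ (∧-true {Adj G z u} h))
      in <⇒≱ (≤-trans lo≥2 (min-degree w (attached⁺ (trans (sym G w z) a)))) dw))) z≤n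
    open Soundness G lo (limit l) fits u min-degree max-degree fits⁺ fails crown≤2
    E = u ∷ []
    traces : ∀ z → seen E z ≡ true → trace E z ≡ true ∷ []
    traces z h with Adj G z u | proj₂ (∧-true {out E z} h)
    ... | true | _ = refl
    same : ∀ z → ⟦ seen E z ⟧ ≡ ⟦ Adj G u z ⟧
    same z with z ≟ u
    ... | yes refl rewrite irrefl G z = refl
    ... | no _ rewrite sym G z u with Adj G u z
    ...   | true  = refl
    ...   | false = refl

  -- The search starts at a vertex of least positive degree anywhere in the graph, so that this
  -- degree can serve as `lo`; only if it is 3 is `u` itself the start.
  no-low : ∀ {u} → attached u ≡ true → dg u ≤ 3 → ⊥
  no-low {u} au du with search (λ z → dg z ≡ᵇ 1)
  ... | inj₁ (z , q) = leaf-case {z} (≡ᵇ⁻ q)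
  ... | inj₂ no₁ with search (λ z → dg z ≡ᵇ 2)
  ...   | inj₁ (z , q) = hub-case 2 2 hub₂ ≤-refl ≥2 {z} (positive⁺ {dg z} (subst (0 <_) (≡-sym (≡ᵇ⁻ {dg z} {2} q)) (s≤s z≤n))) (≡ᵇ⁻ q)
    where
    ≥2 : ∀ z → attached z ≡ true → 2 ≤ dg z
    ≥2 z a = ≤∧≢⇒< (positive⁻ a) λ e → true≢false (≡ᵇ⁺ (≡-sym e)) (no₁ z)
  ...   | inj₂ no₂ = hub-case 3 3 hub₃ (s≤s (s≤s z≤n)) ≥3 {u} au (≤-antisym du (≥3 u au))
    where
    ≥3 : ∀ z → attached z ≡ true → 3 ≤ dg z
    ≥3 z a = ≤∧≢⇒< (≤∧≢⇒< (positive⁻ a) λ e → true≢false (≡ᵇ⁺ (≡-sym e)) (no₁ z))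
                   λ e → true≢false (≡ᵇ⁺ (≡-sym e)) (no₂ z)

-- Case trees: closed for graphs of order at most 7, open for graphs in which every odd set of
-- order 2 loses at least 8 vertices.

closed-pendant₀ : List Move
closed-pendant₀ =
  win 3 ∷ []

closed-pendant₁ : List Move
closed-pendant₁ =
  win 3 ∷ []

closed-pendant₂ : List Move
closed-pendant₂ =
  cut 3 ∷ cut 6 ∷ cut 12 ∷ new 1 ∷ win 3 ∷ win 39 ∷ new 0 ∷ win 3 ∷ win 43 ∷ new 0 ∷ win 9 ∷ win 43 ∷ new 0 ∷ win 3 ∷ win 23 ∷ win 23 ∷
  new 0 ∷ win 23 ∷ win 23 ∷ win 23 ∷ cut 6 ∷ new 0 ∷ win 23 ∷ win 23 ∷ win 23 ∷ new 0 ∷ win 23 ∷ win 3 ∷ win 23 ∷ []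

closed-pendant₃ : List Move
closed-pendant₃ =
  cut 3 ∷ new 0 ∷ win 3 ∷ new 1 ∷ win 27 ∷ win 27 ∷ win 27 ∷ win 6 ∷ cut 3 ∷ new 0 ∷ win 63 ∷ win 63 ∷ new 0 ∷ win 63 ∷ win 63 ∷ new 0 ∷
  win 23 ∷ win 23 ∷ win 23 ∷ new 0 ∷ win 23 ∷ win 23 ∷ win 23 ∷ win 23 ∷ cut 6 ∷ new 1 ∷ win 3 ∷ win 3 ∷ new 0 ∷ win 63 ∷ win 63 ∷
  new 0 ∷ win 23 ∷ win 23 ∷ win 23 ∷ new 0 ∷ win 23 ∷ win 23 ∷ win 23 ∷ new 0 ∷ win 23 ∷ win 23 ∷ win 23 ∷ new 0 ∷ win 23 ∷ win 23 ∷
  win 23 ∷ cut 6 ∷ new 0 ∷ win 23 ∷ win 23 ∷ new 0 ∷ win 23 ∷ win 23 ∷ win 23 ∷ new 0 ∷ win 23 ∷ win 23 ∷ []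

closed-hub₂ : List Move
closed-hub₂ =
  new 0 ∷ win 3 ∷ cut 3 ∷ cut 6 ∷ new 0 ∷ win 3 ∷ win 3 ∷ win 15 ∷ win 3 ∷ cut 3 ∷ cut 6 ∷ new 2 ∷ win 3 ∷ win 3 ∷ win 5 ∷ new 0 ∷
  win 15 ∷ win 3 ∷ win 15 ∷ new 0 ∷ win 3 ∷ win 15 ∷ win 3 ∷ new 0 ∷ win 15 ∷ win 15 ∷ win 15 ∷ cut 6 ∷ new 0 ∷ win 5 ∷ win 15 ∷ win 5 ∷
  new 0 ∷ win 3 ∷ win 15 ∷ win 3 ∷ new 0 ∷ win 5 ∷ win 15 ∷ win 5 ∷ cut 6 ∷ new 0 ∷ win 15 ∷ win 15 ∷ win 15 ∷ new 0 ∷ win 3 ∷ win 15 ∷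
  win 3 ∷ new 0 ∷ win 15 ∷ win 15 ∷ win 15 ∷ cut 3 ∷ new 2 ∷ win 3 ∷ new 0 ∷ win 5 ∷ win 5 ∷ win 18 ∷ win 18 ∷ win 3 ∷ new 0 ∷ win 15 ∷
  win 15 ∷ win 15 ∷ new 1 ∷ win 9 ∷ win 9 ∷ cut 5 ∷ new 0 ∷ win 15 ∷ win 9 ∷ new 0 ∷ win 18 ∷ win 3 ∷ win 18 ∷ new 1 ∷ win 9 ∷ win 9 ∷
  new 0 ∷ win 15 ∷ win 15 ∷ cut 3 ∷ new 2 ∷ win 3 ∷ new 0 ∷ win 5 ∷ win 6 ∷ win 6 ∷ win 6 ∷ new 1 ∷ win 23 ∷ win 23 ∷ win 23 ∷ win 23 ∷
  win 3 ∷ win 3 ∷ new 2 ∷ win 9 ∷ win 9 ∷ win 9 ∷ new 0 ∷ win 15 ∷ win 15 ∷ win 3 ∷ new 0 ∷ win 15 ∷ win 15 ∷ win 15 ∷ new 2 ∷ win 9 ∷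
  new 1 ∷ win 23 ∷ win 23 ∷ win 23 ∷ win 3 ∷ new 2 ∷ win 23 ∷ win 23 ∷ win 23 ∷ win 23 ∷ win 3 ∷ new 1 ∷ win 9 ∷ win 9 ∷ new 0 ∷
  win 15 ∷ win 15 ∷ new 1 ∷ cut 9 ∷ new 0 ∷ win 15 ∷ win 36 ∷ new 0 ∷ new 0 ∷ win 51 ∷ win 6 ∷ new 1 ∷ win 51 ∷ win 36 ∷ new 0 ∷ new 0 ∷
  win 39 ∷ win 39 ∷ new 0 ∷ win 39 ∷ win 39 ∷ new 0 ∷ win 15 ∷ []

closed-hub₃ : List Move
closed-hub₃ =
  new 0 ∷ win 3 ∷ cut 3 ∷ cut 6 ∷ new 0 ∷ win 15 ∷ win 15 ∷ cut 3 ∷ cut 6 ∷ new 0 ∷ win 15 ∷ cut 3 ∷ new 1 ∷ new 0 ∷ win 27 ∷ win 27 ∷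
  win 5 ∷ new 1 ∷ win 23 ∷ win 23 ∷ win 23 ∷ new 2 ∷ win 9 ∷ new 0 ∷ win 15 ∷ win 15 ∷ win 3 ∷ new 0 ∷ win 15 ∷ win 15 ∷ win 15 ∷
  new 0 ∷ new 0 ∷ win 27 ∷ win 9 ∷ win 27 ∷ new 0 ∷ win 27 ∷ win 27 ∷ win 5 ∷ new 0 ∷ win 3 ∷ new 0 ∷ new 0 ∷ win 99 ∷ new 0 ∷ win 111 ∷
  win 3 ∷ cut 3 ∷ new 2 ∷ win 9 ∷ win 9 ∷ new 1 ∷ win 23 ∷ win 9 ∷ win 23 ∷ new 1 ∷ new 1 ∷ win 43 ∷ new 1 ∷ win 9 ∷ win 5 ∷ win 9 ∷
  win 5 ∷ new 2 ∷ win 9 ∷ new 0 ∷ win 15 ∷ win 15 ∷ win 15 ∷ new 0 ∷ win 15 ∷ win 15 ∷ new 1 ∷ cut 9 ∷ new 0 ∷ win 15 ∷ win 9 ∷ new 0 ∷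
  win 3 ∷ new 0 ∷ win 51 ∷ new 1 ∷ new 0 ∷ win 123 ∷ new 1 ∷ cut 5 ∷ new 1 ∷ win 27 ∷ new 2 ∷ win 15 ∷ win 15 ∷ win 15 ∷ new 1 ∷ new 1 ∷
  win 27 ∷ win 27 ∷ win 27 ∷ win 5 ∷ new 1 ∷ new 0 ∷ win 63 ∷ win 34 ∷ new 1 ∷ win 63 ∷ new 1 ∷ win 15 ∷ win 15 ∷ []

open-pendant₀ : List Move
open-pendant₀ =
  win 3 ∷ []

open-pendant₁ : List Move
open-pendant₁ =
  win 3 ∷ []

open-pendant₂ : List Move
open-pendant₂ =
  cut 3 ∷ cut 6 ∷ cut 12 ∷ new 1 ∷ win 3 ∷ win 39 ∷ win 39 ∷ new 0 ∷ win 3 ∷ win 43 ∷ win 43 ∷ new 0 ∷ win 9 ∷ win 3 ∷ win 43 ∷ new 0 ∷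
  win 3 ∷ win 23 ∷ win 23 ∷ new 0 ∷ win 5 ∷ win 3 ∷ win 23 ∷ cut 6 ∷ new 0 ∷ win 3 ∷ win 3 ∷ win 23 ∷ new 0 ∷ win 3 ∷ win 3 ∷ win 23 ∷ []

-- `crown 15` closes the branch in which each of the three further neighbours of the oldest vertex
-- has a leaf of its own; the mask consists of these leaves and the starting one.
open-pendant₃ : List Move
open-pendant₃ =
  cut 3 ∷ cut 6 ∷ cut 12 ∷ crown 15 ∷ new 1 ∷ win 3 ∷ win 39 ∷ win 39 ∷ cut 3 ∷ cut 6 ∷ new 0 ∷ win 3 ∷ win 15 ∷ win 15 ∷ win 15 ∷
  win 221 ∷ win 197 ∷ win 111 ∷ win 99 ∷ new 1 ∷ win 5 ∷ win 3 ∷ win 39 ∷ cut 5 ∷ cut 10 ∷ new 0 ∷ win 3 ∷ win 15 ∷ win 15 ∷ win 63 ∷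
  win 9 ∷ win 197 ∷ win 5 ∷ win 99 ∷ new 0 ∷ win 3 ∷ win 43 ∷ win 43 ∷ cut 3 ∷ cut 6 ∷ new 0 ∷ win 3 ∷ win 15 ∷ win 15 ∷ win 15 ∷
  win 237 ∷ win 197 ∷ win 119 ∷ win 99 ∷ new 0 ∷ win 9 ∷ win 3 ∷ win 43 ∷ cut 9 ∷ cut 18 ∷ new 0 ∷ win 3 ∷ win 15 ∷ win 15 ∷ win 95 ∷
  win 9 ∷ win 197 ∷ win 5 ∷ win 99 ∷ new 0 ∷ win 9 ∷ win 43 ∷ win 43 ∷ cut 9 ∷ cut 18 ∷ new 0 ∷ win 3 ∷ win 15 ∷ win 15 ∷ win 15 ∷
  win 197 ∷ win 197 ∷ win 99 ∷ win 99 ∷ new 0 ∷ win 9 ∷ win 9 ∷ win 43 ∷ cut 9 ∷ cut 18 ∷ new 0 ∷ win 3 ∷ win 3 ∷ win 3 ∷ win 95 ∷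
  win 197 ∷ win 197 ∷ win 99 ∷ win 99 ∷ new 0 ∷ win 5 ∷ win 5 ∷ new 0 ∷ win 63 ∷ win 3 ∷ win 63 ∷ cut 5 ∷ cut 10 ∷ new 0 ∷ win 3 ∷
  win 3 ∷ win 15 ∷ new 1 ∷ win 63 ∷ win 63 ∷ win 63 ∷ win 63 ∷ cut 5 ∷ cut 10 ∷ cut 96 ∷ new 2 ∷ win 3 ∷ win 3 ∷ win 291 ∷ win 291 ∷
  cut 3 ∷ cut 6 ∷ new 0 ∷ win 3 ∷ win 15 ∷ win 15 ∷ win 15 ∷ win 287 ∷ win 129 ∷ win 1541 ∷ win 65 ∷ win 771 ∷ new 2 ∷ win 3 ∷ win 3 ∷
  win 291 ∷ win 291 ∷ win 291 ∷ new 0 ∷ win 3 ∷ win 15 ∷ win 15 ∷ cut 3 ∷ cut 6 ∷ new 0 ∷ win 3 ∷ win 15 ∷ win 15 ∷ win 15 ∷ win 165 ∷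
  win 165 ∷ win 83 ∷ win 83 ∷ new 0 ∷ win 5 ∷ win 15 ∷ win 3 ∷ cut 192 ∷ cut 10 ∷ new 2 ∷ win 5 ∷ win 5 ∷ win 1157 ∷ win 1157 ∷
  win 1733 ∷ win 9 ∷ win 165 ∷ win 350 ∷ cut 10 ∷ new 0 ∷ win 3 ∷ win 15 ∷ win 3 ∷ cut 192 ∷ cut 6 ∷ new 2 ∷ win 5 ∷ win 5 ∷
  win 1157 ∷ win 1157 ∷ win 1733 ∷ win 17 ∷ win 165 ∷ win 350 ∷ new 0 ∷ win 3 ∷ win 15 ∷ win 3 ∷ win 15 ∷ new 0 ∷ win 3 ∷ win 23 ∷
  cut 3 ∷ cut 6 ∷ new 0 ∷ win 3 ∷ win 15 ∷ win 63 ∷ win 125 ∷ win 101 ∷ win 63 ∷ win 51 ∷ new 0 ∷ win 23 ∷ win 23 ∷ win 23 ∷ cut 5 ∷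
  cut 10 ∷ new 0 ∷ win 3 ∷ win 15 ∷ win 15 ∷ win 63 ∷ win 9 ∷ win 101 ∷ win 101 ∷ win 101 ∷ new 0 ∷ win 29 ∷ win 10 ∷ win 10 ∷
  win 10 ∷ win 10 ∷ win 10 ∷ win 10 ∷ win 51 ∷ win 51 ∷ win 51 ∷ new 0 ∷ win 23 ∷ win 23 ∷ cut 5 ∷ cut 10 ∷ new 0 ∷ win 3 ∷ win 3 ∷
  win 63 ∷ win 101 ∷ win 101 ∷ win 51 ∷ win 51 ∷ cut 6 ∷ new 1 ∷ win 3 ∷ win 3 ∷ new 0 ∷ win 63 ∷ win 3 ∷ win 63 ∷ cut 3 ∷ cut 6 ∷
  new 0 ∷ win 3 ∷ win 3 ∷ win 15 ∷ new 1 ∷ win 63 ∷ win 63 ∷ win 63 ∷ win 63 ∷ cut 3 ∷ cut 6 ∷ cut 96 ∷ new 2 ∷ win 3 ∷ win 3 ∷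
  win 323 ∷ win 323 ∷ cut 3 ∷ cut 6 ∷ new 0 ∷ win 3 ∷ win 15 ∷ win 15 ∷ win 15 ∷ win 543 ∷ win 257 ∷ win 1541 ∷ win 129 ∷ win 771 ∷
  new 2 ∷ win 3 ∷ win 3 ∷ win 323 ∷ win 323 ∷ win 323 ∷ new 0 ∷ win 3 ∷ win 15 ∷ win 15 ∷ cut 3 ∷ cut 6 ∷ new 0 ∷ win 3 ∷ win 15 ∷
  win 15 ∷ win 15 ∷ win 101 ∷ win 101 ∷ win 51 ∷ win 51 ∷ new 0 ∷ win 5 ∷ win 15 ∷ win 3 ∷ cut 192 ∷ cut 10 ∷ new 2 ∷ win 5 ∷ win 5 ∷
  win 1285 ∷ win 1285 ∷ win 1861 ∷ win 9 ∷ win 101 ∷ win 318 ∷ cut 6 ∷ new 0 ∷ win 3 ∷ win 15 ∷ win 3 ∷ cut 192 ∷ cut 6 ∷ new 2 ∷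
  win 5 ∷ win 5 ∷ win 1285 ∷ win 1285 ∷ win 1861 ∷ win 17 ∷ win 101 ∷ win 318 ∷ new 0 ∷ win 3 ∷ win 15 ∷ win 3 ∷ win 15 ∷ new 0 ∷
  win 23 ∷ win 23 ∷ win 23 ∷ cut 3 ∷ cut 6 ∷ new 0 ∷ win 3 ∷ win 15 ∷ win 15 ∷ win 63 ∷ win 17 ∷ win 101 ∷ win 101 ∷ win 101 ∷ new 0 ∷
  win 29 ∷ win 18 ∷ win 18 ∷ win 18 ∷ win 18 ∷ win 18 ∷ win 18 ∷ win 51 ∷ win 51 ∷ win 51 ∷ new 0 ∷ win 23 ∷ win 23 ∷ win 23 ∷ new 1 ∷
  win 9 ∷ win 51 ∷ win 51 ∷ win 51 ∷ new 0 ∷ win 3 ∷ win 3 ∷ win 15 ∷ win 15 ∷ win 92 ∷ win 92 ∷ win 92 ∷ win 102 ∷ win 92 ∷ win 92 ∷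
  win 92 ∷ win 92 ∷ win 46 ∷ win 46 ∷ cut 9 ∷ new 0 ∷ win 3 ∷ win 3 ∷ win 3 ∷ win 184 ∷ win 3 ∷ win 184 ∷ win 184 ∷ win 187 ∷
  win 184 ∷ win 184 ∷ win 184 ∷ new 1 ∷ cut 9 ∷ win 29 ∷ win 368 ∷ win 368 ∷ win 368 ∷ win 368 ∷ win 368 ∷ win 368 ∷ win 368 ∷
  win 368 ∷ win 368 ∷ win 368 ∷ win 368 ∷ win 368 ∷ win 368 ∷ win 368 ∷ win 368 ∷ win 368 ∷ win 368 ∷ win 368 ∷ win 368 ∷
  win 368 ∷ win 368 ∷ win 368 ∷ win 368 ∷ win 92 ∷ win 29 ∷ win 92 ∷ win 111 ∷ new 0 ∷ win 23 ∷ win 23 ∷ win 3 ∷ new 1 ∷ win 45 ∷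
  win 51 ∷ win 51 ∷ cut 5 ∷ cut 12 ∷ cut 192 ∷ new 2 ∷ win 3 ∷ win 3 ∷ win 3 ∷ win 720 ∷ win 720 ∷ win 720 ∷ win 720 ∷ win 977 ∷
  win 197 ∷ win 201 ∷ win 5 ∷ win 29 ∷ win 99 ∷ win 99 ∷ new 0 ∷ win 23 ∷ win 23 ∷ win 23 ∷ new 1 ∷ win 51 ∷ win 51 ∷ win 51 ∷ new 0 ∷
  win 27 ∷ win 27 ∷ win 27 ∷ win 27 ∷ win 90 ∷ win 90 ∷ win 90 ∷ win 102 ∷ win 90 ∷ win 90 ∷ win 92 ∷ win 92 ∷ cut 6 ∷ new 0 ∷
  win 23 ∷ win 23 ∷ cut 3 ∷ cut 6 ∷ new 0 ∷ win 3 ∷ win 3 ∷ win 63 ∷ win 101 ∷ win 101 ∷ win 51 ∷ win 51 ∷ new 0 ∷ win 23 ∷ win 23 ∷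
  win 23 ∷ new 1 ∷ win 51 ∷ win 51 ∷ win 51 ∷ new 0 ∷ win 27 ∷ win 27 ∷ win 27 ∷ win 27 ∷ win 90 ∷ win 90 ∷ win 90 ∷ win 102 ∷
  win 90 ∷ win 90 ∷ win 92 ∷ win 92 ∷ new 0 ∷ win 23 ∷ win 23 ∷ win 23 ∷ []

open-hub₂ : List Move
open-hub₂ =
  new 0 ∷ win 3 ∷ win 3 ∷ win 3 ∷ cut 3 ∷ new 2 ∷ win 3 ∷ win 9 ∷ win 3 ∷ win 3 ∷ win 3 ∷ cut 3 ∷ new 1 ∷ win 3 ∷ win 3 ∷ win 3 ∷ win 39 ∷
  win 24 ∷ win 24 ∷ win 18 ∷ win 3 ∷ cut 12 ∷ new 1 ∷ win 3 ∷ win 3 ∷ win 39 ∷ win 27 ∷ win 23 ∷ win 23 ∷ win 23 ∷ cut 6 ∷ new 0 ∷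
  win 5 ∷ win 3 ∷ win 5 ∷ win 15 ∷ new 0 ∷ win 3 ∷ win 15 ∷ win 3 ∷ win 15 ∷ new 0 ∷ win 5 ∷ win 15 ∷ win 5 ∷ win 15 ∷ cut 6 ∷ new 0 ∷
  win 3 ∷ win 3 ∷ win 15 ∷ win 15 ∷ new 0 ∷ win 3 ∷ win 15 ∷ win 3 ∷ win 15 ∷ new 0 ∷ win 15 ∷ win 3 ∷ win 3 ∷ win 15 ∷ new 1 ∷ win 5 ∷
  win 3 ∷ win 3 ∷ win 5 ∷ new 0 ∷ win 10 ∷ win 3 ∷ win 3 ∷ win 10 ∷ win 10 ∷ win 10 ∷ win 10 ∷ win 10 ∷ win 12 ∷ win 10 ∷ win 12 ∷
  cut 5 ∷ cut 12 ∷ cut 20 ∷ new 0 ∷ win 3 ∷ win 3 ∷ win 3 ∷ win 27 ∷ new 0 ∷ win 3 ∷ win 3 ∷ win 3 ∷ win 24 ∷ win 24 ∷ win 24 ∷ win 24 ∷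
  win 24 ∷ cut 5 ∷ win 20 ∷ win 24 ∷ win 20 ∷ cut 3 ∷ new 2 ∷ win 3 ∷ win 3 ∷ cut 3 ∷ new 1 ∷ win 3 ∷ win 3 ∷ win 23 ∷ win 23 ∷ win 18 ∷
  win 18 ∷ win 3 ∷ win 3 ∷ win 3 ∷ cut 9 ∷ new 2 ∷ win 3 ∷ win 23 ∷ win 23 ∷ win 3 ∷ win 45 ∷ win 5 ∷ win 5 ∷ new 0 ∷ win 3 ∷ win 12 ∷
  win 5 ∷ win 12 ∷ win 12 ∷ win 12 ∷ win 12 ∷ win 45 ∷ win 6 ∷ win 9 ∷ win 15 ∷ win 15 ∷ win 3 ∷ cut 3 ∷ new 2 ∷ win 3 ∷ win 39 ∷
  win 39 ∷ win 3 ∷ new 3 ∷ win 33 ∷ win 119 ∷ win 57 ∷ win 119 ∷ win 99 ∷ win 57 ∷ win 72 ∷ win 99 ∷ win 99 ∷ win 78 ∷ win 78 ∷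
  win 99 ∷ win 6 ∷ win 78 ∷ win 78 ∷ win 78 ∷ win 78 ∷ win 78 ∷ win 78 ∷ win 78 ∷ win 78 ∷ win 78 ∷ win 78 ∷ win 78 ∷ win 78 ∷
  win 78 ∷ win 78 ∷ win 78 ∷ win 78 ∷ win 78 ∷ win 78 ∷ cut 6 ∷ new 0 ∷ win 3 ∷ win 15 ∷ win 3 ∷ win 5 ∷ win 15 ∷ new 0 ∷ win 3 ∷
  win 3 ∷ win 15 ∷ win 3 ∷ win 15 ∷ new 0 ∷ win 5 ∷ win 5 ∷ win 3 ∷ win 3 ∷ win 15 ∷ new 1 ∷ win 39 ∷ win 39 ∷ win 39 ∷ win 39 ∷ new 0 ∷
  win 3 ∷ cut 3 ∷ new 0 ∷ win 9 ∷ win 3 ∷ win 9 ∷ win 27 ∷ win 27 ∷ win 9 ∷ win 27 ∷ win 3 ∷ new 0 ∷ win 5 ∷ win 5 ∷ win 5 ∷ win 27 ∷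
  win 5 ∷ win 27 ∷ win 27 ∷ cut 5 ∷ new 2 ∷ win 9 ∷ win 9 ∷ win 65 ∷ win 65 ∷ win 85 ∷ win 65 ∷ win 57 ∷ win 57 ∷ win 57 ∷ win 5 ∷
  win 51 ∷ win 51 ∷ win 3 ∷ new 0 ∷ win 3 ∷ win 3 ∷ win 5 ∷ win 5 ∷ win 3 ∷ new 2 ∷ win 6 ∷ win 9 ∷ win 6 ∷ win 27 ∷ win 6 ∷ win 6 ∷
  win 6 ∷ win 6 ∷ win 6 ∷ win 6 ∷ win 6 ∷ win 6 ∷ win 6 ∷ win 6 ∷ win 6 ∷ win 6 ∷ win 6 ∷ win 6 ∷ win 6 ∷ cut 3 ∷ new 1 ∷ win 3 ∷ win 3 ∷
  win 9 ∷ win 9 ∷ win 27 ∷ new 3 ∷ win 3 ∷ win 39 ∷ win 39 ∷ win 3 ∷ win 39 ∷ new 1 ∷ win 3 ∷ win 27 ∷ win 27 ∷ win 3 ∷ new 3 ∷ win 9 ∷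
  win 65 ∷ win 9 ∷ win 65 ∷ win 65 ∷ win 15 ∷ win 18 ∷ win 65 ∷ win 54 ∷ win 54 ∷ win 83 ∷ win 54 ∷ new 3 ∷ win 33 ∷ win 39 ∷ win 39 ∷
  win 33 ∷ win 39 ∷ win 27 ∷ win 27 ∷ win 27 ∷ win 27 ∷ win 27 ∷ win 27 ∷ win 27 ∷ cut 3 ∷ new 1 ∷ win 3 ∷ win 27 ∷ win 3 ∷ win 27 ∷
  win 27 ∷ new 2 ∷ win 3 ∷ win 63 ∷ win 63 ∷ win 3 ∷ win 63 ∷ new 1 ∷ win 3 ∷ win 27 ∷ win 9 ∷ win 3 ∷ win 27 ∷ new 1 ∷ win 9 ∷ win 27 ∷
  win 9 ∷ win 27 ∷ win 27 ∷ win 3 ∷ cut 3 ∷ new 2 ∷ win 3 ∷ win 27 ∷ win 27 ∷ win 27 ∷ win 3 ∷ new 2 ∷ win 54 ∷ win 15 ∷ win 57 ∷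
  win 9 ∷ win 15 ∷ win 9 ∷ win 18 ∷ win 15 ∷ win 15 ∷ win 15 ∷ win 54 ∷ win 18 ∷ win 18 ∷ win 6 ∷ win 15 ∷ win 54 ∷ win 54 ∷ win 54 ∷
  win 15 ∷ win 54 ∷ win 18 ∷ win 15 ∷ win 54 ∷ win 54 ∷ win 18 ∷ win 54 ∷ win 54 ∷ win 54 ∷ win 54 ∷ win 54 ∷ win 54 ∷ cut 24 ∷
  cut 12 ∷ new 0 ∷ win 3 ∷ win 9 ∷ win 9 ∷ win 3 ∷ win 9 ∷ win 27 ∷ new 0 ∷ win 3 ∷ win 3 ∷ win 3 ∷ win 27 ∷ win 3 ∷ win 27 ∷ new 0 ∷
  win 9 ∷ win 9 ∷ win 9 ∷ win 3 ∷ win 3 ∷ win 27 ∷ new 1 ∷ win 3 ∷ win 3 ∷ win 17 ∷ win 17 ∷ win 51 ∷ new 1 ∷ win 3 ∷ win 51 ∷ win 3 ∷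
  win 3 ∷ win 51 ∷ new 1 ∷ win 17 ∷ win 51 ∷ win 17 ∷ win 17 ∷ win 51 ∷ new 1 ∷ win 9 ∷ new 1 ∷ win 33 ∷ win 43 ∷ win 96 ∷ win 43 ∷
  win 18 ∷ win 99 ∷ win 99 ∷ win 54 ∷ win 99 ∷ win 54 ∷ win 119 ∷ win 54 ∷ win 54 ∷ win 119 ∷ win 27 ∷ win 27 ∷ cut 9 ∷ win 5 ∷
  new 0 ∷ win 3 ∷ win 27 ∷ win 27 ∷ win 195 ∷ win 3 ∷ win 10 ∷ win 10 ∷ win 27 ∷ win 123 ∷ win 27 ∷ win 27 ∷ win 123 ∷ win 43 ∷
  new 0 ∷ win 18 ∷ win 29 ∷ win 18 ∷ win 5 ∷ win 18 ∷ win 18 ∷ win 18 ∷ win 18 ∷ win 18 ∷ win 18 ∷ win 18 ∷ win 18 ∷ win 18 ∷ win 18 ∷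
  win 18 ∷ win 18 ∷ win 18 ∷ win 18 ∷ win 18 ∷ new 1 ∷ win 29 ∷ win 29 ∷ win 29 ∷ win 5 ∷ win 29 ∷ win 29 ∷ win 29 ∷ win 29 ∷ win 54 ∷
  win 29 ∷ win 54 ∷ win 29 ∷ win 54 ∷ win 29 ∷ win 54 ∷ win 54 ∷ win 54 ∷ win 54 ∷ win 63 ∷ win 27 ∷ win 27 ∷ win 27 ∷ new 2 ∷ win 3 ∷
  cut 3 ∷ win 18 ∷ win 18 ∷ win 18 ∷ win 3 ∷ new 2 ∷ win 3 ∷ win 23 ∷ win 3 ∷ win 3 ∷ win 23 ∷ win 23 ∷ win 18 ∷ win 23 ∷ win 3 ∷
  cut 3 ∷ win 18 ∷ win 18 ∷ win 18 ∷ new 2 ∷ win 23 ∷ win 23 ∷ win 23 ∷ win 23 ∷ win 23 ∷ cut 18 ∷ win 3 ∷ win 9 ∷ win 51 ∷ win 23 ∷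
  win 23 ∷ cut 18 ∷ new 0 ∷ win 15 ∷ win 15 ∷ win 5 ∷ win 6 ∷ win 6 ∷ win 15 ∷ win 46 ∷ win 46 ∷ win 15 ∷ win 15 ∷ win 95 ∷ win 46 ∷
  win 46 ∷ win 95 ∷ win 9 ∷ new 1 ∷ win 3 ∷ win 3 ∷ win 51 ∷ win 18 ∷ win 51 ∷ win 51 ∷ win 51 ∷ win 119 ∷ win 119 ∷ cut 9 ∷ new 1 ∷
  win 23 ∷ win 5 ∷ win 5 ∷ win 6 ∷ win 6 ∷ win 9 ∷ win 15 ∷ win 15 ∷ cut 12 ∷ new 1 ∷ win 3 ∷ win 3 ∷ win 3 ∷ win 39 ∷ win 27 ∷ new 1 ∷
  win 3 ∷ win 3 ∷ win 3 ∷ win 39 ∷ win 27 ∷ new 1 ∷ win 3 ∷ win 3 ∷ win 3 ∷ win 27 ∷ win 27 ∷ win 23 ∷ win 23 ∷ win 23 ∷ win 23 ∷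
  win 23 ∷ cut 6 ∷ new 0 ∷ win 15 ∷ win 15 ∷ win 5 ∷ win 15 ∷ new 0 ∷ win 3 ∷ win 15 ∷ win 3 ∷ win 3 ∷ win 15 ∷ new 0 ∷ win 5 ∷ win 15 ∷
  win 5 ∷ win 5 ∷ win 15 ∷ new 0 ∷ win 3 ∷ win 15 ∷ win 3 ∷ win 15 ∷ new 0 ∷ win 5 ∷ win 15 ∷ win 5 ∷ win 15 ∷ new 1 ∷ win 9 ∷ win 9 ∷
  cut 3 ∷ win 18 ∷ new 0 ∷ win 23 ∷ win 18 ∷ cut 12 ∷ win 18 ∷ win 18 ∷ win 3 ∷ win 3 ∷ win 23 ∷ cut 12 ∷ new 2 ∷ win 3 ∷ win 3 ∷
  win 3 ∷ win 3 ∷ win 27 ∷ new 1 ∷ win 23 ∷ win 18 ∷ win 3 ∷ win 23 ∷ win 3 ∷ win 3 ∷ win 23 ∷ cut 12 ∷ new 1 ∷ win 3 ∷ win 3 ∷ win 3 ∷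
  win 39 ∷ win 27 ∷ new 1 ∷ win 3 ∷ win 3 ∷ win 39 ∷ win 27 ∷ win 23 ∷ win 23 ∷ win 23 ∷ []

open-hub₃ : List Move
open-hub₃ =
  new 0 ∷ win 3 ∷ win 3 ∷ win 3 ∷ cut 3 ∷ cut 6 ∷ new 2 ∷ win 3 ∷ win 3 ∷ win 3 ∷ win 5 ∷ win 23 ∷ new 0 ∷ win 15 ∷ win 3 ∷ win 15 ∷
  win 15 ∷ new 0 ∷ win 3 ∷ win 15 ∷ win 3 ∷ win 3 ∷ win 15 ∷ new 0 ∷ win 15 ∷ win 15 ∷ win 15 ∷ win 15 ∷ cut 6 ∷ new 0 ∷ win 5 ∷
  win 15 ∷ win 5 ∷ win 5 ∷ win 15 ∷ new 0 ∷ win 3 ∷ win 3 ∷ win 5 ∷ win 3 ∷ win 15 ∷ new 0 ∷ win 3 ∷ win 15 ∷ win 3 ∷ win 3 ∷ win 15 ∷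
  new 0 ∷ win 5 ∷ win 15 ∷ win 5 ∷ win 5 ∷ win 15 ∷ cut 6 ∷ new 0 ∷ win 15 ∷ win 15 ∷ win 15 ∷ win 15 ∷ new 0 ∷ win 3 ∷ win 15 ∷ win 3 ∷
  win 3 ∷ win 15 ∷ new 0 ∷ win 15 ∷ win 15 ∷ win 15 ∷ win 15 ∷ new 1 ∷ win 5 ∷ win 3 ∷ win 5 ∷ win 3 ∷ win 5 ∷ win 5 ∷ cut 3 ∷ cut 6 ∷
  win 20 ∷ win 17 ∷ win 17 ∷ win 17 ∷ win 20 ∷ win 9 ∷ new 0 ∷ win 3 ∷ win 5 ∷ win 3 ∷ win 3 ∷ win 3 ∷ win 20 ∷ win 24 ∷ win 9 ∷
  win 10 ∷ cut 5 ∷ cut 12 ∷ cut 20 ∷ new 0 ∷ win 3 ∷ win 3 ∷ win 3 ∷ win 27 ∷ cut 10 ∷ win 24 ∷ win 24 ∷ win 24 ∷ win 15 ∷ win 15 ∷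
  cut 10 ∷ win 24 ∷ win 15 ∷ win 15 ∷ win 15 ∷ cut 10 ∷ win 24 ∷ win 15 ∷ win 15 ∷ win 15 ∷ cut 3 ∷ new 0 ∷ win 3 ∷ win 3 ∷ cut 3 ∷
  win 10 ∷ win 27 ∷ win 9 ∷ win 27 ∷ new 2 ∷ win 3 ∷ win 5 ∷ win 5 ∷ win 3 ∷ win 5 ∷ cut 5 ∷ win 5 ∷ new 0 ∷ win 5 ∷ win 43 ∷ win 3 ∷
  win 43 ∷ cut 3 ∷ new 2 ∷ win 3 ∷ win 3 ∷ win 23 ∷ win 3 ∷ win 43 ∷ win 27 ∷ win 27 ∷ win 27 ∷ new 2 ∷ win 5 ∷ win 5 ∷ win 5 ∷ win 5 ∷
  new 1 ∷ win 10 ∷ win 10 ∷ win 10 ∷ win 23 ∷ win 10 ∷ win 10 ∷ win 10 ∷ win 10 ∷ win 10 ∷ win 10 ∷ win 10 ∷ win 10 ∷ win 10 ∷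
  win 10 ∷ win 10 ∷ win 10 ∷ win 10 ∷ win 10 ∷ win 10 ∷ cut 5 ∷ new 1 ∷ win 3 ∷ win 63 ∷ win 3 ∷ win 3 ∷ win 63 ∷ win 5 ∷ win 5 ∷
  new 1 ∷ win 5 ∷ win 43 ∷ win 17 ∷ win 5 ∷ win 43 ∷ win 5 ∷ cut 5 ∷ new 0 ∷ win 3 ∷ win 3 ∷ win 3 ∷ win 15 ∷ win 15 ∷ new 0 ∷ win 3 ∷
  win 43 ∷ win 10 ∷ win 3 ∷ win 3 ∷ win 5 ∷ win 43 ∷ win 43 ∷ win 43 ∷ win 43 ∷ win 43 ∷ new 2 ∷ win 5 ∷ win 17 ∷ win 5 ∷ cut 17 ∷
  new 1 ∷ win 3 ∷ win 3 ∷ win 3 ∷ win 39 ∷ win 39 ∷ win 5 ∷ win 5 ∷ cut 5 ∷ new 0 ∷ win 15 ∷ win 3 ∷ win 15 ∷ win 3 ∷ win 15 ∷ win 85 ∷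
  win 39 ∷ win 5 ∷ win 5 ∷ win 39 ∷ cut 5 ∷ new 0 ∷ win 3 ∷ win 3 ∷ win 15 ∷ win 3 ∷ win 15 ∷ cut 5 ∷ win 34 ∷ new 1 ∷ win 10 ∷ win 10 ∷
  win 10 ∷ win 5 ∷ win 5 ∷ win 10 ∷ win 10 ∷ win 34 ∷ win 10 ∷ win 10 ∷ win 10 ∷ win 10 ∷ win 10 ∷ win 10 ∷ win 10 ∷ win 10 ∷ win 10 ∷
  win 10 ∷ win 10 ∷ win 10 ∷ win 10 ∷ win 10 ∷ win 10 ∷ win 10 ∷ win 10 ∷ win 10 ∷ win 10 ∷ win 10 ∷ win 10 ∷ win 10 ∷ win 10 ∷
  cut 5 ∷ new 2 ∷ win 39 ∷ win 39 ∷ win 39 ∷ win 85 ∷ win 39 ∷ win 85 ∷ win 39 ∷ win 39 ∷ win 39 ∷ win 39 ∷ cut 5 ∷ new 1 ∷ win 15 ∷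
  win 15 ∷ win 85 ∷ win 15 ∷ win 15 ∷ win 85 ∷ win 5 ∷ win 39 ∷ win 5 ∷ win 39 ∷ cut 5 ∷ new 3 ∷ win 83 ∷ win 83 ∷ win 83 ∷ win 83 ∷
  win 83 ∷ win 39 ∷ win 39 ∷ win 39 ∷ new 2 ∷ win 9 ∷ cut 3 ∷ win 18 ∷ win 17 ∷ win 27 ∷ win 27 ∷ new 1 ∷ win 3 ∷ win 23 ∷ win 23 ∷
  win 23 ∷ win 23 ∷ win 23 ∷ win 23 ∷ cut 18 ∷ win 51 ∷ win 3 ∷ win 3 ∷ cut 3 ∷ new 0 ∷ win 3 ∷ win 17 ∷ win 17 ∷ win 27 ∷ win 27 ∷
  win 3 ∷ cut 3 ∷ new 1 ∷ win 3 ∷ win 36 ∷ win 36 ∷ win 3 ∷ win 3 ∷ win 39 ∷ win 27 ∷ win 17 ∷ win 27 ∷ cut 3 ∷ win 18 ∷ new 1 ∷ win 9 ∷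
  win 3 ∷ win 36 ∷ win 9 ∷ win 3 ∷ win 39 ∷ win 18 ∷ win 18 ∷ new 2 ∷ win 23 ∷ win 23 ∷ win 23 ∷ win 23 ∷ win 23 ∷ win 23 ∷ win 23 ∷
  cut 3 ∷ win 9 ∷ win 51 ∷ win 51 ∷ win 53 ∷ cut 18 ∷ win 23 ∷ win 51 ∷ win 9 ∷ win 51 ∷ cut 18 ∷ win 23 ∷ win 9 ∷ win 46 ∷ win 46 ∷
  win 51 ∷ win 9 ∷ win 51 ∷ cut 3 ∷ win 9 ∷ win 9 ∷ win 51 ∷ win 53 ∷ cut 18 ∷ new 0 ∷ win 15 ∷ win 15 ∷ win 15 ∷ win 15 ∷ win 5 ∷
  win 15 ∷ win 15 ∷ win 15 ∷ win 46 ∷ win 46 ∷ win 46 ∷ win 15 ∷ win 15 ∷ win 46 ∷ win 95 ∷ win 95 ∷ win 95 ∷ win 95 ∷ win 95 ∷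
  win 51 ∷ win 9 ∷ new 1 ∷ win 51 ∷ win 51 ∷ win 51 ∷ win 51 ∷ win 51 ∷ win 51 ∷ win 51 ∷ win 51 ∷ win 51 ∷ win 51 ∷ win 119 ∷
  win 119 ∷ cut 3 ∷ new 1 ∷ win 9 ∷ win 27 ∷ win 17 ∷ win 17 ∷ win 27 ∷ cut 3 ∷ new 2 ∷ win 3 ∷ win 39 ∷ win 27 ∷ win 3 ∷ win 39 ∷
  win 3 ∷ win 27 ∷ new 1 ∷ win 39 ∷ win 39 ∷ win 39 ∷ win 39 ∷ win 39 ∷ cut 9 ∷ win 89 ∷ win 5 ∷ win 78 ∷ win 33 ∷ cut 18 ∷ new 0 ∷
  win 3 ∷ win 3 ∷ win 95 ∷ win 15 ∷ win 3 ∷ win 15 ∷ win 29 ∷ win 29 ∷ win 29 ∷ win 27 ∷ win 17 ∷ win 27 ∷ win 17 ∷ win 27 ∷ new 2 ∷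
  win 3 ∷ new 1 ∷ win 3 ∷ win 3 ∷ win 23 ∷ win 9 ∷ win 23 ∷ win 23 ∷ win 23 ∷ cut 3 ∷ win 36 ∷ win 36 ∷ win 27 ∷ win 27 ∷ new 1 ∷
  win 3 ∷ win 9 ∷ win 18 ∷ win 9 ∷ win 23 ∷ win 18 ∷ win 23 ∷ win 23 ∷ win 3 ∷ win 3 ∷ new 2 ∷ win 23 ∷ win 9 ∷ win 23 ∷ win 3 ∷
  win 23 ∷ win 9 ∷ win 23 ∷ win 23 ∷ win 23 ∷ win 23 ∷ win 23 ∷ win 3 ∷ cut 3 ∷ win 18 ∷ new 1 ∷ win 39 ∷ win 3 ∷ win 36 ∷ win 36 ∷
  win 3 ∷ win 39 ∷ win 18 ∷ win 18 ∷ cut 3 ∷ win 18 ∷ win 18 ∷ win 18 ∷ win 18 ∷ new 2 ∷ win 23 ∷ win 9 ∷ win 23 ∷ win 9 ∷ win 23 ∷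
  win 23 ∷ win 23 ∷ cut 3 ∷ win 51 ∷ win 51 ∷ win 51 ∷ win 27 ∷ win 27 ∷ win 27 ∷ win 23 ∷ win 23 ∷ win 23 ∷ cut 18 ∷ new 0 ∷ win 15 ∷
  win 15 ∷ win 15 ∷ win 15 ∷ win 5 ∷ win 15 ∷ win 15 ∷ win 15 ∷ win 46 ∷ win 15 ∷ win 46 ∷ win 15 ∷ win 15 ∷ win 15 ∷ win 95 ∷
  win 46 ∷ win 46 ∷ win 46 ∷ win 95 ∷ win 51 ∷ new 1 ∷ win 51 ∷ win 3 ∷ win 51 ∷ win 3 ∷ win 51 ∷ win 51 ∷ win 51 ∷ win 3 ∷ win 51 ∷
  win 51 ∷ win 119 ∷ win 119 ∷ new 1 ∷ win 3 ∷ win 51 ∷ win 51 ∷ win 51 ∷ win 51 ∷ win 51 ∷ win 51 ∷ win 51 ∷ win 51 ∷ win 51 ∷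
  win 119 ∷ win 119 ∷ new 4 ∷ win 27 ∷ win 5 ∷ win 27 ∷ win 5 ∷ win 27 ∷ win 5 ∷ win 27 ∷ win 27 ∷ win 27 ∷ win 27 ∷ cut 5 ∷ win 34 ∷
  win 5 ∷ win 45 ∷ win 5 ∷ win 34 ∷ win 27 ∷ win 27 ∷ win 27 ∷ win 27 ∷ cut 18 ∷ win 43 ∷ win 17 ∷ win 15 ∷ win 15 ∷ win 17 ∷ cut 9 ∷
  new 3 ∷ win 43 ∷ cut 33 ∷ win 5 ∷ win 33 ∷ win 43 ∷ win 43 ∷ cut 33 ∷ win 5 ∷ new 0 ∷ win 3 ∷ win 3 ∷ win 99 ∷ win 3 ∷ win 147 ∷
  win 147 ∷ win 147 ∷ win 99 ∷ win 99 ∷ win 99 ∷ win 45 ∷ win 221 ∷ cut 5 ∷ win 23 ∷ win 17 ∷ cut 9 ∷ new 0 ∷ win 3 ∷ win 15 ∷ win 3 ∷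
  win 3 ∷ win 15 ∷ new 0 ∷ win 15 ∷ win 15 ∷ win 3 ∷ win 6 ∷ win 27 ∷ win 15 ∷ win 15 ∷ win 3 ∷ win 15 ∷ win 15 ∷ win 198 ∷ win 15 ∷
  win 198 ∷ win 15 ∷ win 198 ∷ win 15 ∷ win 15 ∷ win 198 ∷ win 15 ∷ win 15 ∷ win 198 ∷ win 198 ∷ win 198 ∷ win 198 ∷ win 111 ∷
  win 111 ∷ win 33 ∷ win 9 ∷ win 15 ∷ win 15 ∷ win 15 ∷ win 15 ∷ new 4 ∷ win 3 ∷ win 53 ∷ win 9 ∷ win 53 ∷ win 3 ∷ new 0 ∷ win 71 ∷
  win 71 ∷ win 71 ∷ win 71 ∷ win 71 ∷ win 3 ∷ win 71 ∷ win 71 ∷ win 71 ∷ win 71 ∷ win 71 ∷ win 71 ∷ win 83 ∷ win 71 ∷ win 63 ∷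
  win 83 ∷ win 71 ∷ win 71 ∷ win 71 ∷ win 71 ∷ win 63 ∷ win 63 ∷ win 83 ∷ win 63 ∷ win 71 ∷ win 63 ∷ new 1 ∷ win 15 ∷ win 17 ∷
  win 15 ∷ win 15 ∷ win 15 ∷ win 15 ∷ win 15 ∷ win 15 ∷ win 15 ∷ new 3 ∷ win 65 ∷ win 65 ∷ win 65 ∷ win 23 ∷ win 65 ∷ win 23 ∷
  win 23 ∷ win 65 ∷ win 111 ∷ win 29 ∷ win 111 ∷ win 111 ∷ win 15 ∷ new 3 ∷ win 65 ∷ win 65 ∷ win 29 ∷ win 29 ∷ win 65 ∷ win 111 ∷
  win 29 ∷ win 111 ∷ win 65 ∷ win 111 ∷ win 29 ∷ win 111 ∷ win 111 ∷ win 15 ∷ win 15 ∷ win 15 ∷ new 0 ∷ new 1 ∷ win 17 ∷ win 3 ∷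
  win 17 ∷ win 6 ∷ win 6 ∷ win 17 ∷ win 6 ∷ win 15 ∷ new 0 ∷ win 5 ∷ win 27 ∷ win 5 ∷ win 5 ∷ win 5 ∷ win 27 ∷ win 5 ∷ cut 5 ∷ new 1 ∷
  win 17 ∷ win 51 ∷ win 51 ∷ win 51 ∷ win 3 ∷ win 3 ∷ win 3 ∷ cut 3 ∷ new 0 ∷ win 12 ∷ win 12 ∷ win 3 ∷ win 12 ∷ win 3 ∷ win 29 ∷
  win 29 ∷ win 12 ∷ win 29 ∷ new 2 ∷ win 17 ∷ win 17 ∷ win 17 ∷ win 15 ∷ win 17 ∷ win 17 ∷ win 15 ∷ win 15 ∷ new 1 ∷ win 34 ∷ win 34 ∷
  win 34 ∷ win 15 ∷ win 34 ∷ win 34 ∷ win 34 ∷ win 34 ∷ win 34 ∷ win 34 ∷ win 34 ∷ win 34 ∷ win 34 ∷ win 34 ∷ win 34 ∷ win 34 ∷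
  win 34 ∷ win 34 ∷ win 34 ∷ win 15 ∷ win 15 ∷ cut 17 ∷ win 30 ∷ win 29 ∷ win 15 ∷ win 30 ∷ cut 3 ∷ new 0 ∷ win 12 ∷ win 12 ∷ win 3 ∷
  win 3 ∷ win 12 ∷ win 12 ∷ win 12 ∷ win 29 ∷ cut 3 ∷ new 2 ∷ win 3 ∷ win 27 ∷ win 3 ∷ win 27 ∷ win 3 ∷ win 27 ∷ new 1 ∷ win 27 ∷
  win 27 ∷ win 9 ∷ win 27 ∷ win 27 ∷ new 1 ∷ win 9 ∷ win 27 ∷ win 9 ∷ win 27 ∷ win 27 ∷ new 1 ∷ win 9 ∷ cut 3 ∷ win 18 ∷ win 17 ∷
  win 17 ∷ win 27 ∷ new 0 ∷ win 5 ∷ win 3 ∷ win 5 ∷ new 1 ∷ win 51 ∷ win 9 ∷ win 36 ∷ win 36 ∷ win 36 ∷ win 36 ∷ win 36 ∷ win 36 ∷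
  win 36 ∷ win 36 ∷ win 36 ∷ cut 3 ∷ new 0 ∷ win 3 ∷ win 17 ∷ win 17 ∷ win 27 ∷ cut 9 ∷ new 1 ∷ win 15 ∷ win 9 ∷ win 17 ∷ win 15 ∷
  win 15 ∷ win 15 ∷ win 15 ∷ win 15 ∷ win 15 ∷ win 15 ∷ win 51 ∷ new 0 ∷ win 5 ∷ win 3 ∷ win 27 ∷ win 3 ∷ win 5 ∷ win 27 ∷ win 27 ∷
  win 27 ∷ cut 18 ∷ win 15 ∷ win 15 ∷ win 15 ∷ new 2 ∷ win 3 ∷ win 17 ∷ win 3 ∷ win 3 ∷ win 17 ∷ win 17 ∷ win 3 ∷ cut 3 ∷ win 34 ∷
  new 1 ∷ win 5 ∷ new 1 ∷ win 51 ∷ win 9 ∷ win 17 ∷ win 51 ∷ win 51 ∷ win 51 ∷ win 51 ∷ win 51 ∷ win 51 ∷ win 51 ∷ win 51 ∷ win 5 ∷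
  new 0 ∷ win 5 ∷ win 3 ∷ win 27 ∷ win 3 ∷ win 5 ∷ win 27 ∷ win 27 ∷ win 27 ∷ cut 3 ∷ win 51 ∷ win 51 ∷ win 51 ∷ win 33 ∷ cut 9 ∷
  new 2 ∷ win 3 ∷ win 15 ∷ win 3 ∷ win 3 ∷ win 3 ∷ new 1 ∷ win 5 ∷ win 6 ∷ win 5 ∷ win 5 ∷ win 5 ∷ win 6 ∷ win 5 ∷ win 66 ∷ win 66 ∷
  win 5 ∷ win 6 ∷ win 66 ∷ new 1 ∷ win 5 ∷ win 101 ∷ win 5 ∷ win 101 ∷ win 5 ∷ win 5 ∷ win 5 ∷ win 5 ∷ win 123 ∷ win 123 ∷ win 5 ∷
  win 123 ∷ win 123 ∷ win 123 ∷ win 5 ∷ win 123 ∷ win 123 ∷ new 2 ∷ win 5 ∷ win 6 ∷ win 5 ∷ win 5 ∷ win 5 ∷ win 6 ∷ win 5 ∷ win 5 ∷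
  win 6 ∷ win 5 ∷ win 6 ∷ win 123 ∷ cut 33 ∷ win 5 ∷ win 123 ∷ cut 9 ∷ new 1 ∷ win 3 ∷ win 3 ∷ win 3 ∷ win 75 ∷ win 51 ∷ cut 5 ∷ new 0 ∷
  win 15 ∷ win 15 ∷ win 3 ∷ win 15 ∷ win 53 ∷ win 23 ∷ win 5 ∷ win 23 ∷ new 0 ∷ win 27 ∷ win 27 ∷ win 27 ∷ win 27 ∷ win 5 ∷ win 27 ∷
  win 27 ∷ win 27 ∷ win 27 ∷ win 27 ∷ new 3 ∷ win 65 ∷ win 23 ∷ win 65 ∷ win 65 ∷ win 65 ∷ win 23 ∷ win 23 ∷ win 65 ∷ win 53 ∷
  win 123 ∷ win 123 ∷ win 123 ∷ new 3 ∷ win 65 ∷ win 53 ∷ win 65 ∷ win 53 ∷ win 65 ∷ win 53 ∷ win 123 ∷ win 123 ∷ win 65 ∷ win 53 ∷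
  win 123 ∷ win 123 ∷ win 123 ∷ new 0 ∷ win 27 ∷ win 27 ∷ win 27 ∷ win 27 ∷ win 3 ∷ win 27 ∷ win 27 ∷ win 27 ∷ new 1 ∷ win 9 ∷
  win 23 ∷ win 23 ∷ win 23 ∷ win 23 ∷ win 23 ∷ win 23 ∷ win 53 ∷ win 75 ∷ win 53 ∷ win 75 ∷ new 3 ∷ win 129 ∷ win 29 ∷ win 5 ∷
  win 29 ∷ win 129 ∷ win 169 ∷ win 29 ∷ win 139 ∷ win 129 ∷ win 243 ∷ win 29 ∷ win 243 ∷ win 243 ∷ win 27 ∷ win 27 ∷ new 3 ∷
  win 65 ∷ win 65 ∷ win 85 ∷ win 65 ∷ win 85 ∷ win 65 ∷ win 85 ∷ win 65 ∷ win 123 ∷ win 71 ∷ win 65 ∷ win 123 ∷ win 65 ∷ win 123 ∷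
  win 65 ∷ win 123 ∷ win 123 ∷ win 123 ∷ win 123 ∷ win 123 ∷ win 123 ∷ win 123 ∷ cut 65 ∷ new 2 ∷ win 89 ∷ win 89 ∷ win 89 ∷
  win 89 ∷ win 89 ∷ win 209 ∷ win 209 ∷ win 209 ∷ win 209 ∷ win 209 ∷ win 209 ∷ new 4 ∷ win 129 ∷ win 337 ∷ win 337 ∷ win 323 ∷
  win 129 ∷ win 337 ∷ win 225 ∷ win 129 ∷ win 225 ∷ win 225 ∷ win 225 ∷ win 323 ∷ win 323 ∷ win 225 ∷ win 323 ∷ win 225 ∷
  win 225 ∷ win 225 ∷ win 432 ∷ win 225 ∷ win 819 ∷ win 418 ∷ win 819 ∷ win 485 ∷ new 3 ∷ win 129 ∷ win 225 ∷ win 337 ∷ win 337 ∷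
  win 225 ∷ win 129 ∷ win 225 ∷ win 225 ∷ win 225 ∷ win 323 ∷ win 225 ∷ win 225 ∷ win 323 ∷ win 225 ∷ win 225 ∷ win 819 ∷
  win 873 ∷ win 819 ∷ new 4 ∷ win 1539 ∷ win 673 ∷ win 1539 ∷ win 449 ∷ win 449 ∷ win 1539 ∷ win 449 ∷ win 449 ∷ win 645 ∷
  win 323 ∷ win 1539 ∷ win 1539 ∷ win 1539 ∷ win 323 ∷ win 449 ∷ win 1443 ∷ win 1745 ∷ win 1415 ∷ win 1539 ∷ cut 449 ∷
  win 1541 ∷ win 3087 ∷ win 3143 ∷ []

-- Each `refl` makes the type checker replay a whole case tree.
open-refutations : Refutations 7 (λ _ → true)
open-refutations = record
  { pendants = λ { 0 _ → open-pendant₀ , refl ; 1 _ → open-pendant₁ , refl ; 2 _ → open-pendant₂ , refl ; 3 _ → open-pendant₃ , refl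
                 ; (suc (suc (suc (suc _)))) (s≤s (s≤s (s≤s ()))) }
  ; hub₂ = open-hub₂ , refl
  ; hub₃ = open-hub₃ , refl
  }

closed-refutations : Refutations 6 (_≤ᵇ 7)
closed-refutations = record
  { pendants = λ { 0 _ → closed-pendant₀ , refl ; 1 _ → closed-pendant₁ , refl ; 2 _ → closed-pendant₂ , refl ; 3 _ → closed-pendant₃ , refl
                 ; (suc (suc (suc (suc _)))) (s≤s (s≤s (s≤s ()))) }
  ; hub₂ = closed-hub₂ , refl
  ; hub₃ = closed-hub₃ , refl
  }

-- Order, low vertices and odd sets under deletion

open Vertices

order : Graph n → ℕ
order G = count (attached G)

low : Graph n → Fin n → Bool
low G z = attached G z ∧ (dg G z <ᵇ 4)

hasLow : Graph n → Bool
hasLow G = 0 <ᵇ count (low G)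

-- An odd number of neighbours is positive. Thus an odd set of a graph obtained by deletion avoids
-- the deleted vertices by itself.
Odd-attached : ∀ (G : Graph n) {s} → Odd G s → ∀ {z} → s z ≡ true → attached G z ≡ true
Odd-attached {n} G {s} o {z} h = attached⁺ G (proj₂ (proj₂ (into⁻ G s (odd⇒positive (o z h)))))
  where
  odd⇒positive : ∀ {m} → m % 2 ≡ 1 → 0 < m
  odd⇒positive {suc m} _ = s≤s z≤n

module _ (G : Graph n) (d : Fin n → Bool) where

  delete-dg : ∀ z → dg (delete G d) z ≤ dg G z
  delete-dg z = sum-mono {n} λ w → ⟦⟧-mono {Adj (delete G d) z w} {Adj G z w} (λ h → proj₁ (∧-true h))

  delete-attached : ∀ {z} → attached (delete G d) z ≡ true → attached G z ≡ true × d z ≡ false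
  delete-attached {z} h =
    let w , q = count-witness (Adj (delete G d) z) (positive⁻ h)
        a , b = ∧-true {Adj G z w} q
    in attached⁺ G a , not-true (proj₁ (∧-true b))

  -- The set contains no deleted vertex, and the deletion changes no adjacency between the others.
  delete-Odd : ∀ {s} → Odd (delete G d) s → Odd G s
  delete-Odd {s} o z h = trans (cong (_% 2) (sum-cong-≗ {n} same)) (o z h)
    where
    kept : ∀ {z} → s z ≡ true → d z ≡ false
    kept h = proj₂ (delete-attached (Odd-attached (delete G d) o h))
    same : ∀ w → ⟦ s w ⟧ * ⟦ Adj G z w ⟧ ≡ ⟦ s w ⟧ * ⟦ Adj (delete G d) z w ⟧
    same w with s w in eq
    ... | false = refl
    ... | true rewrite kept h | kept eq with Adj G z w
    ...   | true  = refl
    ...   | false = refl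

module _ (G : Graph n) {s t : Fin n → Bool} (disjoint : ∀ z → s z ≡ true → t z ≡ false) where

  union : Fin n → Bool
  union z = s z ∨ t z

  union-split : ∀ z → ⟦ union z ⟧ ≡ ⟦ s z ⟧ + ⟦ t z ⟧
  union-split z with s z in eq
  ... | true rewrite disjoint z eq = refl
  ... | false = refl

  union-count : count union ≡ count s + count t
  union-count = sum-+-≡ {n} union-split

  union-Odd : (∀ z w → s z ≡ true → t w ≡ true → Adj G z w ≡ false) → Odd G s → Odd G t → Odd G union
  union-Odd apart os ot z h with ∨-true {s z} h
  ... | inj₁ p = trans (cong (_% 2) (trans split (trans (cong (into G s z +_) none) (+-identityʳ _)))) (os z p)
    where
    split : into G union z ≡ into G s z + into G t z
    split = sum-+-≡ {n} λ w → trans (cong (_* ⟦ Adj G z w ⟧) (union-split w)) (*-distribʳ-+ ⟦ Adj G z w ⟧ ⟦ s w ⟧ _)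
    none : into G t z ≡ 0
    none = nonpositive⁻ (¬true⇒false λ q → let w , tw , a = into⁻ G t {z} (positive⁻ q) in true≢false a (apart z w p tw))
  ... | inj₂ p = trans (cong (_% 2) (trans split (cong (_+ into G t z) none))) (ot z p)
    where
    split : into G union z ≡ into G s z + into G t z
    split = sum-+-≡ {n} λ w → trans (cong (_* ⟦ Adj G z w ⟧) (union-split w)) (*-distribʳ-+ ⟦ Adj G z w ⟧ ⟦ s w ⟧ _)
    none : into G s z ≡ 0
    none = nonpositive⁻ (¬true⇒false λ q → let w , sw , a = into⁻ G s {z} (positive⁻ q) in
      true≢false (trans (sym G w z) a) (apart w z sw p))

_−_ : Graph n → (Fin n → Bool) → Graph n
G − s = delete G (reach G s)

order-split : ∀ (G : Graph n) s → order G ≡ order (G − s) + count (lost G s)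
order-split {n} G s = sum-+-≡ {n} λ z → part (attached G z) (attached (G − s) z) (λ h → proj₁ (delete-attached G (reach G s) {z} h))
  where
  part : ∀ a b → (b ≡ true → a ≡ true) → ⟦ a ⟧ ≡ ⟦ b ⟧ + ⟦ a ∧ not b ⟧
  part true  true  h = refl
  part true  false h = refl
  part false false h = refl
  part false true  h = ⊥-elim (true≢false (h refl) refl)

order-decreases : ∀ (G : Graph n) s → Odd G s → 0 < count s → order (G − s) < order G
order-decreases G s o p = subst (order (G − s) <_) (≡-sym (order-split G s)) (m<m+n _ lost>0)
  where
  lost>0 : 0 < count (lost G s)
  lost>0 = let z , h = count-witness s p in count-positive (lost G s) z (cong₂ _∧_ (Odd-attached G o h)
    (cong not (¬true⇒false λ a → true≢false (cong (_∨ (0 <ᵇ into G s z)) h) (proj₂ (delete-attached G (reach G s) {z} a)))))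

-- A surviving neighbour of a lost vertex would have lost an edge, hence have degree at most 3 and
-- be low. So the lost vertices form a union of components.
lost-closed : ∀ (G : Graph n) s → (∀ z → dg G z ≤ 4) → hasLow (G − s) ≡ false →
              ∀ {z w} → lost G s z ≡ true → Adj G z w ≡ true → lost G s w ≡ true
lost-closed {n} G s max-degree none {z} {w} l a with bool-cases (attached (G − s) w)
... | inj₂ q = cong₂ _∧_ (attached⁺ G (trans (sym G w z) a)) (cong not q)
... | inj₁ q = ⊥-elim (true≢false (attached⁺ (G − s) (trans (sym (G − s) z w) (⟦⟧≡1 kept))) (not-true (proj₂ (∧-true {attached G z} l))))
  where
  ⟦⟧≡1 : ∀ {b} → ⟦ b ⟧ ≡ 1 → b ≡ true
  ⟦⟧≡1 {true} _ = refl
  full : 4 ≤ dg (G − s) w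
  full = ≮⇒≥ λ h → true≢false (cong₂ _∧_ q (<ᵇ⁺ h)) (count-zero (low (G − s)) (nonpositive⁻ none) w)
  kept : ⟦ Adj (G − s) w z ⟧ ≡ 1
  kept = trans (sum-squeeze {n} (λ x → ⟦⟧-mono {Adj (G − s) w x} {Adj G w x} (λ h → proj₁ (∧-true h)))
    (≤-trans (max-degree w) full) z) (cong ⟦_⟧ (trans (sym G w z) a))

-- Deciding and combining reductions

anyPredicate? : {P : (Fin n → Bool) → Set} → (∀ {s t} → (∀ z → s z ≡ t z) → P s → P t) →
                (∀ s → Dec (P s)) → Dec (∃ P)
anyPredicate? resp P? = map′ (λ (S , p) → lookup S , p)
  -- A set and its tabulation agree only pointwise, which is why `P` has to respect pointwise
  -- equality.
  (λ (s , p) → Vec.tabulate s , resp (λ z → ≡-sym (lookup∘tabulate s z)) p)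
  (anySubset? (λ S → P? (lookup S)))

Odd? : ∀ (G : Graph n) s → Dec (Odd G s)
Odd? G s = all? λ z → (s z Bool.≟ true) →-dec (into G s z % 2 ℕ.≟ 1)

module _ (G : Graph n) {s t : Fin n → Bool} (same : ∀ z → s z ≡ t z) where

  count-cong : count s ≡ count t
  count-cong = sum-cong-≗ {n} λ z → cong ⟦_⟧ (same z)

  into-cong : ∀ z → into G s z ≡ into G t z
  into-cong z = sum-cong-≗ {n} λ w → cong (λ b → ⟦ b ⟧ * ⟦ Adj G z w ⟧) (same w)

  Odd-cong : Odd G s → Odd G t
  Odd-cong o z h = trans (cong (_% 2) (≡-sym (into-cong z))) (o z (trans (same z) h))

  dg-cong : ∀ z → dg (G − s) z ≡ dg (G − t) z
  dg-cong z = sum-cong-≗ {n} λ w → cong₂ (λ a b → ⟦ Adj G z w ∧ (not a ∧ not b) ⟧) (reach-cong z) (reach-cong w)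
    where
    reach-cong : ∀ z → reach G s z ≡ reach G t z
    reach-cong z = cong₂ (λ a m → a ∨ (0 <ᵇ m)) (same z) (into-cong z)

  order-cong : order (G − s) ≡ order (G − t)
  order-cong = sum-cong-≗ {n} λ z → cong (λ m → ⟦ 0 <ᵇ m ⟧) (dg-cong z)

  hasLow-cong : hasLow (G − s) ≡ hasLow (G − t)
  hasLow-cong = cong (0 <ᵇ_) (sum-cong-≗ {n} λ z → cong (λ m → ⟦ (0 <ᵇ m) ∧ (m <ᵇ 4) ⟧) (dg-cong z))

  lost-cong : count (lost G s) ≡ count (lost G t)
  lost-cong = sum-cong-≗ {n} λ z → cong (λ m → ⟦ attached G z ∧ not (0 <ᵇ m) ⟧) (dg-cong z)

-- The right side is what the induction gives for `G − s`. By `order-split` the inequality says 2 ·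
-- lost + 2 ≤ 7|s|, with 2 added on the right if a low vertex survives.
Reducing : Graph n → (Fin n → Bool) → Set
Reducing G s = Odd G s × 0 < count s ×
  2 * order G + 2 ≤ 7 * count s + (2 * order (G − s) + 2 * ⟦ hasLow (G − s) ⟧)

Reducing? : ∀ (G : Graph n) → Dec (∃ (Reducing G))
Reducing? G = anyPredicate?
  (λ e (o , p , q) → Odd-cong G e o , subst (0 <_) (count-cong G e) p ,
    subst (2 * order G + 2 ≤_) (cong₂ _+_ (cong (7 *_) (count-cong G e))
      (cong₂ (λ a b → 2 * a + 2 * ⟦ b ⟧) (order-cong G e) (hasLow-cong G e))) q)
  (λ s → Odd? G s ×-dec (0 ℕ.<? count s) ×-dec (_ ≤? _))

-- An odd set of order 2 is an edge. Without a reducing set, `lost>6` makes the number of lost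
-- vertices exactly 7.
SmallEdge : Graph n → (Fin n → Bool) → Set
SmallEdge G s = Odd G s × count s ≡ 2 × count (lost G s) ≤ 7

SmallEdge? : ∀ (G : Graph n) → Dec (∃ (SmallEdge G))
SmallEdge? G = anyPredicate?
  (λ e (o , p , q) → Odd-cong G e o , trans (≡-sym (count-cong G e)) p , subst (_≤ 7) (lost-cong G e) q)
  (λ s → Odd? G s ×-dec (count s ℕ.≟ 2) ×-dec (_ ≤? _))

Large : Graph n → Set
Large G = ∃ λ s → Odd G s × 2 * order G + 2 * ⟦ hasLow G ⟧ ≤ 7 * count s

reduce : ∀ (G : Graph n) {s} → Reducing G s → Large (G − s) → ∃ λ t → Odd G t × 2 * order G + 2 ≤ 7 * count t
reduce G {s} (os , _ , q) (t , ot , r) = union G disjoint , union-Odd G disjoint apart os ot′ , (begin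
  2 * order G + 2                    ≤⟨ q ⟩
  7 * count s + _                    ≤⟨ +-monoʳ-≤ (7 * count s) r ⟩
  7 * count s + 7 * count t          ≡⟨ *-distribˡ-+ 7 (count s) (count t) ⟨
  7 * (count s + count t)            ≡⟨ cong (7 *_) (union-count G disjoint) ⟨
  7 * count (union G disjoint)       ∎)
  where
  open ≤-Reasoning
  ot′ : Odd G t
  ot′ = delete-Odd G (reach G s) {t} ot
  far : ∀ {w} → t w ≡ true → reach G s w ≡ false
  far h = proj₂ (delete-attached G (reach G s) (Odd-attached (G − s) ot h))
  disjoint : ∀ z → s z ≡ true → t z ≡ false
  disjoint z h = ¬true⇒false λ tz → true≢false (cong (_∨ (0 <ᵇ into G s z)) h) (far tz)
  apart : ∀ z w → s z ≡ true → t w ≡ true → Adj G z w ≡ false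
  apart z w h tw = ¬true⇒false λ a → true≢false (∨-trueʳ {s w} (positive⁺ (into⁺ G s {w} {z} h (trans (sym G w z) a)))) (far tw)

module Separate (G : Graph n) {s} (closed : ∀ {z w} → lost G s z ≡ true → Adj G z w ≡ true → lost G s w ≡ true) where

  part : Graph n
  part = delete G (not ∘ lost G s)

  not-not : ∀ {a} → not a ≡ false → a ≡ true
  not-not {true} _ = refl

  part-attached : ∀ {z} → attached part z ≡ true → lost G s z ≡ true
  part-attached {z} h = not-not (proj₂ (delete-attached G (not ∘ lost G s) {z} h))

  part-dg : ∀ {z} → lost G s z ≡ true → dg part z ≡ dg G z
  part-dg {z} h = sum-cong-≗ {n} λ w → cong ⟦_⟧ (same w)
    where
    same : ∀ w → Adj part z w ≡ Adj G z w
    same w with Adj G z w in eq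
    ... | false = refl
    ... | true rewrite h | closed h eq = refl

  part-order : order part ≡ count (lost G s)
  part-order = sum-cong-≗ {n} λ z → cong ⟦_⟧ (iff (part-attached {z}) λ h →
    positive⁺ (subst (0 <_) (≡-sym (part-dg h)) (positive⁻ (proj₁ (∧-true {attached G z} h)))))
    where
    iff : ∀ {a b} → (a ≡ true → b ≡ true) → (b ≡ true → a ≡ true) → a ≡ b
    iff {true}  {b}     f g = ≡-sym (f refl)
    iff {false} {false} f g = refl
    iff {false} {true}  f g = g refl

  -- A single extra 2 is required, and it comes from `part`; the one that `G − s` might offer is
  -- dropped.
  rejoin : ∀ {t} → Odd part t → 2 * order part + 2 ≤ 7 * count t → Large (G − s) →
            ∃ λ u → Odd G u × 2 * order G + 2 ≤ 7 * count u
  rejoin {t} ot p (r , or , q) = union G disjoint , union-Odd G disjoint apart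
    (delete-Odd G (not ∘ lost G s) {t} ot) (delete-Odd G (reach G s) {r} or) , (begin
    2 * order G + 2                                       ≡⟨ cong (λ m → 2 * m + 2) (order-split G s) ⟩
    2 * (order (G − s) + count (lost G s)) + 2             ≡⟨ cong (_+ 2) (*-distribˡ-+ 2 (order (G − s)) _) ⟩
    2 * order (G − s) + 2 * count (lost G s) + 2           ≡⟨ +-assoc (2 * order (G − s)) _ 2 ⟩
    2 * order (G − s) + (2 * count (lost G s) + 2)         ≤⟨ +-mono-≤ (≤-trans (m≤m+n (2 * order (G − s)) _) q) (subst (λ m → 2 * m + 2 ≤ 7 * count t) part-order p) ⟩
    7 * count r + 7 * count t                             ≡⟨ +-comm (7 * count r) _ ⟩
    7 * count t + 7 * count r                             ≡⟨ *-distribˡ-+ 7 (count t) (count r) ⟨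
    7 * (count t + count r)                               ≡⟨ cong (7 *_) (union-count G disjoint) ⟨
    7 * count (union G disjoint)                          ∎)
    where
    open ≤-Reasoning
    inside : ∀ {z} → t z ≡ true → lost G s z ≡ true
    inside h = part-attached (Odd-attached part ot h)
    outside : ∀ {z} → r z ≡ true → lost G s z ≡ true → ⊥
    outside {z} h l = true≢false (Odd-attached (G − s) or h) (not-true (proj₂ (∧-true {attached G z} l)))
    disjoint : ∀ z → t z ≡ true → r z ≡ false
    disjoint z h = ¬true⇒false λ rz → outside rz (inside h)
    apart : ∀ z w → t z ≡ true → r w ≡ true → Adj G z w ≡ false
    apart z w h rw = ¬true⇒false λ a → outside rw (closed (inside h) a)

-- Graphs without a reducing set

module Irreducible (G : Graph n) (max-degree : ∀ z → dg G z ≤ 4) (irreducible : ¬ ∃ (Reducing G)) where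

  strict : ∀ s → Odd G s → 0 < count s → 7 * count s + 2 * ⟦ hasLow (G − s) ⟧ < 2 * count (lost G s) + 2
  strict s o p = +-cancelˡ-< (2 * order (G − s)) _ _ (begin-strict
    2 * order (G − s) + (7 * count s + 2 * ⟦ hasLow (G − s) ⟧)  ≡⟨ +-comm-assoc (2 * order (G − s)) (7 * count s) _ ⟩
    7 * count s + (2 * order (G − s) + 2 * ⟦ hasLow (G − s) ⟧)  <⟨ ≰⇒> (λ q → irreducible (s , o , p , q)) ⟩
    2 * order G + 2                                         ≡⟨ cong (λ m → 2 * m + 2) (order-split G s) ⟩
    2 * (order (G − s) + count (lost G s)) + 2               ≡⟨ cong (_+ 2) (*-distribˡ-+ 2 (order (G − s)) _) ⟩
    2 * order (G − s) + 2 * count (lost G s) + 2             ≡⟨ +-assoc (2 * order (G − s)) _ 2 ⟩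
    2 * order (G − s) + (2 * count (lost G s) + 2)           ∎)
    where
    open ≤-Reasoning
    +-comm-assoc : ∀ a b c → a + (b + c) ≡ b + (a + c)
    +-comm-assoc a b c = trans (≡-sym (+-assoc a b c)) (trans (cong (_+ c) (+-comm a b)) (+-assoc b a c))

  H : ∀ s → Odd G s → 0 < count s → 7 * count s < 2 * count (lost G s) + 2
  H s o p = ≤-<-trans (m≤m+n _ _) (strict s o p)

  lost>6 : ∀ s → Odd G s → count s ≡ 2 → 6 < count (lost G s)
  lost>6 s o e = *-cancelˡ-< 2 6 _ (+-cancelʳ-< 2 _ _ (subst (λ c → 7 * c < 2 * count (lost G s) + 2) e
    (H s o (subst (0 <_) (≡-sym e) (s≤s z≤n)))))

  -- With a surviving low vertex, 7 · 2 + 2 = 2 · 7 + 2 would make the edge reducing.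
  small-edge-closed : ∀ {s} → SmallEdge G s → hasLow (G − s) ≡ false
  small-edge-closed {s} (o , e , l) = ¬true⇒false λ h → <⇒≱
    (subst₂ (λ c b → 7 * c + 2 * ⟦ b ⟧ < 2 * count (lost G s) + 2) e h (strict s o (subst (0 <_) (≡-sym e) (s≤s z≤n))))
    (+-monoˡ-≤ 2 (*-monoʳ-≤ 2 l))

  module _ {u} (au : attached G u ≡ true) (du : dg G u ≤ 3) where

    -- Edges have the stricter limit 6 here; in return all cases with more than seven vertices are
    -- skipped.
    not-tiny : order G ≤ 7 → ⊥
    not-tiny N≤7 = Local.no-low G max-degree 6 (_≤ᵇ 7) (λ m h → ≤ᵇ⁺ (≤-trans h N≤7)) H lost>6 closed-refutations au du

    small-edge-exists : ¬ ∃ (SmallEdge G) → ⊥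
    small-edge-exists none = Local.no-low G max-degree 7 (λ _ → true) (λ _ _ → refl) H
      (λ s o e → ≰⇒> λ l → none (s , o , e , l)) open-refutations au du

    -- Degrees only fall, so a surviving `u` would still be low.
    still-low : ∀ {s} → hasLow (G − s) ≡ false → lost G s u ≡ true
    still-low {s} none with bool-cases (attached (G − s) u)
    ... | inj₂ q = cong₂ _∧_ au (cong not q)
    ... | inj₁ q = ⊥-elim (true≢false (cong₂ _∧_ q (<ᵇ⁺ (≤-<-trans (delete-dg G (reach G s) u) (s≤s du))))
                                      (count-zero (low (G − s)) (nonpositive⁻ none) u))

low-witness : ∀ (G : Graph n) → hasLow G ≡ true → ∃ λ u → attached G u ≡ true × dg G u ≤ 3
low-witness G h = let u , q = count-witness (low G) (positive⁻ h) ; a , b = ∧-true {attached G u} q in u , a , s≤s⁻¹ (<ᵇ⁻ b)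

-- Regular graphs and the induction

module Regular (G : Graph n) (max-degree : ∀ z → dg G z ≤ 4) (regular : hasLow G ≡ false)
               {y} (ay : attached G y ≡ true) where

  full : ∀ {z} → attached G z ≡ true → dg G z ≡ 4
  full {z} a = ≤-antisym (max-degree z) (≮⇒≥ λ h →
    true≢false (cong₂ _∧_ a (<ᵇ⁺ h)) (count-zero (low G) (nonpositive⁻ regular) z))

  rest : Graph n
  rest = delete G (_== y)

  rest-dg : ∀ {z} → z ≢ y → dg G z ≡ dg rest z + ⟦ Adj G z y ⟧
  rest-dg {z} z≢y = trans (sum-+-≡ {n} point) (trans (cong (dg rest z +_) (sum-point y (λ w → ⟦ Adj G z w ⟧))) refl)
    where
    point : ∀ w → ⟦ Adj G z w ⟧ ≡ ⟦ Adj rest z w ⟧ + ⟦ w == y ⟧ * ⟦ Adj G z w ⟧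
    point w rewrite ≢⇒== z≢y with Adj G z w | w == y
    ... | true  | true  = refl
    ... | true  | false = refl
    ... | false | true  = refl
    ... | false | false = refl

  rest-dg≥3 : ∀ {z} → z ≢ y → attached G z ≡ true → 3 ≤ dg rest z
  rest-dg≥3 {z} z≢y a = +-cancelʳ-≤ 1 _ _ (≤-trans (≤-reflexive (trans (≡-sym (full a)) (rest-dg z≢y)))
    (+-monoʳ-≤ (dg rest z) (⟦⟧≤1 (Adj G z y))))
    where
    ⟦⟧≤1 : ∀ b → ⟦ b ⟧ ≤ 1
    ⟦⟧≤1 true  = ≤-refl
    ⟦⟧≤1 false = z≤n

  rest-order : order G ≡ 1 + order rest
  rest-order = trans (sum-+-≡ {n} point) (cong (_+ order rest) (sum-point y (λ _ → 1)))
    where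
    point : ∀ z → ⟦ attached G z ⟧ ≡ ⟦ z == y ⟧ * 1 + ⟦ attached rest z ⟧
    point z with bool-cases (z == y)
    ... | inj₁ e = trans (cong ⟦_⟧ (trans (cong (attached G) (==⇒≡ e)) ay))
                     (≡-sym (cong₂ (λ a b → ⟦ a ⟧ * 1 + ⟦ b ⟧) e (¬true⇒false λ h →
                       true≢false e (proj₂ (delete-attached G (_== y) {z} h)))))
    ... | inj₂ e = trans (cong ⟦_⟧ (helper (bool-cases (attached G z))))
                     (≡-sym (cong (λ a → ⟦ a ⟧ * 1 + ⟦ attached rest z ⟧) e))
      where
      z≢y : z ≢ y
      z≢y refl = true≢false (==-refl z) e
      helper : attached G z ≡ true ⊎ attached G z ≡ false → attached G z ≡ attached rest z
      helper (inj₁ a) = trans a (≡-sym (positive⁺ {dg rest z} (≤-trans (s≤s z≤n) (rest-dg≥3 z≢y a))))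
      helper (inj₂ a) = trans a (≡-sym (¬true⇒false λ h → true≢false (proj₁ (delete-attached G (_== y) {z} h)) a))

  rest-low : hasLow rest ≡ true
  rest-low = let w , a = count-witness (Adj G y) (positive⁻ ay)
                 wy = trans (sym G w y) a
                 w≢y : w ≢ y
                 w≢y = λ e → true≢false (subst (λ x → Adj G y x ≡ true) e a) (irrefl G y)
                 aw = attached⁺ G wy
             in positive⁺ (count-positive (low rest) w (cong₂ _∧_
                  (positive⁺ {dg rest w} (≤-trans (s≤s z≤n) (rest-dg≥3 w≢y aw)))
                  (<ᵇ⁺ (subst (dg rest w <_) (trans (≡-sym (rest-dg w≢y)) (full aw))
                    (m<m+n (dg rest w) (≤-reflexive (≡-sym (cong ⟦_⟧ wy))))))))

  -- The order falls by exactly 1, since the other vertices keep degree at least 3, and the 2 paid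
  -- for this is the extra 2 gained with the low neighbours of `y`.
  extend : Large rest → Large G
  extend (s , o , q) = s , delete-Odd G (_== y) {s} o , ≤-trans (≤-reflexive eq) q
    where
    eq : 2 * order G + 2 * ⟦ hasLow G ⟧ ≡ 2 * order rest + 2 * ⟦ hasLow rest ⟧
    eq rewrite regular | rest-low | rest-order = trans (+-identityʳ _) (trans (*-distribˡ-+ 2 1 (order rest)) (+-comm 2 _))

large : ∀ f (G : Graph n) → order G < f → (∀ z → dg G z ≤ 4) → Large G
large (suc f) G (s≤s N≤f) max-degree with hasLow G in hl
... | false with search (attached G)
...   | inj₂ none = (λ _ → false) , (λ z ()) , ≤-trans (≤-reflexive (cong (λ m → 2 * m + 0) (sum-zero λ z → cong ⟦_⟧ (none z)))) z≤n
...   | inj₁ (y , ay) = subst (λ b → ∃ λ s → Odd G s × 2 * order G + 2 * ⟦ b ⟧ ≤ 7 * count s) hl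
    (extend (large f rest (≤-trans (≤-reflexive (≡-sym rest-order)) N≤f) λ z → ≤-trans (delete-dg G (_== y) z) (max-degree z)))
  where open Regular G max-degree hl ay
large (suc f) G (s≤s N≤f) max-degree | true with Reducing? G
... | yes (s , red@(o , p , _)) =
  reduce G red (large f (G − s) (<-≤-trans (order-decreases G s o p) N≤f) λ z → ≤-trans (delete-dg G (reach G s) z) (max-degree z))
-- Small orders are treated apart because there the seven lost vertices could be the whole graph,
-- and the recursion on `part` would not descend.
... | no irreducible with order G ≤? 7 | SmallEdge? G | low-witness G hl
...   | yes N≤7 | _ | u , au , du = ⊥-elim (not-tiny au du N≤7)
  where open Irreducible G max-degree irreducible
...   | no _ | no none | u , au , du = ⊥-elim (small-edge-exists au du none)
  where open Irreducible G max-degree irreducible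
...   | no N≰7 | yes (s , edge@(o , e , l)) | u , au , du =
  -- Seven lost vertices are fewer than the order of `G`, so the induction applies to `part`, where
  -- `u` is still low.
  let t , ot , q = large f part (<-≤-trans (≤-<-trans (≤-trans (≤-reflexive part-order) l) (≰⇒> N≰7)) N≤f)
                     λ z → ≤-trans (delete-dg G (not ∘ lost G s) z) (max-degree z)
      s′ = large f (G − s) (<-≤-trans (order-decreases G s o (subst (0 <_) (≡-sym e) (s≤s z≤n))) N≤f)
             λ z → ≤-trans (delete-dg G (reach G s) z) (max-degree z)
  in rejoin ot (subst (λ b → 2 * order part + 2 * ⟦ b ⟧ ≤ 7 * count t) part-low q) s′
  where
  open Irreducible G max-degree irreducible
  no-low-left : hasLow (G − s) ≡ false
  no-low-left = small-edge-closed {s} edge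
  open Separate G {s} (λ {z} {w} → lost-closed G s max-degree no-low-left {z} {w})
  u-lost : lost G s u ≡ true
  u-lost = still-low au du {s} no-low-left
  part-low : hasLow part ≡ true
  part-low = positive⁺ (count-positive (low part) u (cong₂ _∧_
    (positive⁺ (subst (0 <_) (≡-sym (part-dg u-lost)) (positive⁻ au)))
    (<ᵇ⁺ (subst (_< 4) (≡-sym (part-dg u-lost)) (s≤s du)))))

-- Translation to subsets and the lower bound

∣∣≡count : (S : Subset n) → ∣ S ∣ ≡ count (lookup S)
∣∣≡count []          = refl
∣∣≡count (true ∷ S)  = cong suc (∣∣≡count S)
∣∣≡count (false ∷ S) = ∣∣≡count S

deg≡dg : ∀ (G : Graph n) v → deg G v ≡ dg G v
deg≡dg {n} G v = trans (∣∣≡count (nbhd G v)) (sum-cong-≗ {n} λ w → cong ⟦_⟧ (lookup∘tabulate (Adj G v) w))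

degIn≡into : ∀ (G : Graph n) S v → degIn G S v ≡ into G (lookup S) v
degIn≡into {n} G S v = trans (∣∣≡count (S ∩ nbhd G v)) (sum-cong-≗ {n} λ w →
  trans (cong ⟦_⟧ (trans (lookup-zipWith _∧_ w S (nbhd G v)) (cong (lookup S w ∧_) (lookup∘tabulate (Adj G v) w))))
        (⟦⟧-∧ (lookup S w) (Adj G v w)))

IsOddInduced⁻ : ∀ (G : Graph n) S → IsOddInduced G S → Odd G (lookup S)
IsOddInduced⁻ G S (_ , h) v q = trans (cong (_% 2) (≡-sym (degIn≡into G S v))) (h v (lookup⇒[]= v S q))

IsOddInduced⁺ : ∀ (G : Graph n) S → 0 < ∣ S ∣ → Odd G (lookup S) → IsOddInduced G S
IsOddInduced⁺ G S p o =
  (let v , h = count-witness (lookup S) (subst (0 <_) (∣∣≡count S) p) in v , lookup⇒[]= v S h) ,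
  λ v h → trans (cong (_% 2) (degIn≡into G S v)) (o v ([]=⇒lookup h))

∣tabulate∣ : (s : Fin n → Bool) → ∣ Vec.tabulate s ∣ ≡ count s
∣tabulate∣ {n} s = trans (∣∣≡count (Vec.tabulate s)) (sum-cong-≗ {n} λ z → cong ⟦_⟧ (lookup∘tabulate s z))

IsOddInduced-tabulate : ∀ (G : Graph n) {s} → 0 < count s → Odd G s → IsOddInduced G (Vec.tabulate s)
IsOddInduced-tabulate G {s} p o = IsOddInduced⁺ G (Vec.tabulate s) (subst (0 <_) (≡-sym (∣tabulate∣ s)) p)
  (Odd-cong G (λ z → ≡-sym (lookup∘tabulate s z)) o)

sum-const : ∀ k c → sum {k} (λ _ → c) ≡ k * c
sum-const zero    c = refl
sum-const (suc k) c = cong (c +_) (sum-const k c)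

lower-bound : (n : ℕ) → 1 ≤ n → (G : Graph n) → NoIsolated G → MaxDegAtMost 4 G →
              Σ (Subset n) (λ S → IsOddInduced G S × 2 * n ≤ 7 * ∣ S ∣)
lower-bound n n>0 G noIso maxDeg with large (suc (order G)) G ≤-refl (λ z → subst (_≤ 4) (deg≡dg G z) (maxDeg z))
... | s , o , q = Vec.tabulate s , IsOddInduced-tabulate G s>0 o , subst (λ c → 2 * n ≤ 7 * c) (≡-sym (∣tabulate∣ s)) bound
  where
  order≡n : order G ≡ n
  order≡n = trans (sum-cong-≗ {n} λ z → cong ⟦_⟧ (positive⁺ (subst (0 <_) (deg≡dg G z) (noIso z))))
                  (trans (sum-const n 1) (*-identityʳ n))
  bound : 2 * n ≤ 7 * count s
  bound = ≤-trans (m≤m+n (2 * n) _) (subst (λ N → 2 * N + 2 * ⟦ hasLow G ⟧ ≤ 7 * count s) order≡n q)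
  s>0 : 0 < count s
  s>0 = n≢0⇒n>0 λ e → <⇒≱ (*-monoʳ-< 2 n>0) (subst (λ c → 2 * n ≤ 7 * c) e bound)

-- Disjoint copies and sharpness

private variable
  m : ℕ

sum-++ : ∀ m {k} (f : Fin (m + k) → ℕ) → sum f ≡ sum (λ i → f (i ↑ˡ k)) + sum (λ j → f (m ↑ʳ j))
sum-++ zero    f = refl
sum-++ (suc m) f = trans (cong (f zero +_) (sum-++ m (f ∘ suc))) (≡-sym (+-assoc (f zero) _ _))

sum-combine : ∀ m k (f : Fin (m * k) → ℕ) → sum f ≡ sum {k} (λ b → sum {m} (λ a → f (combine a b)))
sum-combine m k f = trans (rows m f) (∑-comm {m} {k} (λ a b → f (combine a b)))
  where
  rows : ∀ m (f : Fin (m * k) → ℕ) → sum f ≡ sum {m} (λ a → sum {k} (λ b → f (combine a b)))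
  rows zero    f = refl
  rows (suc m) f = trans (sum-++ k f) (cong (sum (λ b → f (b ↑ˡ (m * k))) +_) (rows m (λ j → f (k ↑ʳ j))))

==-sym : (i j : Fin n) → (i == j) ≡ (j == i)
==-sym i j with bool-cases (i == j)
... | inj₁ e = trans e (≡-sym (subst (λ x → (j == x) ≡ true) (≡-sym (==⇒≡ e)) (==-refl j)))
... | inj₂ e = trans e (≡-sym (≢⇒== {i = j} {i} λ q → true≢false (subst (λ x → (x == j) ≡ true) q (==-refl j)) e))

position : ∀ m k → Fin (m * k) → Fin m
position m k v = proj₁ (remQuot {m} k v)

layer : ∀ m k → Fin (m * k) → Fin k
layer m k v = proj₂ (remQuot {m} k v)

-- The vertex `combine a b` is the vertex a of the copy b.
copies : Graph m → ∀ k → Graph (m * k)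
copies {m} C k .Adj u v = Adj C (position m k u) (position m k v) ∧ (layer m k u == layer m k v)
copies {m} C k .sym u v = cong₂ _∧_ (sym C _ _) (==-sym (layer m k u) (layer m k v))
copies {m} C k .irrefl v = cong (_∧ (layer m k v == layer m k v)) (irrefl C (position m k v))

module _ (C : Graph m) (k : ℕ) where

  block : (Fin (m * k) → Bool) → Fin k → Fin m → Bool
  block s b a = s (combine a b)

  Adj-copies : ∀ a b a′ b′ → Adj (copies C k) (combine a b) (combine a′ b′) ≡ Adj C a a′ ∧ (b′ == b)
  Adj-copies a b a′ b′ = trans (cong₂ (λ p q → Adj C (proj₁ p) (proj₁ q) ∧ (proj₂ p == proj₂ q))
    (remQuot-combine {m} {k} a b) (remQuot-combine {m} {k} a′ b′)) (cong (Adj C a a′ ∧_) (==-sym b b′))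

  into-copies : ∀ s a b → into (copies C k) s (combine a b) ≡ into C (block s b) a
  into-copies s a b = begin
    into (copies C k) s (combine a b)
      ≡⟨ sum-combine m k _ ⟩
    sum {k} (λ b′ → sum {m} (λ a′ → ⟦ s (combine a′ b′) ⟧ * ⟦ Adj (copies C k) (combine a b) (combine a′ b′) ⟧))
      ≡⟨ sum-cong-≗ {k} (λ b′ → trans (sum-cong-≗ {m} (λ a′ → term a′ b′)) (≡-sym (*-distribˡ-sum {m} ⟦ b′ == b ⟧ _))) ⟩
    sum {k} (λ b′ → ⟦ b′ == b ⟧ * into C (block s b′) a)
      ≡⟨ sum-point b (λ b′ → into C (block s b′) a) ⟩
    into C (block s b) a ∎
    where
    open ≡-Reasoning
    term : ∀ a′ b′ → ⟦ s (combine a′ b′) ⟧ * ⟦ Adj (copies C k) (combine a b) (combine a′ b′) ⟧ ≡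
                     ⟦ b′ == b ⟧ * (⟦ block s b′ a′ ⟧ * ⟦ Adj C a a′ ⟧)
    term a′ b′ = trans (cong (⟦ s (combine a′ b′) ⟧ *_) (trans (cong ⟦_⟧ (Adj-copies a b a′ b′)) (⟦⟧-∧ (Adj C a a′) (b′ == b))))
      (trans (≡-sym (*-assoc ⟦ s (combine a′ b′) ⟧ _ _)) (*-comm _ ⟦ b′ == b ⟧))

  Odd-block : ∀ {s} → Odd (copies C k) s → ∀ b → Odd C (block s b)
  Odd-block {s} o b a h = trans (cong (_% 2) (≡-sym (into-copies s a b))) (o (combine a b) h)

  Odd-copies : ∀ {s} → (∀ b → Odd C (block s b)) → Odd (copies C k) s
  Odd-copies {s} o v h = trans (cong (λ x → into (copies C k) s x % 2) (≡-sym v≡))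
    (trans (cong (_% 2) (into-copies s a b)) (o b a (trans (cong s v≡) h)))
    where
    a = position m k v
    b = layer m k v
    v≡ : combine a b ≡ v
    v≡ = combine-remQuot {m} k v

  -- A degree is `into` of the full vertex set, so `into-copies` applies to degrees as well.
  deg-copies : ∀ v → deg (copies C k) v ≡ dg C (position m k v)
  deg-copies v = trans (deg≡dg (copies C k) v) (trans (cong (dg (copies C k)) (≡-sym (combine-remQuot {m} k v)))
    (trans (≡-sym (into-all (copies C k) (combine a b))) (trans (into-copies (λ _ → true) a b) (into-all C a))))
    where
    a = position m k v
    b = layer m k v
    into-all : ∀ {n} (G : Graph n) z → into G (λ _ → true) z ≡ dg G z
    into-all {n} G z = sum-cong-≗ {n} λ w → +-identityʳ ⟦ Adj G z w ⟧

C₇ᶜ : Graph 7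
C₇ᶜ = record
  { Adj    = adj
  ; sym    = from-yes (all? λ u → all? λ v → adj u v Bool.≟ adj v u)
  ; irrefl = from-yes (all? λ v → adj v v Bool.≟ false)
  }
  where
  adj : Fin 7 → Fin 7 → Bool
  -- `gap` is the difference modulo 7: the values 1 and 6 are the edges of the cycle, and 0 is a
  -- loop.
  adj u v = (1 <ᵇ gap) ∧ (gap <ᵇ 6)
    where gap = (toℕ u + (7 ∸ toℕ v)) % 7

C₇ᶜ-dg : ∀ v → dg C₇ᶜ v ≡ 4
C₇ᶜ-dg = from-yes (all? λ v → dg C₇ᶜ v ℕ.≟ 4)

-- Checked over all subsets. The reason: an odd set has even order, so its vertices have even degree
-- within the 7-cycle; being a proper subset, it spans only paths there, so it is independent in the
-- cycle. Hence its order is at most 3, and so at most 2.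
C₇ᶜ-Odd : ∀ s → Odd C₇ᶜ s → count s ≤ 2
C₇ᶜ-Odd s o with count s ≤? 2
... | yes p = p
... | no ¬p = ⊥-elim (from-no large-odd? (s , o , ≰⇒> ¬p))
  where
  large-odd? : Dec (∃ λ s → Odd C₇ᶜ s × 2 < count s)
  large-odd? = anyPredicate? (λ e (o , q) → Odd-cong C₇ᶜ e o , subst (2 <_) (count-cong C₇ᶜ e) q)
                             (λ s → Odd? C₇ᶜ s ×-dec (2 ℕ.<? count s))

-- Two vertices at distance 2 on the cycle, hence adjacent in the complement.
edge : Fin 7 → Bool
edge v = (toℕ v ≡ᵇ 0) ∨ (toℕ v ≡ᵇ 2)

sharpness : (k : ℕ) → 1 ≤ k → Σ (Graph (7 * k)) (λ G → NoIsolated G × MaxDegAtMost 4 G ×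
  Σ (Subset (7 * k)) (λ S → IsOddInduced G S × ∣ S ∣ ≡ 2 * k) ×
  ((T : Subset (7 * k)) → IsOddInduced G T → ∣ T ∣ ≤ 2 * k))
sharpness k k>0 = G , (λ v → subst (1 ≤_) (≡-sym (degree v)) (s≤s z≤n)) , (λ v → ≤-reflexive (degree v)) ,
  (Vec.tabulate s , IsOddInduced-tabulate G (subst (0 <_) (≡-sym count-s) (*-monoʳ-< 2 k>0)) s-Odd , trans (∣tabulate∣ s) count-s) ,
  upper
  where
  G : Graph (7 * k)
  G = copies C₇ᶜ k
  degree : ∀ v → deg G v ≡ 4
  degree v = trans (deg-copies C₇ᶜ k v) (C₇ᶜ-dg (position 7 k v))
  s : Fin (7 * k) → Bool
  s v = edge (position 7 k v)
  s-block : ∀ b a → edge a ≡ block C₇ᶜ k s b a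
  s-block b a = cong (λ p → edge (proj₁ p)) (≡-sym (remQuot-combine {7} {k} a b))
  edge-Odd : Odd C₇ᶜ edge
  edge-Odd = from-yes (Odd? C₇ᶜ edge)
  s-Odd : Odd G s
  s-Odd = Odd-copies C₇ᶜ k λ b → Odd-cong C₇ᶜ (s-block b) edge-Odd
  count-s : count s ≡ 2 * k
  count-s = trans (sum-combine 7 k (λ v → ⟦ s v ⟧)) (trans (sum-cong-≗ {k} λ b → ≡-sym (count-cong C₇ᶜ (s-block b)))
    (trans (sum-const k 2) (*-comm k 2)))
  upper : (T : Subset (7 * k)) → IsOddInduced G T → ∣ T ∣ ≤ 2 * k
  upper T odd = begin
    ∣ T ∣                                              ≡⟨ ∣∣≡count T ⟩
    count (lookup T)                                  ≡⟨ sum-combine 7 k (λ v → ⟦ lookup T v ⟧) ⟩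
    sum {k} (λ b → count (block C₇ᶜ k (lookup T) b))      ≤⟨ sum-mono {k} (λ b → C₇ᶜ-Odd _ (Odd-block C₇ᶜ k (IsOddInduced⁻ G T odd) b)) ⟩
    sum {k} (λ _ → 2)                                 ≡⟨ sum-const k 2 ⟩
    k * 2                                             ≡⟨ *-comm k 2 ⟩
    2 * k                                             ∎
    where open ≤-Reasoning

theorem1 : ((n : ℕ) → 1 ≤ n → (G : Graph n) → NoIsolated G → MaxDegAtMost 4 G →
    Σ (Subset n) (λ S → IsOddInduced G S × 2 * n ≤ 7 * ∣ S ∣))
    ×
    ((k : ℕ) → 1 ≤ k → Σ (Graph (7 * k)) (λ G → NoIsolated G × MaxDegAtMost 4 G ×
    Σ (Subset (7 * k)) (λ S → IsOddInduced G S × ∣ S ∣ ≡ 2 * k) ×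
    ((T : Subset (7 * k)) → IsOddInduced G T → ∣ T ∣ ≤ 2 * k)))
theorem1 = lower-bound , sharpness
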